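{- Let $m,n$ be positive integers. For every $(m\times n)$-transportation polytope $T_{rc}$ with $(r,c)\neq(0,0)$, the toric ideal of $T_{rc}$ has a squarefree reduced Gröbner basis in degree $\left\lfloor\frac{m\cdot n}{2}\right\rfloor$; that is, there is a term order for which the reduced Gröbner basis of the toric ideal of $T_{rc}$ is squarefree and all its elements have degree at most $\left\lfloor\frac{m\cdot n}{2}\right\rfloor$.
   Context: $\mathbb{N}=\{0,1,2,\dots\}$, $k$ is a field. Transportation polytope: for $r\in\mathbb{N}^m$, $c\in\mathbb{N}^n$, $$T_{rc}=\Big\{A\in\mathbb{R}_{\ge0}^{m\times n}\ \Big|\ \sum_{i=1}^m a_{ij}=c_j\ \forall j,\ \sum_{j=1}^n a_{ij}=r_i\ \forall i\Big\}.$$ It is a lattice polytope. Toric ideal: for a lattice polytope $P\subseteq\mathbb{R}^N$ put $\mathcal{A}=P\cap\mathbb{Z}^N$. The toric ideal $I_P$ is the kernel of the $k$-algebra homomorphism $k[x_a : a\in\mathcal{A}]\to k[t_1^{\pm1},\dots,t_N^{\pm1}]$, $x_a\mapsto t^a$. A Gröbner basis is squarefree if the leading term of each of its elements is a squarefree monomial (up to a scalar). -}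

module Defs where

open import Algebra.Apartness.Bundles using (HeytingField)
open import Algebra.Bundles.Raw using (RawSemiring)
import Algebra.Definitions.RawMonoid as RawMonoidDefs
import Algebra.Definitions.RawSemiring as RawSemiringDefs
open import Data.Bool.Base using (if_then_else_)
open import Data.Fin.Base using (Fin; zero; suc)
import Data.Fin.Properties as Fin
open import Data.Integer.Base as ℤ using (ℤ; +_; 0ℤ)
import Data.Integer.Properties as ℤ
open import Data.Irrelevant using ([_])
open import Data.List.Base as List using (List; []; _∷_; _++_; cartesianProductWith)
open import Data.List.Membership.Propositional using (_∈_)
open import Data.List.Membership.Propositional.Properties
  using (∈-cartesianProductWith⁺; ∈-map⁺; ∈-upTo⁺; ∈-lookup; ∈-deduplicate⁺)
open import Data.List.Relation.Unary.All as All using (All)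
open import Data.List.Relation.Unary.Any as Any using (here; there)
import Data.List.Relation.Unary.Any.Properties as Any
open import Data.List.Relation.Unary.AllPairs using (_∷_)
open import Data.List.Relation.Unary.Unique.Propositional using (Unique)
open import Data.List.Relation.Unary.Unique.DecPropositional.Properties using (deduplicate-!)
open import Data.Nat.Base as ℕ using (ℕ; suc)
import Data.Nat.Properties as ℕ
open import Data.Product.Base using (Σ-syntax; ∃-syntax; _×_; _,_; proj₁; proj₂)
open import Data.Refinement.Base using (Refinement-syntax; value; _,_)
open import Data.Vec.Base as Vec using (Vec; []; _∷_; lookup; concat; replicate; zipWith)
import Data.Vec.Properties as Vec
open import Data.Vec.Relation.Unary.All using () renaming (All to VecAll)
open import Function.Base using (_∘_)
open import Function.Bundles using (_↔_; mk↔ₛ′; Inverse)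
open import Level using (Level; _⊔_; 0ℓ)
open import Relation.Binary.Core using (Rel)
open import Relation.Binary.Definitions using (DecidableEquality)
open import Relation.Binary.PropositionalEquality
  using (_≡_; _≢_; refl; sym; trans; cong; subst)
open import Relation.Binary.Structures using (IsTotalOrder)
open import Relation.Nullary using (¬_; Dec; yes; no; does; contradiction; recompute)
open import Relation.Nullary.Decidable using (map′; _×-dec_)
open import Relation.Unary using (Pred; _≐_)

private
  variable
    a c ℓ ℓ₁ ℓ₂ : Level
    m n d N : ℕ

------------------------------------------------------------------------
-- Transportation polytopes and their lattice points

Matrix : Set a → ℕ → ℕ → Set a
Matrix A m n = Vec (Vec A n) m

entry : {A : Set a} → Matrix A m n → Fin m → Fin n → A
entry A i j = lookup (lookup A i) j

Σℤ : (Fin n → ℤ) → ℤ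
Σℤ = RawMonoidDefs.sum ℤ.+-0-rawMonoid

-- Only the integer matrices of the polytope enter the toric ideal, so its
-- defining inequalities and equations are imposed on integer matrices.
record InTransportationPolytope (r : Vec ℕ m) (s : Vec ℕ n) (A : Matrix ℤ m n) : Set where
  field
    nonNegative : ∀ i j → 0ℤ ℤ.≤ entry A i j
    columnSums  : ∀ j → Σℤ (λ i → entry A i j) ≡ + lookup s j
    rowSums     : ∀ i → Σℤ (λ j → entry A i j) ≡ + lookup r i

-- Membership is proof-irrelevant: two lattice points are equal as soon as
-- their matrices are.
LatticePoint : Vec ℕ m → Vec ℕ n → Set
LatticePoint {m} {n} r s = [ A ∈ Matrix ℤ m n ∣ InTransportationPolytope r s A ]

inTransportationPolytope? : (r : Vec ℕ m) (s : Vec ℕ n) (A : Matrix ℤ m n) →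
                            Dec (InTransportationPolytope r s A)
inTransportationPolytope? r s A =
  map′ (λ (p , q , t) → record { nonNegative = p ; columnSums = q ; rowSums = t })
       (λ T → let open InTransportationPolytope T in nonNegative , columnSums , rowSums)
       (Fin.all? (λ i → Fin.all? (λ j → 0ℤ ℤ.≤? entry A i j))
        ×-dec Fin.all? (λ j → Σℤ (λ i → entry A i j) ℤ.≟ + lookup s j)
        ×-dec Fin.all? (λ i → Σℤ (λ j → entry A i j) ℤ.≟ + lookup r i))

private
  ∈-unique : {A : Set} {x : A} {xs : List A} → Unique xs → (p q : x ∈ xs) → p ≡ q
  ∈-unique _ (here refl) (here refl) = refl
  ∈-unique (x∉ ∷ _) (here refl) (there q) = contradiction refl (All.lookup x∉ q)
  ∈-unique (x∉ ∷ _) (there p) (here refl) = contradiction refl (All.lookup x∉ p)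
  ∈-unique (_ ∷ u) (there p) (there q) = cong there (∈-unique u p q)

  index-∈-lookup : {A : Set} (xs : List A) (i : Fin (List.length xs)) →
                   Any.index (∈-lookup {xs = xs} i) ≡ i
  index-∈-lookup (x ∷ xs) zero    = refl
  index-∈-lookup (x ∷ xs) (suc i) = cong suc (index-∈-lookup xs i)

  listed⇒finite : {A : Set} → DecidableEquality A → (xs : List A) → (∀ x → x ∈ xs) →
                  Σ[ N ∈ ℕ ] (Fin N ↔ A)
  listed⇒finite {A} _≟_ xs complete =
    List.length ys ,
    mk↔ₛ′ (List.lookup ys) (λ x → Any.index (∈ys x))
      (λ x → sym (Any.lookup-index (∈ys x)))
      (λ i → trans (cong Any.index
                      (∈-unique (deduplicate-! _≟_ xs)
                        (∈ys (List.lookup ys i)) (∈-lookup {xs = ys} i)))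
                   (index-∈-lookup ys i))
    where
    ys : List A
    ys = List.deduplicate _≟_ xs

    ∈ys : ∀ x → x ∈ ys
    ∈ys x = ∈-deduplicate⁺ _≟_ (complete x)

  choices : {A : Set} → Vec (List A) n → List (Vec A n)
  choices []         = [] ∷ []
  choices (xs ∷ xss) = cartesianProductWith _∷_ xs (choices xss)

  ∈-choices : {A : Set} (xss : Vec (List A) n) (v : Vec A n) →
              (∀ i → lookup v i ∈ lookup xss i) → v ∈ choices xss
  ∈-choices []         []      _ = here refl
  ∈-choices (xs ∷ xss) (x ∷ v) p =
    ∈-cartesianProductWith⁺ _∷_ (p zero) (∈-choices xss v (p ∘ suc))

  Σℤ-nonNegative : (f : Fin n → ℤ) → (∀ i → 0ℤ ℤ.≤ f i) → 0ℤ ℤ.≤ Σℤ f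
  Σℤ-nonNegative {ℕ.zero} f p = ℤ.≤-refl
  Σℤ-nonNegative {suc n} f p =
    ℤ.+-mono-≤ (p zero) (Σℤ-nonNegative (f ∘ suc) (p ∘ suc))

  term≤Σℤ : (f : Fin n → ℤ) → (∀ i → 0ℤ ℤ.≤ f i) → ∀ i → f i ℤ.≤ Σℤ f
  term≤Σℤ f p zero =
    subst (ℤ._≤ Σℤ f) (ℤ.+-identityʳ _) (ℤ.+-monoʳ-≤ (f zero) (Σℤ-nonNegative (f ∘ suc) (p ∘ suc)))
  term≤Σℤ f p (suc i) =
    subst (ℤ._≤ Σℤ f) (ℤ.+-identityˡ _) (ℤ.+-mono-≤ (p zero) (term≤Σℤ (f ∘ suc) (p ∘ suc) i))

  interval : ℕ → List ℤ
  interval b = List.map +_ (List.upTo (suc b))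

  ∈-interval : (b : ℕ) (x : ℤ) → 0ℤ ℤ.≤ x → x ℤ.≤ + b → x ∈ interval b
  ∈-interval b (+ x) _ (ℤ.+≤+ x≤b) = ∈-map⁺ +_ (∈-upTo⁺ (ℕ.s≤s x≤b))

  rows : (n : ℕ) → ℕ → List (Vec ℤ n)
  rows n b = choices (replicate n (interval b))

  candidates : Vec ℕ m → (n : ℕ) → List (Matrix ℤ m n)
  candidates r n = choices (Vec.map (rows n) r)

  ∈-candidates : (r : Vec ℕ m) (s : Vec ℕ n) (A : Matrix ℤ m n) →
                 InTransportationPolytope r s A → A ∈ candidates r n
  ∈-candidates {n = n} r s A T = ∈-choices (Vec.map (rows n) r) A λ i →
    subst (lookup A i ∈_) (sym (Vec.lookup-map i (rows n) r))
      (∈-choices (replicate n (interval (lookup r i))) (lookup A i) λ j →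
        subst (entry A i j ∈_) (sym (Vec.lookup-replicate j (interval (lookup r i))))
          (∈-interval (lookup r i) (entry A i j) (nonNegative i j)
            (subst (entry A i j ℤ.≤_) (rowSums i)
              (term≤Σℤ (entry A i) (nonNegative i) j))))
    where open InTransportationPolytope T

  refineAll : (r : Vec ℕ m) (s : Vec ℕ n) → List (Matrix ℤ m n) → List (LatticePoint r s)
  refineAll r s []       = []
  refineAll r s (A ∷ As) with inTransportationPolytope? r s A
  ... | yes T = (A , [ T ]) ∷ refineAll r s As
  ... | no  _ = refineAll r s As

  ∈-refineAll : (r : Vec ℕ m) (s : Vec ℕ n) (p : LatticePoint r s) (As : List (Matrix ℤ m n)) →
                InTransportationPolytope r s (value p) → value p ∈ As → p ∈ refineAll r s As
  ∈-refineAll r s p (A ∷ As) T A∈ with inTransportationPolytope? r s A | A∈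
  ... | yes _  | here refl = here refl
  ... | yes _  | there A∈′ = there (∈-refineAll r s p As T A∈′)
  ... | no ¬T  | here refl = contradiction T ¬T
  ... | no _   | there A∈′ = ∈-refineAll r s p As T A∈′

  LatticePoint-≟ : (r : Vec ℕ m) (s : Vec ℕ n) → DecidableEquality (LatticePoint r s)
  LatticePoint-≟ r s (A , _) (B , _) =
    map′ (λ { refl → refl }) (cong value) (Vec.≡-dec (Vec.≡-dec ℤ._≟_) A B)

-- Abstract, so that nothing depends on the order in which the lattice points
-- happen to be listed.
abstract
  latticePoints-finite : (r : Vec ℕ m) (s : Vec ℕ n) → Σ[ N ∈ ℕ ] (Fin N ↔ LatticePoint r s)
  latticePoints-finite {n = n} r s =
    listed⇒finite (LatticePoint-≟ r s) (refineAll r s (candidates r n)) complete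
    where
    complete : ∀ p → p ∈ refineAll r s (candidates r n)
    complete p@(A , [ T ]) = ∈-refineAll r s p (candidates r n) T′ (∈-candidates r s A T′)
      where
      T′ : InTransportationPolytope r s A
      T′ = recompute (inTransportationPolytope? r s A) T

#latticePoints : Vec ℕ m → Vec ℕ n → ℕ
#latticePoints r s = proj₁ (latticePoints-finite r s)

latticePoint : (r : Vec ℕ m) (s : Vec ℕ n) → Fin (#latticePoints r s) → LatticePoint r s
latticePoint r s = Inverse.to (proj₂ (latticePoints-finite r s))

-- The lattice points as vectors in ℤ^(m·n), matrices being read row by row.
configuration : (r : Vec ℕ m) (s : Vec ℕ n) → Fin (#latticePoints r s) → Vec ℤ (m ℕ.* n)
configuration r s i = concat (value (latticePoint r s i))

------------------------------------------------------------------------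
-- Monomials in N variables, as exponent vectors

Monomial : ℕ → Set
Monomial = Vec ℕ

𝟙 : Monomial N
𝟙 = replicate _ 0

infixl 7 _·_
_·_ : Monomial N → Monomial N → Monomial N
_·_ = zipWith ℕ._+_

_Divides_ : Rel (Monomial N) 0ℓ
u Divides v = ∃[ w ] v ≡ w · u

degree : Monomial N → ℕ
degree = Vec.sum

SquarefreeMonomial : Pred (Monomial N) 0ℓ
SquarefreeMonomial = VecAll (ℕ._≤ 1)

record IsTermOrder (_≼_ : Rel (Monomial N) 0ℓ) : Set where
  field
    isTotalOrder : IsTotalOrder _≡_ _≼_
    𝟙-minimum    : ∀ u → 𝟙 ≼ u
    ·-monotone   : ∀ {u v} w → u ≼ v → (w · u) ≼ (w · v)

------------------------------------------------------------------------
-- Monoid algebras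

-- Elements are formal sums of terms; a monoid element may occur in several
-- terms, so equality is equality of all coefficients and not _≡_ of lists.
module MonoidAlgebra (k : HeytingField c ℓ₁ ℓ₂) {M : Set} (_≟_ : DecidableEquality M)
                     (_∙_ : M → M → M) (ε : M) where
  private module k = HeytingField k

  Elem : Set c
  Elem = List (k.Carrier × M)

  coeff : Elem → M → k.Carrier
  coeff []            u = k.0#
  coeff ((a , v) ∷ f) u = if does (v ≟ u) then a k.+ coeff f u else coeff f u

  term : k.Carrier → M → Elem
  term a u = (a , u) ∷ []

  rawSemiring : RawSemiring c ℓ₁
  rawSemiring = record
    { Carrier = Elem
    ; _≈_     = λ f g → ∀ u → coeff f u k.≈ coeff g u
    ; _+_     = _++_
    ; _*_     = cartesianProductWith (λ (a , u) (b , v) → (a k.* b , u ∙ v))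
    ; 0#      = []
    ; 1#      = term k.1# ε
    }

  infix 4 _∈supp_
  _∈supp_ : M → Elem → Set ℓ₁
  u ∈supp f = ¬ (coeff f u k.≈ k.0#)

------------------------------------------------------------------------
-- k[x₁,…,x_N] and k[t₁^±¹,…,t_d^±¹]

module Poly (k : HeytingField c ℓ₁ ℓ₂) (N : ℕ) where
  open MonoidAlgebra k (Vec.≡-dec {n = N} ℕ._≟_) _·_ 𝟙 public

module Laurent (k : HeytingField c ℓ₁ ℓ₂) (d : ℕ) where
  open MonoidAlgebra k (Vec.≡-dec {n = d} ℤ._≟_) (zipWith ℤ._+_) (replicate d 0ℤ) public

Polynomial : HeytingField c ℓ₁ ℓ₂ → ℕ → Set c
Polynomial k N = Poly.Elem k N

LaurentPolynomial : HeytingField c ℓ₁ ℓ₂ → ℕ → Set c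
LaurentPolynomial k d = Laurent.Elem k d

module _ (k : HeytingField c ℓ₁ ℓ₂) where
  private
    module k = HeytingField k

  -- The k-algebra homomorphism determined by xᵢ ↦ φ i.
  evaluate : (Fin N → LaurentPolynomial k d) → Polynomial k N → LaurentPolynomial k d
  evaluate {N} {d} φ []            = RawSemiring.0# (Laurent.rawSemiring k d)
  evaluate {N} {d} φ ((a , u) ∷ f) =
    (Laurent.term k d a (replicate d 0ℤ) * product (λ i → φ i ^ lookup u i)) + evaluate φ f
    where
    open RawSemiring (Laurent.rawSemiring k d) using (_+_; _*_)
    open RawSemiringDefs (Laurent.rawSemiring k d) using (_^_; product)

  toricIdeal : (Fin N → Vec ℤ d) → Pred (Polynomial k N) ℓ₁
  toricIdeal {d = d} 𝒜 f = evaluate (λ i → Laurent.term k d k.1# (𝒜 i)) f ≈ 0#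
    where open RawSemiring (Laurent.rawSemiring k d) using (_≈_; 0#)

------------------------------------------------------------------------
-- Gröbner bases

  module _ {N : ℕ} where
    open Poly k N
    open RawSemiring rawSemiring using (_≈_; _+_; _*_; 0#)

    -- The ideal generated by S.
    data ⟨_⟩ (S : Pred (Polynomial k N) ℓ) : Pred (Polynomial k N) (c ⊔ ℓ₁ ⊔ ℓ) where
      generator : ∀ {f} → S f → ⟨ S ⟩ f
      zero      : ⟨ S ⟩ 0#
      add       : ∀ {f g} → ⟨ S ⟩ f → ⟨ S ⟩ g → ⟨ S ⟩ (f + g)
      scale     : ∀ h {f} → ⟨ S ⟩ f → ⟨ S ⟩ (h * f)
      respects  : ∀ {f g} → f ≈ g → ⟨ S ⟩ f → ⟨ S ⟩ g

    HasDegreeAtMost : ℕ → Pred (Polynomial k N) ℓ₁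
    HasDegreeAtMost b f = ∀ u → u ∈supp f → degree u ℕ.≤ b

    module _ (_≼_ : Rel (Monomial N) 0ℓ) where

      IsLeadingMonomial : Polynomial k N → Pred (Monomial N) ℓ₁
      IsLeadingMonomial f u = u ∈supp f × (∀ v → v ∈supp f → v ≼ u)

      LeadingTermsOf : Pred (Polynomial k N) ℓ → Pred (Polynomial k N) (c ⊔ ℓ₁ ⊔ ℓ)
      LeadingTermsOf S p = ∃[ f ] ∃[ u ] (S f × IsLeadingMonomial f u × p ≡ term (coeff f u) u)

      record IsGröbnerBasis (I : Pred (Polynomial k N) ℓ) (G : List (Polynomial k N)) :
                            Set (c ⊔ ℓ₁ ⊔ ℓ) where
        field
          contained    : All I G
          initialIdeal : ⟨ LeadingTermsOf I ⟩ ≐ ⟨ LeadingTermsOf (_∈ G) ⟩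

      -- Since distinct positions are compared, G has no repeated elements.
      record IsReducedGröbnerBasis (I : Pred (Polynomial k N) ℓ) (G : List (Polynomial k N)) :
                                   Set (c ⊔ ℓ₁ ⊔ ℓ) where
        field
          isGröbnerBasis : IsGröbnerBasis I G
          monic          : All (λ g → ∃[ u ] (IsLeadingMonomial g u × coeff g u k.≈ k.1#)) G
          reduced        : ∀ i j → i ≢ j →
                           ∀ u v → IsLeadingMonomial (List.lookup G i) u →
                           v ∈supp List.lookup G j → ¬ (u Divides v)

      HasSquarefreeLeadingTerm : Pred (Polynomial k N) ℓ₁
      HasSquarefreeLeadingTerm f = ∀ u → IsLeadingMonomial f u → SquarefreeMonomial u

{-# OPTIONS --safe #-}

-- Read lattice points as functions on the cells of an m × n grid. Pair the cells into ⌊mn/2⌋ dominoes, each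
-- inside a row or a column, missing at most one corner cell. Order monomials by degree, then by the sum of the
-- squares of the values of all cells and domino sums of the variables involved, then reverse
-- lexicographically, with the points of small value in the corner cell as the cheapest variables.
--
-- A set of points with fixed line sums can always be rebalanced so that the values of every cell, domino
-- and line differ by at most 1: two points are split evenly by 2-colouring a union of two matchings of the
-- cells where their sum is odd. So a minimal reducible monomial u either has two points far apart
-- on some cell or domino, and has degree 2; or it is balanced, and then the first variable b in which
-- its reduction exceeds it agrees on every domino with some point of u. One such point for each domino
-- suffices for b to be split off, so u is a product of at most ⌊mn/2⌋ distinct variables.

module Submission where

open import Defs
open import Algebra.Apartness.Bundles using (HeytingField)
open import Algebra.Bundles.Raw using (RawSemiring)
import Algebra.Definitions.RawSemiring as RawSemiringDefs
open import Data.Bool.Base using (Bool; true; false; not; if_then_else_; _∧_)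
open import Data.Bool.Properties using (not-involutive)
open import Data.Fin.Base as Fin using (Fin; zero; suc; combine; remQuot; fromℕ<)
import Data.Fin.Properties as Fin
open import Data.Integer.Base as ℤ using (ℤ; 0ℤ; ∣_∣)
import Data.Integer.Properties as ℤ
open import Data.Irrelevant using ([_])
open import Data.List.Base as List
  using (List; []; _∷_; _++_; map; length; concat; concatMap; filter; deduplicate; upTo; allFin; tabulate;
         cartesianProduct; cartesianProductWith)
open import Data.List.Membership.Propositional using (_∈_; _∉_; find; lose)
open import Data.List.Membership.Propositional.Properties
open import Data.List.Properties
  using (map-++; ++-assoc; length-deduplicate; length-map; length-tabulate; length-++; length-replicate)
open import Data.List.Relation.Binary.Permutation.Propositional as ↭
  using (_↭_; ↭-refl; ↭-sym; ↭-trans; ↭⇒↭ₛ)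
open import Data.List.Relation.Binary.Permutation.Propositional.Properties
  using (∈-resp-↭; shifts; ++⁺; ++⁺ˡ; shift; ↭-length) renaming (map⁺ to ↭-map⁺)
open import Data.List.Relation.Binary.Permutation.Setoid.Properties using (Unique-resp-↭)
open import Data.List.Relation.Binary.Pointwise.Base using (Pointwise; []; _∷_)
open import Data.List.Relation.Unary.All as All using (All; []; _∷_; all?)
open import Data.List.Relation.Unary.All.Properties using (¬All⇒Any¬; concat⁻)
  renaming (++⁺ to All-++⁺; ++⁻ˡ to All-++⁻ˡ; map⁺ to All-map⁺; map⁻ to All-map⁻)
open import Data.List.Relation.Unary.AllPairs using (AllPairs; []; _∷_)
open import Data.List.Relation.Unary.Any as Any using (here; there; any?)
import Data.List.Relation.Unary.Any.Properties as Any
open import Data.List.Relation.Unary.Sorted.TotalOrder.Properties using (Sorted⇒AllPairs)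
open import Data.List.Relation.Unary.Unique.DecPropositional.Properties using (deduplicate-!)
open import Data.List.Relation.Unary.Unique.Propositional using (Unique)
open import Data.List.Relation.Unary.Unique.Propositional.Properties using (cartesianProductWith⁺; allFin⁺)
import Data.List.Sort as Sort
open import Data.Nat.Base
open import Data.Nat.Induction using (<-wellFounded)
open import Data.Nat.ListAction using (sum)
open import Data.Nat.ListAction.Properties using (sum-↭; sum-++)
open import Data.Nat.Properties
open import Data.Nat.Tactic.RingSolver using (solve-∀)
open import Data.Product.Base using (Σ-syntax; ∃-syntax; ∃₂; _×_; _,_; proj₁; proj₂)
open import Data.Product.Properties using (≡-dec)
open import Data.Refinement.Base using (value; _,_)
open import Data.Sum.Base using (_⊎_; inj₁; inj₂; [_,_]′)
open import Data.Unit.Base using (⊤; tt)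
open import Data.Vec.Base as Vec using (Vec; []; _∷_; lookup; zipWith; replicate)
import Data.Vec.Properties as Vec
open import Data.Vec.Relation.Unary.All.Properties using (lookup⁻) renaming (lookup⁺ to VecAll-lookup⁺)
open import Function.Base using (_∘_; const)
open import Function.Bundles using (Inverse)
open import Induction.WellFounded using (Acc; acc)
open import Level using (Level; 0ℓ)
open import Relation.Binary.Bundles using (DecTotalOrder)
import Relation.Binary.Construct.On as On
open import Relation.Binary.Core using (Rel)
open import Relation.Binary.Definitions using (DecidableEquality; tri<; tri≈; tri>)
open import Relation.Binary.PropositionalEquality hiding ([_])
open import Relation.Binary.Structures using (IsTotalOrder)
open import Relation.Nullary using (¬_; Dec; yes; no; contradiction; does; recompute; _×-dec_; ¬?)
open import Relation.Nullary.Decidable using (_→-dec_)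

-- Finite sums over lists

-- The weight is a sum of squares, so among lists of points of equal length and total it is least
-- exactly on those balanced for all functionals at once; a tie then confines both lists to the same
-- two neighbouring values of each functional. For each single functional this yields a point of u
-- agreeing with b. Domino sums are weighed along with cells because the three functionals of a
-- domino together produce one point agreeing on both cells. No point of u has to agree with b
-- everywhere: weights are compared functional by functional, each time cancelling b against a
-- possibly different point. If mn is odd, one cell lies in no domino, and there only the order can
-- bound b, hence the sorting by corner values. The 2-colouring exists because row pairs and column
-- pairs alternate along paths and even cycles. With fewer than two dominoes the degree 2 case would
-- break the bound, but then there is at most one lattice point. Equality in k need not be
-- decidable, so polynomials are never reduced: the argument lives on monomials, and a least
-- monomial in a fibre is found by finite search, because degree comes first in the order.

∑ : ∀ {a} {A : Set a} → (A → ℕ) → List A → ℕ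
∑ f xs = sum (map f xs)

module _ {a} {A : Set a} where

  ∑-cong : {f g : A → ℕ} → (∀ x → f x ≡ g x) → ∀ xs → ∑ f xs ≡ ∑ g xs
  ∑-cong f≗g []       = refl
  ∑-cong f≗g (x ∷ xs) = cong₂ _+_ (f≗g x) (∑-cong f≗g xs)

  ∑-++ : (f : A → ℕ) → ∀ xs ys → ∑ f (xs ++ ys) ≡ ∑ f xs + ∑ f ys
  ∑-++ f xs ys = trans (cong sum (map-++ f xs ys)) (sum-++ (map f xs) (map f ys))

  ∑-↭ : (f : A → ℕ) → ∀ {xs ys} → xs ↭ ys → ∑ f xs ≡ ∑ f ys
  ∑-↭ f p = sum-↭ (↭-map⁺ f p)

  ∑-+ : (f g : A → ℕ) → ∀ xs → ∑ (λ x → f x + g x) xs ≡ ∑ f xs + ∑ g xs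
  ∑-+ f g []       = refl
  ∑-+ f g (x ∷ xs) = trans (cong (f x + g x +_) (∑-+ f g xs)) (interchange (f x) (g x) _ _)
    where
    interchange : ∀ a b c d → (a + b) + (c + d) ≡ (a + c) + (b + d)
    interchange = solve-∀

  ∑-const : ∀ c (xs : List A) → ∑ (λ _ → c) xs ≡ length xs * c
  ∑-const c []       = refl
  ∑-const c (x ∷ xs) = cong (c +_) (∑-const c xs)

  ∑-* : ∀ c (f : A → ℕ) xs → ∑ (λ x → c * f x) xs ≡ c * ∑ f xs
  ∑-* c f []       = sym (*-zeroʳ c)
  ∑-* c f (x ∷ xs) = trans (cong (c * f x +_) (∑-* c f xs)) (sym (*-distribˡ-+ c (f x) _))

  ∑-zero : (f : A → ℕ) → ∀ {xs} → All (λ x → f x ≡ 0) xs → ∑ f xs ≡ 0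
  ∑-zero f []           = refl
  ∑-zero f (fx≡0 ∷ all) = cong₂ _+_ fx≡0 (∑-zero f all)

  ∑≡0⇒≡0 : (f : A → ℕ) → ∀ {xs x} → ∑ f xs ≡ 0 → x ∈ xs → f x ≡ 0
  ∑≡0⇒≡0 f {x ∷ _} eq (here refl) = m+n≡0⇒m≡0 (f x) eq
  ∑≡0⇒≡0 f {y ∷ _} eq (there x∈)  = ∑≡0⇒≡0 f (m+n≡0⇒n≡0 (f y) eq) x∈

  term≤∑ : (f : A → ℕ) → ∀ {xs x} → x ∈ xs → f x ≤ ∑ f xs
  term≤∑ f {x ∷ xs} (here refl) = m≤m+n (f x) _
  term≤∑ f {y ∷ xs} (there x∈)  = ≤-trans (term≤∑ f x∈) (m≤n+m _ (f y))

  ∑-mono : {f g : A → ℕ} → ∀ {xs} → All (λ x → f x ≤ g x) xs → ∑ f xs ≤ ∑ g xs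
  ∑-mono []          = z≤n
  ∑-mono (f≤g ∷ all) = +-mono-≤ f≤g (∑-mono all)

  ∑-mono-< : {f g : A → ℕ} → ∀ {xs x} → All (λ x → f x ≤ g x) xs →
             x ∈ xs → f x < g x → ∑ f xs < ∑ g xs
  ∑-mono-< (_ ∷ all)   (here refl) f<g = +-mono-<-≤ f<g (∑-mono all)
  ∑-mono-< (f≤g ∷ all) (there x∈)  f<g = +-mono-≤-< f≤g (∑-mono-< all x∈ f<g)

∑-swap : ∀ {a b} {A : Set a} {B : Set b} (f : A → B → ℕ) xs ys →
         ∑ (λ x → ∑ (f x) ys) xs ≡ ∑ (λ y → ∑ (λ x → f x y) xs) ys
∑-swap f []       ys = sym (∑-zero (λ _ → 0) {ys} (All.universal (λ _ → refl) ys))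
∑-swap f (x ∷ xs) ys = trans (cong (∑ (f x) ys +_) (∑-swap f xs ys))
                             (sym (∑-+ (f x) (λ y → ∑ (λ x → f x y) xs) ys))

-- Sums of squares

-- (y − k)(y − k − 1), which is non-negative on integers.
gap : ℕ → ℕ → ℕ
gap k y = (y ∸ k) * (y ∸ suc k) + (k ∸ y) * (suc k ∸ y)

-- For lists of fixed length and sum everything here except `y * y` and `gap k y` adds up to a
-- constant, so the sum of squares is least where the gaps vanish.
gap-identity : ∀ k y → y * y + k * suc k ≡ gap k y + (k + suc k) * y
gap-identity k y with ≤-<-connex y k
... | inj₁ y≤k with m≤n⇒∃[o]m+o≡n y≤k
...   | t , refl rewrite m≤n⇒m∸n≡0 (m≤m+n y t) | m+n∸m≡n y t
                       | sym (+-suc y t) | m+n∸m≡n y (suc t) = ident y t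
  where
  ident : ∀ y t → y * y + (y + t) * (y + suc t) ≡ t * suc t + ((y + t) + (y + suc t)) * y
  ident = solve-∀
gap-identity k y | inj₂ k<y with m≤n⇒∃[o]m+o≡n k<y
...   | t , refl = trans (ident k t) (cong (_+ (k + suc k) * (suc k + t)) (sym gap-value))
  where
  ident : ∀ k t → (suc k + t) * (suc k + t) + k * suc k ≡ suc t * t + (k + suc k) * (suc k + t)
  ident = solve-∀
  gap-value : gap k (suc k + t) ≡ suc t * t
  gap-value rewrite m+n∸m≡n k t | m≤n⇒m∸n≡0 (m≤m+n k t) | m≤n⇒m∸n≡0 (≤-trans (m≤m+n k t) (n≤1+n _))
              | sym (+-suc k t) | m+n∸m≡n k (suc t) = +-identityʳ _

AtLevel : ℕ → ℕ → Set
AtLevel k y = y ≡ k ⊎ y ≡ suc k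

gap≡0⇒AtLevel : ∀ k y → gap k y ≡ 0 → AtLevel k y
gap≡0⇒AtLevel zero    zero          eq = inj₁ refl
gap≡0⇒AtLevel zero    (suc zero)    eq = inj₂ refl
gap≡0⇒AtLevel (suc k) (suc y)       eq with gap≡0⇒AtLevel k y eq
... | inj₁ refl = inj₁ refl
... | inj₂ refl = inj₂ refl

AtLevel⇒gap≡0 : ∀ {k y} → AtLevel k y → gap k y ≡ 0
AtLevel⇒gap≡0 {k} (inj₁ refl) rewrite n∸n≡0 k = refl
AtLevel⇒gap≡0 {k} (inj₂ refl) rewrite n∸n≡0 k | m+n∸n≡m 1 k | m≤n⇒m∸n≡0 (n≤1+n k) = refl

Close : ℕ → ℕ → Set
Close x y = x ≤ suc y × y ≤ suc x

close-refl : ∀ {x} → Close x x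
close-refl = n≤1+n _ , n≤1+n _

atLevel-close : ∀ {k x y} → AtLevel k x → AtLevel k y → Close x y
atLevel-close (inj₁ refl) (inj₁ refl) = close-refl
atLevel-close (inj₁ refl) (inj₂ refl) = ≤-trans (n≤1+n _) (n≤1+n _) , ≤-refl
atLevel-close (inj₂ refl) (inj₁ refl) = ≤-refl , ≤-trans (n≤1+n _) (n≤1+n _)
atLevel-close (inj₂ refl) (inj₂ refl) = close-refl

module _ {a} {A : Set a} (f : A → ℕ) where

  private
    sq : A → ℕ
    sq x = f x * f x

  ∑-sq-gap : ∀ k xs → ∑ sq xs + length xs * (k * suc k) ≡ ∑ (gap k ∘ f) xs + (k + suc k) * ∑ f xs
  ∑-sq-gap k xs = begin
    ∑ sq xs + length xs * (k * suc k)                ≡⟨ cong (∑ sq xs +_) (∑-const _ xs) ⟨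
    ∑ sq xs + ∑ (λ _ → k * suc k) xs                 ≡⟨ ∑-+ sq _ xs ⟨
    ∑ (λ x → sq x + k * suc k) xs                    ≡⟨ ∑-cong (λ x → gap-identity k (f x)) xs ⟩
    ∑ (λ x → gap k (f x) + (k + suc k) * f x) xs     ≡⟨ ∑-+ (gap k ∘ f) _ xs ⟩
    ∑ (gap k ∘ f) xs + ∑ (λ x → (k + suc k) * f x) xs ≡⟨ cong (∑ (gap k ∘ f) xs +_) (∑-* (k + suc k) f xs) ⟩
    ∑ (gap k ∘ f) xs + (k + suc k) * ∑ f xs          ∎
    where open ≡-Reasoning

  -- Both lists satisfy `∑-sq-gap` with the same `k`; the gaps of `xs` vanish, so those of `ys` are
  -- exactly its excess.
  ∑-sq-balanced : ∀ {k xs ys} → All (AtLevel k ∘ f) xs → length xs ≡ length ys → ∑ f xs ≡ ∑ f ys →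
                  ∑ sq ys ≡ ∑ sq xs + ∑ (gap k ∘ f) ys
  ∑-sq-balanced {k} {xs} {ys} lev len eq = +-cancelʳ-≡ (length ys * (k * suc k)) _ _ (begin
    ∑ sq ys + length ys * (k * suc k)                  ≡⟨ ∑-sq-gap k ys ⟩
    G + (k + suc k) * ∑ f ys                           ≡⟨ cong (λ t → G + (k + suc k) * t) eq ⟨
    G + (k + suc k) * ∑ f xs                           ≡⟨ cong (G +_) (cong (_+ (k + suc k) * ∑ f xs)
                                                           (∑-zero (gap k ∘ f) (All.map AtLevel⇒gap≡0 lev))) ⟨
    G + (∑ (gap k ∘ f) xs + (k + suc k) * ∑ f xs)      ≡⟨ cong (G +_) (∑-sq-gap k xs) ⟨
    G + (∑ sq xs + length xs * (k * suc k))            ≡⟨ cong (λ t → G + (∑ sq xs + t * (k * suc k))) len ⟩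
    G + (∑ sq xs + length ys * (k * suc k))            ≡⟨ move G (∑ sq xs) _ ⟩
    (∑ sq xs + G) + length ys * (k * suc k)            ∎)
    where
    open ≡-Reasoning
    G = ∑ (gap k ∘ f) ys
    move : ∀ a b c → a + (b + c) ≡ (b + a) + c
    move = solve-∀

  Balanced : List A → Set a
  Balanced xs = ∀ {x y} → x ∈ xs → y ∈ xs → f x ≤ suc (f y)

  minimum : ∀ x xs → ∃[ y ] (y ∈ x ∷ xs × (∀ {z} → z ∈ x ∷ xs → f y ≤ f z))
  minimum x []       = x , here refl , λ { (here refl) → ≤-refl }
  minimum x (y ∷ xs) with minimum y xs
  ... | m , m∈ , m≤ with ≤-total (f x) (f m)
  ...   | inj₁ x≤m = x , here refl , λ { (here refl) → ≤-refl ; (there z∈) → ≤-trans x≤m (m≤ z∈) }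
  ...   | inj₂ m≤x = m , there m∈ , λ { (here refl) → m≤x ; (there z∈) → m≤ z∈ }

  balanced⇒atLevel : ∀ x xs → Balanced (x ∷ xs) →
                     ∃[ y ] (y ∈ x ∷ xs × All (AtLevel (f y) ∘ f) (x ∷ xs))
  balanced⇒atLevel x xs bal with minimum x xs
  ... | y , y∈ , y≤ = y , y∈ , All.tabulate λ z∈ → level (y≤ z∈) (bal z∈ y∈)
    where
    level : ∀ {m n} → m ≤ n → n ≤ suc m → AtLevel m n
    level m≤n n≤1+m with m≤n⇒m<n∨m≡n m≤n
    ... | inj₁ m<n  = inj₂ (≤-antisym n≤1+m m<n)
    ... | inj₂ refl = inj₁ refl

  ∑-sq-min : ∀ {xs ys} → Balanced xs → length xs ≡ length ys → ∑ f xs ≡ ∑ f ys →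
             ∑ sq xs ≤ ∑ sq ys
  ∑-sq-min {[]} {ys} bal len eq = z≤n
  ∑-sq-min {x ∷ xs} {ys} bal len eq with balanced⇒atLevel x xs bal
  ... | y , _ , lev = subst (_ ≤_) (sym (∑-sq-balanced {ys = ys} lev len eq)) (m≤m+n _ _)

  -- No excess means no gaps, so both lists take only the values `f m` and `suc (f m)`. The lower
  -- one is attained in `xs` at `m`; were the upper one attained in `ys` alone, the sum of `ys`
  -- would be larger.
  ∑-sq-equality : ∀ {xs ys} → Balanced xs → length xs ≡ length ys → ∑ f xs ≡ ∑ f ys →
                  ∑ sq ys ≤ ∑ sq xs → ∀ {y} → y ∈ ys →
                  (∃[ x ] (x ∈ xs × f x ≡ f y)) × (∀ {x} → x ∈ xs → Close (f x) (f y))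
  ∑-sq-equality {[]}     {_ ∷ _} bal ()
  ∑-sq-equality {x ∷ xs} {ys} bal len eq le {y} y∈ with balanced⇒atLevel x xs bal
  ... | m , m∈ , lev = agree , λ x∈ → atLevel-close (All.lookup lev x∈) (at y∈)
    where
    gaps≡0 : ∑ (gap (f m) ∘ f) ys ≡ 0
    gaps≡0 = n≤0⇒n≡0 (+-cancelˡ-≤ (∑ sq (x ∷ xs)) _ _
      (subst₂ _≤_ (∑-sq-balanced {ys = ys} lev len eq) (sym (+-identityʳ _)) le))
    at : ∀ {v} → v ∈ ys → AtLevel (f m) (f v)
    at v∈ = gap≡0⇒AtLevel (f m) _ (∑≡0⇒≡0 (gap (f m) ∘ f) gaps≡0 v∈)
    agree : ∃[ w ] (w ∈ x ∷ xs × f w ≡ f y)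
    agree with at y∈
    ... | inj₁ eq′ = m , m∈ , sym eq′
    ... | inj₂ eq′ with any? (λ w → f w ≟ f y) (x ∷ xs)
    ...   | yes some = find some
    ...   | no none  = contradiction eq (<⇒≢ (begin-strict
      ∑ f (x ∷ xs)                   ≤⟨ ∑-mono {g = λ _ → f m} (All.tabulate low) ⟩
      ∑ (λ _ → f m) (x ∷ xs)         ≡⟨ ∑-const (f m) (x ∷ xs) ⟩
      length (x ∷ xs) * f m          ≡⟨ cong (_* f m) len ⟩
      length ys * f m                ≡⟨ ∑-const (f m) ys ⟨
      ∑ (λ _ → f m) ys               <⟨ ∑-mono-< {f = λ _ → f m} (All.tabulate high) y∈ (≤-reflexive (sym eq′)) ⟩
      ∑ f ys                         ∎))
      where
      open ≤-Reasoning
      low : ∀ {w} → w ∈ x ∷ xs → f w ≤ f m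
      low w∈ with All.lookup lev w∈
      ... | inj₁ fw = ≤-reflexive fw
      ... | inj₂ fw = contradiction (lose w∈ (trans fw (sym eq′))) none
      high : ∀ {w} → w ∈ ys → f m ≤ f w
      high w∈ with at w∈
      ... | inj₁ fw = ≤-reflexive (sym fw)
      ... | inj₂ fw = ≤-trans (n≤1+n _) (≤-reflexive (sym fw))

  ∑-sq-strict : ∀ {xs ys} → Balanced xs → length xs ≡ length ys → ∑ f xs ≡ ∑ f ys →
                ∀ {y z} → y ∈ ys → z ∈ ys → suc (f z) < f y → ∑ sq xs < ∑ sq ys
  ∑-sq-strict bal len eq y∈ z∈ far = ≰⇒> λ le →
    let (w , w∈ , fw≡fz) = proj₁ (∑-sq-equality bal len eq le z∈)
        _ , fy≤          = proj₂ (∑-sq-equality bal len eq le y∈) w∈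
    in <⇒≱ far (≤-trans fy≤ (s≤s (≤-reflexive fw≡fz)))

  -- A value below an integral mean keeps all others at most the mean, so the sum falls short;
  -- dually above. This makes balanced line sums exact, so that the parts of a decomposition are
  -- again lattice points.
  balanced-average : ∀ {xs} r → Balanced xs → ∑ f xs ≡ length xs * r → ∀ {x} → x ∈ xs → f x ≡ r
  balanced-average {xs} r bal eq {x} x∈ with <-cmp (f x) r
  ... | tri≈ _ fx≡r _ = fx≡r
  ... | tri< fx<r _ _ = contradiction (trans eq (sym (∑-const r xs))) (<⇒≢
          (∑-mono-< {g = λ _ → r} (All.tabulate λ y∈ → ≤-trans (bal y∈ x∈) fx<r) x∈ fx<r))
  ... | tri> _ _ r<fx = contradiction (trans (∑-const r xs) (sym eq)) (<⇒≢
          (∑-mono-< {f = λ _ → r} (All.tabulate λ y∈ → ≤-pred (≤-trans r<fx (bal x∈ y∈))) x∈ r<fx))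

-- Two-colourings of unions of two matchings

module _ {A : Set} where

  flat : List (A × A) → List A
  flat []             = []
  flat ((x , y) ∷ ps) = x ∷ y ∷ flat ps

  flat-++ : ∀ ps qs → flat (ps ++ qs) ≡ flat ps ++ flat qs
  flat-++ []             qs = refl
  flat-++ ((x , y) ∷ ps) qs = cong (λ zs → x ∷ y ∷ zs) (flat-++ ps qs)

  unique-↭ : ∀ {xs ys : List A} → xs ↭ ys → Unique xs → Unique ys
  unique-↭ p = Unique-resp-↭ (setoid A) (↭⇒↭ₛ p)

  unique-++ˡ : ∀ xs {ys : List A} → Unique (xs ++ ys) → Unique xs
  unique-++ˡ []       u         = []
  unique-++ˡ (x ∷ xs) (x∉ ∷ u) = All-++⁻ˡ xs x∉ ∷ unique-++ˡ xs u

  Opposite : (A → Bool) → A × A → Set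
  Opposite σ (x , y) = σ x ≡ not (σ y)

  opposite-sym : ∀ {σ x y} → Opposite σ (x , y) → Opposite σ (y , x)
  opposite-sym eq = sym (trans (cong not eq) (not-involutive _))

module Colouring {A : Set} (_≟ᴬ_ : DecidableEquality A) where

  -- `qs′` is `qs` without the pair that contains `x`, in whichever order it stands; the last field
  -- lets any colouring of the rest put that pair back.
  data Extract (x : A) (qs : List (A × A)) : Set where
    absent  : x ∉ flat qs → Extract x qs
    partner : ∀ a qs′ → flat qs ↭ x ∷ a ∷ flat qs′ →
              (∀ {σ} → Opposite σ (x , a) → All (Opposite σ) qs′ → All (Opposite σ) qs) → Extract x qs

  extract : ∀ x qs → Extract x qs
  extract x [] = absent λ ()
  extract x ((u , v) ∷ qs) with u ≟ᴬ x
  ... | yes refl = partner v qs ↭-refl _∷_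
  ... | no u≢x with v ≟ᴬ x
  ...   | yes refl = partner u qs (↭.swap _ _ ↭-refl) λ {σ} o os → opposite-sym {σ = σ} {y = u} o ∷ os
  ...   | no v≢x with extract x qs
  ...     | absent x∉ = absent λ { (here eq) → u≢x (sym eq) ; (there (here eq)) → v≢x (sym eq)
                                 ; (there (there x∈)) → x∉ x∈ }
  ...     | partner a qs′ perm colours = partner a ((u , v) ∷ qs′)
            (↭-trans (↭.prep u (↭.prep v perm)) (shifts (u ∷ v ∷ []) (x ∷ a ∷ [])))
            λ { o (o′ ∷ os) → o′ ∷ colours o os }

  _[_↦_] : (A → Bool) → A → Bool → A → Bool
  (σ [ x ↦ b ]) y = if does (y ≟ᴬ x) then b else σ y

  update-same : ∀ σ x b → (σ [ x ↦ b ]) x ≡ b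
  update-same σ x b with x ≟ᴬ x
  ... | yes _ = refl
  ... | no x≢x = contradiction refl x≢x

  update-other : ∀ σ {x y} b → x ≢ y → (σ [ x ↦ b ]) y ≡ σ y
  update-other σ {x} {y} b x≢y with y ≟ᴬ x
  ... | yes refl = contradiction refl x≢y
  ... | no _     = refl

  update-opposite : ∀ σ {x} b {ps} → x ∉ flat ps → All (Opposite σ) ps → All (Opposite (σ [ x ↦ b ])) ps
  update-opposite σ b x∉ []       = []
  update-opposite σ {x} b {(u , v) ∷ ps} x∉ (o ∷ os) =
    trans (update-other σ b (x∉ ∘ here)) (trans o (cong not (sym (update-other σ b (x∉ ∘ there ∘ here)))))
    ∷ update-opposite σ b (x∉ ∘ there ∘ there) os

  private
    head∉ : ∀ {x : A} {xs} → Unique (x ∷ xs) → x ∉ xs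
    head∉ (x∉ ∷ _) x∈ = All.lookup x∉ x∈ refl

    tail : ∀ {x : A} {xs} → Unique (x ∷ xs) → Unique xs
    tail (_ ∷ u) = u

  Colours : List (A × A) → List (A × A) → Set
  Colours ps qs = ∃[ σ ] (All (Opposite σ) ps × All (Opposite σ) qs)

  -- The pair (x , y) is contracted: its neighbours in the other matching become matched to each other.
  colour : ∀ ps qs → Unique (flat ps) → Unique (flat qs) → Colours ps qs
  colour [] [] _ _ = (λ _ → true) , [] , []
  colour [] ((x , y) ∷ qs) _ uqs with colour [] qs [] (tail (tail uqs))
  ... | σ , _ , os = τ , [] , trans (update-same (σ [ y ↦ true ]) x false) (cong not (sym τy)) ∷
        update-opposite (σ [ y ↦ true ]) false (head∉ uqs ∘ there) (update-opposite σ true (head∉ (tail uqs)) os)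
    where
    τ : A → Bool
    τ = (σ [ y ↦ true ]) [ x ↦ false ]
    τy : τ y ≡ true
    τy = trans (update-other (σ [ y ↦ true ]) false λ { refl → head∉ uqs (here refl) }) (update-same σ y true)
  colour ((x , y) ∷ ps) qs ups uqs = by (extract x qs)
    where
    x∉ps : x ∉ flat ps
    x∉ps = head∉ ups ∘ there
    y∉ps : y ∉ flat ps
    y∉ps = head∉ (tail ups)
    x≢y : x ≢ y
    x≢y refl = head∉ ups (here refl)

    ups′ : Unique (flat ps)
    ups′ = tail (tail ups)

    extend : ∀ σ b qs′ → x ∉ flat qs′ → y ∉ flat qs′ → All (Opposite σ) ps → All (Opposite σ) qs′ →
             let τ = (σ [ y ↦ not b ]) [ x ↦ b ] in
             All (Opposite τ) ((x , y) ∷ ps) × All (Opposite τ) qs′ × τ x ≡ b × τ y ≡ not b ×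
             (∀ {a} → x ≢ a → y ≢ a → τ a ≡ σ a)
    extend σ b qs′ x∉ y∉ ops oqs =
      (trans τx (sym (trans (cong not τy) (not-involutive b))) ∷
       update-opposite σ₁ b x∉ps (update-opposite σ _ y∉ps ops)) ,
      update-opposite σ₁ b x∉ (update-opposite σ _ y∉ oqs) , τx , τy ,
      λ x≢a y≢a → trans (update-other σ₁ b x≢a) (update-other σ _ y≢a)
      where
      σ₁ τ : A → Bool
      σ₁ = σ [ y ↦ not b ]
      τ  = σ₁ [ x ↦ b ]
      τx : τ x ≡ b
      τx = update-same σ₁ x b
      τy : τ y ≡ not b
      τy = trans (update-other σ₁ b x≢y) (update-same σ y _)

    by : Extract x qs → Colours ((x , y) ∷ ps) qs
    -- `x` is the end of a path, so only a partner of `y` can constrain the two new colours.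
    by (absent x∉) = by-y (extract y qs)
      where
      by-y : Extract y qs → Colours ((x , y) ∷ ps) qs
      by-y (absent y∉) =
        let σ , ops , oqs = colour ps qs ups′ uqs
            ops′ , oqs′ , _ = extend σ true qs x∉ y∉ ops oqs
        in _ , ops′ , oqs′
      by-y (partner b qs′ perm colours) =
        let u = unique-↭ perm uqs
            σ , ops , oqs = colour ps qs′ ups′ (tail (tail u))
            ops′ , oqs′ , _ , τy , τ≡ =
              extend σ (σ b) qs′ (x∉′ ∘ there ∘ there) (head∉ u ∘ there) ops oqs
            τb = τ≡ (λ { refl → x∉′ (there (here refl)) }) (λ { refl → head∉ u (here refl) })
        in _ , ops′ , colours (trans τy (cong not (sym τb))) oqs′
        where
        x∉′ : x ∉ y ∷ b ∷ flat qs′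
        x∉′ x∈ = x∉ (∈-resp-↭ (↭-sym perm) x∈)
    by (partner a qs₁ perm₁ colours₁) with unique-↭ perm₁ uqs | a ≟ᴬ y
    -- Both matchings contain the pair: a component of its own, whose colours are free.
    ... | u₁ | yes refl =
      let σ , ops , oqs = colour ps qs₁ ups′ (tail (tail u₁))
          ops′ , oqs′ , _ = extend σ true qs₁ (head∉ u₁ ∘ there) (head∉ (tail u₁)) ops oqs
      in _ , ops′ , colours₁ (All.head ops′) oqs′
    ... | u₁ | no a≢y = by-y (extract y qs₁)
      where
      by-y : Extract y qs₁ → Colours ((x , y) ∷ ps) qs
      by-y (absent y∉) =
        let σ , ops , oqs = colour ps qs₁ ups′ (tail (tail u₁))
            ops′ , oqs′ , τx , _ , τ≡ = extend σ (not (σ a)) qs₁ (head∉ u₁ ∘ there) y∉ ops oqs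
            τa = τ≡ (λ { refl → head∉ u₁ (here refl) }) (a≢y ∘ sym)
        in _ , ops′ , colours₁ (trans τx (cong not (sym τa))) oqs′
      by-y (partner b qs₂ perm₂ colours₂) with unique-↭ (↭.prep x (↭.prep a perm₂)) u₁
      ... | u₂@(_ ∷ (_ ∷ a#) ∷ uy@(_ ∷ ub)) =
        -- `(a , b)` stands for the path from `a` through `x` and `y` to `b`. Giving `x` the colour
        -- opposite to `a` gives `y` that of `a`, which is opposite to `b`.
        let σ , ops , os = colour ps ((a , b) ∷ qs₂) ups′ (a# ∷ ub)
            ops′ , oqs′ , τx , τy , τ≡ =
              extend σ (not (σ a)) qs₂ (head∉ u₂ ∘ there ∘ there ∘ there) (head∉ uy ∘ there) ops (All.tail os)
            τa = τ≡ (λ { refl → head∉ u₂ (here refl) }) (a≢y ∘ sym)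
            τb = τ≡ (λ { refl → head∉ u₂ (there (there (here refl))) }) (λ { refl → head∉ uy (here refl) })
        in _ , ops′ ,
           colours₁ (trans τx (cong not (sym τa)))
             (colours₂ (trans τy (trans (not-involutive _) (trans (All.head os) (cong not (sym τb))))) oqs′)

-- Balanced splittings

pairUp : {A : Set} → List A → List (A × A)
pairUp (x ∷ y ∷ xs) = (x , y) ∷ pairUp xs
pairUp _            = []

-- What `pairUp` leaves over: at most one element, kept as a list.
last : {A : Set} → List A → List A
last (x ∷ y ∷ xs) = last xs
last xs           = xs

module _ {A : Set} where

  flat-pairUp : (xs : List A) → flat (pairUp xs) ++ last xs ≡ xs
  flat-pairUp []           = refl
  flat-pairUp (x ∷ [])     = refl
  flat-pairUp (x ∷ y ∷ xs) = cong (λ zs → x ∷ y ∷ zs) (flat-pairUp xs)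

  ∑-last-≤1 : (f : A → ℕ) → (∀ a → f a ≤ 1) → ∀ xs → ∑ f (last xs) ≤ 1
  ∑-last-≤1 f f≤1 []           = z≤n
  ∑-last-≤1 f f≤1 (x ∷ [])     = ≤-trans (≤-reflexive (+-identityʳ (f x))) (f≤1 x)
  ∑-last-≤1 f f≤1 (x ∷ y ∷ xs) = ∑-last-≤1 f f≤1 xs

  ∑-flat : (f : A → ℕ) → ∀ {ps} → All (λ (x , y) → f x + f y ≡ 1) ps → ∑ f (flat ps) ≡ length ps
  ∑-flat f []                 = refl
  ∑-flat f {(x , y) ∷ _} (eq ∷ eqs) =
    trans (sym (+-assoc (f x) (f y) _)) (cong₂ _+_ eq (∑-flat f eqs))

module Split {A : Set} (_≟ᴬ_ : DecidableEquality A) (odd : A → Bool) where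

  BothOdd : A × A → Set
  BothOdd (x , y) = odd x ≡ true × odd y ≡ true

  -- Odd dominoes are matched before the remaining odd elements, so that dominoes as well as lines are balanced.
  dominoes : List A → List (A × A)
  dominoes (x ∷ y ∷ xs) = if odd x ∧ odd y then (x , y) ∷ dominoes xs else dominoes xs
  dominoes _            = []

  singles : List A → List A
  singles (x ∷ y ∷ xs) with odd x | odd y
  ... | true  | true  = singles xs
  ... | true  | false = x ∷ singles xs
  ... | false | true  = y ∷ singles xs
  ... | false | false = singles xs
  singles (x ∷ []) = if odd x then x ∷ [] else []
  singles []       = []

  matching : List A → List (A × A)
  matching xs = dominoes xs ++ pairUp (singles xs)

  singles-odd : ∀ xs → All (λ x → odd x ≡ true) (singles xs)
  singles-odd []       = []
  singles-odd (x ∷ []) with odd x in eq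
  ... | true  = eq ∷ []
  ... | false = []
  singles-odd (x ∷ y ∷ xs) with odd x in eqx | odd y in eqy
  ... | true  | true  = singles-odd xs
  ... | true  | false = eqx ∷ singles-odd xs
  ... | false | true  = eqy ∷ singles-odd xs
  ... | false | false = singles-odd xs

  dominoes-odd : ∀ xs → All BothOdd (dominoes xs)
  dominoes-odd []       = []
  dominoes-odd (x ∷ []) = []
  dominoes-odd (x ∷ y ∷ xs) with odd x in eqx | odd y in eqy
  ... | true  | true  = (eqx , eqy) ∷ dominoes-odd xs
  ... | true  | false = dominoes-odd xs
  ... | false | _     = dominoes-odd xs

  pairUp-odd : ∀ {xs} → All (λ x → odd x ≡ true) xs → All BothOdd (pairUp xs)
  pairUp-odd []              = []
  pairUp-odd (o ∷ [])        = []
  pairUp-odd (o ∷ o′ ∷ os)   = (o , o′) ∷ pairUp-odd os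

  matching-odd : ∀ xs → All BothOdd (matching xs)
  matching-odd xs = All-++⁺ (dominoes-odd xs) (pairUp-odd (singles-odd xs))

  dominoes-singles : ∀ xs → ∃[ rest ] flat (dominoes xs) ++ singles xs ++ rest ↭ xs
  dominoes-singles []       = [] , ↭-refl
  dominoes-singles (x ∷ []) with odd x
  ... | true  = [] , ↭-refl
  ... | false = x ∷ [] , ↭-refl
  dominoes-singles (x ∷ y ∷ xs) with dominoes-singles xs | odd x | odd y
  ... | rest , p | true  | true  = rest , ↭.prep x (↭.prep y p)
  ... | rest , p | true  | false = y ∷ rest ,
    ↭-trans (shift x (flat (dominoes xs)) _) (↭.prep x
      (↭-trans (++⁺ˡ (flat (dominoes xs)) (shift y (singles xs) rest))
               (↭-trans (shift y (flat (dominoes xs)) _) (↭.prep y p))))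
  ... | rest , p | false | true  = x ∷ rest ,
    ↭-trans (shift y (flat (dominoes xs)) _) (↭-trans (↭.prep y
      (↭-trans (++⁺ˡ (flat (dominoes xs)) (shift x (singles xs) rest))
               (↭-trans (shift x (flat (dominoes xs)) _) (↭.prep x p)))) (↭.swap y x ↭-refl))
  ... | rest , p | false | false = x ∷ y ∷ rest ,
    ↭-trans (++⁺ˡ (flat (dominoes xs)) (shifts (singles xs) (x ∷ y ∷ [])))
            (↭-trans (shifts (flat (dominoes xs)) (x ∷ y ∷ [])) (↭.prep x (↭.prep y p)))

  matching-↭ : ∀ xs → ∃[ rest ] flat (matching xs) ++ rest ↭ xs
  matching-↭ xs with dominoes-singles xs
  ... | rest , p = last (singles xs) ++ rest , ↭-trans (↭.↭-reflexive (begin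
    flat (dominoes xs ++ pairUp ss) ++ last ss ++ rest         ≡⟨ cong (_++ last ss ++ rest) (flat-++ (dominoes xs) _) ⟩
    (flat (dominoes xs) ++ flat (pairUp ss)) ++ last ss ++ rest ≡⟨ ++-assoc (flat (dominoes xs)) _ _ ⟩
    flat (dominoes xs) ++ flat (pairUp ss) ++ last ss ++ rest  ≡⟨ cong (flat (dominoes xs) ++_) (++-assoc (flat (pairUp ss)) _ _) ⟨
    flat (dominoes xs) ++ (flat (pairUp ss) ++ last ss) ++ rest ≡⟨ cong (λ zs → flat (dominoes xs) ++ zs ++ rest) (flat-pairUp ss) ⟩
    flat (dominoes xs) ++ ss ++ rest                           ∎)) p
    where
    open ≡-Reasoning
    ss = singles xs

  matchings : List (List A) → List (A × A)
  matchings = concatMap matching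

  matchings-↭ : ∀ lines → ∃[ rest ] flat (matchings lines) ++ rest ↭ concat lines
  matchings-↭ []             = [] , ↭-refl
  matchings-↭ (xs ∷ lines) with matching-↭ xs | matchings-↭ lines
  ... | rest , p | rest′ , p′ = rest ++ rest′ ,
    ↭-trans (↭.↭-reflexive (trans (cong (_++ rest ++ rest′) (flat-++ (matching xs) _)) (++-assoc (flat (matching xs)) _ _)))
      (↭-trans (++⁺ˡ (flat (matching xs)) (shifts (flat (matchings lines)) rest))
        (↭-trans (↭.↭-reflexive (sym (++-assoc (flat (matching xs)) rest _))) (++⁺ p p′)))

  unique-matchings : ∀ {lines} → Unique (concat lines) → Unique (flat (matchings lines))
  unique-matchings {lines} u with matchings-↭ lines
  ... | _ , p = unique-++ˡ _ (unique-↭ (↭-sym p) u)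

  -- The rounding of halves: an odd value is rounded up where `σ` is true and down elsewhere.
  indicator : (A → Bool) → A → ℕ
  indicator σ a = if odd a ∧ σ a then 1 else 0

  indicator≤1 : ∀ σ a → indicator σ a ≤ 1
  indicator≤1 σ a with odd a ∧ σ a
  ... | true  = ≤-refl
  ... | false = z≤n

  module _ (σ : A → Bool) where

    indicator-pair : ∀ {ps} → All BothOdd ps → All (Opposite σ) ps → All (λ (x , y) → indicator σ x + indicator σ y ≡ 1) ps
    indicator-pair []             []       = []
    indicator-pair {(x , y) ∷ _} ((ox , oy) ∷ od) (o ∷ os) = one ∷ indicator-pair od os
      where
      one : indicator σ x + indicator σ y ≡ 1
      one rewrite ox | oy | o with σ y
      ... | true  = refl
      ... | false = refl

    comm : ∀ a b c → a + (b + c) ≡ b + (a + c)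
    comm = solve-∀

    ∑-singles : ∀ xs → ∑ (indicator σ) xs ≡ ∑ (indicator σ) (flat (dominoes xs)) + ∑ (indicator σ) (singles xs)
    ∑-singles []       = refl
    ∑-singles (x ∷ []) with odd x in eq
    ... | true  rewrite eq = refl
    ... | false = refl
    ∑-singles (x ∷ y ∷ xs) with odd x in eqx | odd y in eqy | ∑-singles xs
    ... | true  | true  | IH rewrite eqx | eqy | IH = assoc (if σ x then 1 else 0) (if σ y then 1 else 0) (∑ (indicator σ) (flat (dominoes xs))) _
      where
      assoc : ∀ a b c d → a + (b + (c + d)) ≡ a + (b + c) + d
      assoc = solve-∀
    ... | true  | false | IH rewrite eqx | IH = comm (if σ x then 1 else 0) (∑ (indicator σ) (flat (dominoes xs))) _
    ... | false | true  | IH rewrite eqy | IH = comm (if σ y then 1 else 0) (∑ (indicator σ) (flat (dominoes xs))) _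
    ... | false | false | IH = IH

    -- Each matched pair contributes exactly 1 under any colouring that separates it, so two
    -- opposite colourings differ on a line only by what stays unmatched, at most one odd cell.
    ∑-line : ∀ {xs} → All (Opposite σ) (matching xs) →
             ∑ (indicator σ) xs ≡ length (matching xs) + ∑ (indicator σ) (last (singles xs))
    ∑-line {xs} os = begin
      ∑ χ xs                                                       ≡⟨ ∑-singles xs ⟩
      ∑ χ (flat (dominoes xs)) + ∑ χ ss                            ≡⟨ cong (λ zs → ∑ χ (flat (dominoes xs)) + ∑ χ zs) (flat-pairUp ss) ⟨
      ∑ χ (flat (dominoes xs)) + ∑ χ (flat (pairUp ss) ++ last ss) ≡⟨ cong (∑ χ (flat (dominoes xs)) +_) (∑-++ χ (flat (pairUp ss)) _) ⟩
      ∑ χ (flat (dominoes xs)) + (∑ χ (flat (pairUp ss)) + _)      ≡⟨ +-assoc (∑ χ (flat (dominoes xs))) _ _ ⟨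
      ∑ χ (flat (dominoes xs)) + ∑ χ (flat (pairUp ss)) + _        ≡⟨ cong (_+ ∑ χ (last ss)) (∑-++ χ (flat (dominoes xs)) _) ⟨
      ∑ χ (flat (dominoes xs) ++ flat (pairUp ss)) + _             ≡⟨ cong (λ zs → ∑ χ zs + ∑ χ (last ss)) (flat-++ (dominoes xs) _) ⟨
      ∑ χ (flat (matching xs)) + _                                 ≡⟨ cong (_+ ∑ χ (last ss)) (∑-flat χ (indicator-pair (matching-odd xs) os)) ⟩
      length (matching xs) + ∑ χ (last ss)                         ∎
      where
      open ≡-Reasoning
      χ  = indicator σ
      ss = singles xs

-- Halving a function evenly on lines, dominoes and cells

pair : {A : Set} → A × A → List A
pair (x , y) = x ∷ y ∷ []

Halving : {A : Set} → (A → ℕ) → List A → List (List A) → Set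
Halving {A} S cells lines = ∃₂ λ P Q → (∀ a → P a + Q a ≡ S a) ×
  (∀ {ℓ} → ℓ ∈ lines ++ map pair (concatMap pairUp lines) ++ map (_∷ []) cells → Close (∑ P ℓ) (∑ Q ℓ))

isOdd : ℕ → Bool
isOdd zero          = false
isOdd (suc zero)    = true
isOdd (suc (suc n)) = isOdd n

halves : ∀ n → ⌊ n /2⌋ + ⌊ n /2⌋ + (if isOdd n then 1 else 0) ≡ n
halves zero          = refl
halves (suc zero)    = refl
halves (suc (suc n)) = trans (step ⌊ n /2⌋ _) (cong (2 +_) (halves n))
  where
  step : ∀ h b → suc h + suc h + b ≡ 2 + (h + h + b)
  step = solve-∀

close-+ : ∀ c {x y} → Close x y → Close (c + x) (c + y)
close-+ c (p , q) = ≤-trans (+-monoʳ-≤ c p) (≤-reflexive (+-suc c _)) ,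
                    ≤-trans (+-monoʳ-≤ c q) (≤-reflexive (+-suc c _))

close-≤1 : ∀ {x y} → x ≤ 1 → y ≤ 1 → Close x y
close-≤1 x≤1 y≤1 = ≤-trans x≤1 (s≤s z≤n) , ≤-trans y≤1 (s≤s z≤n)

module _ {A : Set} (_≟ᴬ_ : DecidableEquality A) where

  -- Every value is halved, and the odd ones are rounded up in `P` or in `Q` by colour. Rows and
  -- columns each supply one matching of odd cells, and one colouring separates the pairs of both.
  halve : ∀ cells rows cols → Unique (concat rows) → Unique (concat cols) → (S : A → ℕ) →
          Halving S cells (rows ++ cols)
  halve cells rows cols urows ucols S =
    P , Q , sums , λ {ℓ} ℓ∈ → subst₂ Close (sym (∑-+ h (χ σ) ℓ)) (sym (∑-+ h (χ (not ∘ σ)) ℓ))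
                                       (close-+ (∑ h ℓ) (close-χ ℓ∈))
    where
    odd : A → Bool
    odd a = isOdd (S a)
    open Split _≟ᴬ_ odd
    coloured = Colouring.colour _≟ᴬ_ (matchings rows) (matchings cols)
                 (unique-matchings {rows} urows) (unique-matchings {cols} ucols)
    σ : A → Bool
    σ = proj₁ coloured

    χ : (A → Bool) → A → ℕ
    χ = indicator
    h P Q : A → ℕ
    h a = ⌊ S a /2⌋
    P a = h a + χ σ a
    Q a = h a + χ (not ∘ σ) a

    sums : ∀ a → P a + Q a ≡ S a
    sums a = trans (regroup (h a) (χ σ a) (χ (not ∘ σ) a)) (trans (cong (h a + h a +_) both) (halves (S a)))
      where
      regroup : ∀ h x y → (h + x) + (h + y) ≡ h + h + (x + y)
      regroup = solve-∀
      both : χ σ a + χ (not ∘ σ) a ≡ (if odd a then 1 else 0)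
      both with odd a | σ a
      ... | true  | true  = refl
      ... | true  | false = refl
      ... | false | _     = refl

    opposite-lines : All (λ xs → All (Opposite σ) (matching xs)) (rows ++ cols)
    opposite-lines = All-++⁺ {xs = rows} (All-map⁻ (concat⁻ (proj₁ (proj₂ coloured))))
                             (All-map⁻ (concat⁻ (proj₂ (proj₂ coloured))))

    domino∈ : ∀ {x y xs} → (x , y) ∈ pairUp xs → BothOdd (x , y) → (x , y) ∈ dominoes xs
    domino∈ {xs = x ∷ y ∷ xs} (here refl) (ox , oy) rewrite ox | oy = here refl
    domino∈ {xs = x ∷ y ∷ xs} (there p) oo with odd x ∧ odd y
    ... | true  = there (domino∈ p oo)
    ... | false = domino∈ p oo

    close-line : ∀ {xs} → All (Opposite σ) (matching xs) → Close (∑ (χ σ) xs) (∑ (χ (not ∘ σ)) xs)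
    close-line {xs} os =
      subst₂ Close (sym (∑-line σ {xs} os)) (sym (∑-line (not ∘ σ) {xs} (All.map (cong not) os)))
        (close-+ (length (matching xs)) (close-≤1 (∑-last-≤1 (χ σ) (indicator≤1 σ) (singles xs))
                                                  (∑-last-≤1 (χ (not ∘ σ)) (indicator≤1 _) (singles xs))))

    if≤1 : ∀ b → (if b then 1 else 0) + 0 ≤ 1
    if≤1 true  = ≤-refl
    if≤1 false = z≤n

    -- A domino with two odd cells is itself a matched pair, so each part rounds up exactly one of
    -- them; otherwise at most one cell is rounded up at all.
    close-pair : ∀ {xs x y} → All (Opposite σ) (matching xs) → (x , y) ∈ pairUp xs →
                 Close (∑ (χ σ) (pair (x , y))) (∑ (χ (not ∘ σ)) (pair (x , y)))
    close-pair {xs} {x} {y} os p with odd x in eqx | odd y in eqy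
    ... | false | false = close-refl
    ... | true  | false = close-≤1 (if≤1 (σ x)) (if≤1 (not (σ x)))
    ... | false | true  = close-≤1 (if≤1 (σ y)) (if≤1 (not (σ y)))
    ... | true  | true  rewrite All.lookup os (∈-++⁺ˡ (domino∈ {xs = xs} p (eqx , eqy))) with σ y
    ...   | true  = close-refl
    ...   | false = close-refl

    close-χ : ∀ {ℓ} → ℓ ∈ (rows ++ cols) ++ map pair (concatMap pairUp (rows ++ cols)) ++ map (_∷ []) cells →
              Close (∑ (χ σ) ℓ) (∑ (χ (not ∘ σ)) ℓ)
    close-χ {ℓ} ℓ∈ with ∈-++⁻ (rows ++ cols) ℓ∈
    ... | inj₁ line = close-line {ℓ} (All.lookup opposite-lines line)
    ... | inj₂ ℓ∈′ with ∈-++⁻ (map pair (concatMap pairUp (rows ++ cols))) ℓ∈′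
    ...   | inj₁ domino with ∈-map⁻ pair domino
    ...     | xy , xy∈ , refl with ∈-concat⁻′ (map pairUp (rows ++ cols)) xy∈
    ...       | _ , xy∈ps , ps∈ with ∈-map⁻ pairUp ps∈
    ...         | line , line∈ , refl = close-pair (All.lookup opposite-lines line∈) xy∈ps
    close-χ ℓ∈ | inj₂ ℓ∈′ | inj₂ single with ∈-map⁻ (_∷ []) single
    ... | a , _ , refl = close-≤1 (≤-trans (≤-reflexive (+-identityʳ (χ σ a))) (indicator≤1 σ a))
                                  (≤-trans (≤-reflexive (+-identityʳ (χ (not ∘ σ) a))) (indicator≤1 (not ∘ σ) a))

-- Balanced decompositions into several parts

module Rebalance {A : Set} (L : List (List A))
                 (split : (S : A → ℕ) → ∃₂ λ P Q → (∀ a → P a + Q a ≡ S a) × (∀ {ℓ} → ℓ ∈ L → Close (∑ P ℓ) (∑ Q ℓ)))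
                 where

  CloseOnL : (A → ℕ) → (A → ℕ) → Set
  CloseOnL P Q = All (λ ℓ → Close (∑ P ℓ) (∑ Q ℓ)) L

  closeOnL? : ∀ P Q → Dec (CloseOnL P Q)
  closeOnL? P Q = all? (λ ℓ → (∑ P ℓ ≤? suc (∑ Q ℓ)) ×-dec (∑ Q ℓ ≤? suc (∑ P ℓ))) L

  energy : (A → ℕ) → ℕ
  energy P = ∑ (λ ℓ → ∑ P ℓ * ∑ P ℓ) L

  pairwise? : ∀ Ps → AllPairs CloseOnL Ps ⊎ (∃[ P ] ∃[ Q ] ∃[ Rs ] (Ps ↭ P ∷ Q ∷ Rs × ¬ CloseOnL P Q))
  pairwise? []       = inj₁ []
  pairwise? (P ∷ Ps) with pairwise? Ps
  ... | inj₂ (Q , R , Rs , p , far) = inj₂ (Q , R , P ∷ Rs , ↭-trans (↭.prep P p) (shifts (P ∷ []) (Q ∷ R ∷ [])) , far)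
  ... | inj₁ close with all? (closeOnL? P) Ps
  ...   | yes all = inj₁ (all ∷ close)
  ...   | no ¬all with find (¬All⇒Any¬ (closeOnL? P) Ps ¬all)
  ...     | Q , Q∈ , far with ∈-∃++ Q∈
  ...       | xs , ys , refl = inj₂ (P , Q , xs ++ ys , ↭.prep P (shift Q xs ys) , far)

  balanced₂ : {B : Set} (g : B → ℕ) {x y : B} → Close (g x) (g y) → Balanced g (x ∷ y ∷ [])
  balanced₂ g (p , q) (here refl)         (here refl)         = n≤1+n _
  balanced₂ g (p , q) (here refl)         (there (here refl)) = p
  balanced₂ g (p , q) (there (here refl)) (here refl)         = q
  balanced₂ g (p , q) (there (here refl)) (there (here refl)) = n≤1+n _

  ∑-sum : ∀ {P Q S : A → ℕ} → (∀ a → P a + Q a ≡ S a) → ∀ ℓ → ∑ P ℓ + ∑ Q ℓ ≡ ∑ S ℓ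
  ∑-sum {P} {Q} eq ℓ = trans (sym (∑-+ P Q ℓ)) (∑-cong eq ℓ)

  -- On each functional the new pair has the old sum and is balanced, so its squares do not grow; on
  -- a functional where the old pair was far apart they drop.
  swap-energy : ∀ {P Q P′ Q′} → (∀ a → P′ a + Q′ a ≡ P a + Q a) → CloseOnL P′ Q′ → ¬ CloseOnL P Q →
                energy P′ + energy Q′ < energy P + energy Q
  swap-energy {P} {Q} {P′} {Q′} eq close far with find (¬All⇒Any¬ (λ ℓ → (∑ P ℓ ≤? suc (∑ Q ℓ)) ×-dec (∑ Q ℓ ≤? suc (∑ P ℓ))) L far)
  ... | ℓ , ℓ∈ , ¬close = subst₂ _<_ (sum-energy P′ Q′) (sum-energy P Q)
      (∑-mono-< (All.tabulate (λ {ℓ′} → weak {ℓ′})) ℓ∈ strict)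
    where
    sum-energy : ∀ P Q → ∑ (λ ℓ → ∑ (λ R → ∑ R ℓ * ∑ R ℓ) (P ∷ Q ∷ [])) L ≡ energy P + energy Q
    sum-energy P Q = trans (∑-cong (λ ℓ → cong (∑ P ℓ * ∑ P ℓ +_) (+-identityʳ _)) L) (∑-+ _ _ L)
    sums : ∀ ℓ → ∑ (λ R → ∑ R ℓ) (P′ ∷ Q′ ∷ []) ≡ ∑ (λ R → ∑ R ℓ) (P ∷ Q ∷ [])
    sums ℓ = trans (cong (∑ P′ ℓ +_) (+-identityʳ _))
             (trans (trans (∑-sum eq ℓ) (∑-+ P Q ℓ)) (cong (∑ P ℓ +_) (sym (+-identityʳ _))))
    bal : ∀ {ℓ} → ℓ ∈ L → Balanced (λ R → ∑ R ℓ) (P′ ∷ Q′ ∷ [])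
    bal {ℓ} ℓ∈ = balanced₂ (λ R → ∑ R ℓ) (All.lookup close ℓ∈)
    weak : ∀ {ℓ} → ℓ ∈ L → _
    weak {ℓ} ℓ∈ = ∑-sq-min (λ R → ∑ R ℓ) {ys = P ∷ Q ∷ []} (bal ℓ∈) refl (sums ℓ)
    strict : ∑ (λ R → ∑ R ℓ * ∑ R ℓ) (P′ ∷ Q′ ∷ []) < ∑ (λ R → ∑ R ℓ * ∑ R ℓ) (P ∷ Q ∷ [])
    strict with ∑ P ℓ ≤? suc (∑ Q ℓ) | ∑ Q ℓ ≤? suc (∑ P ℓ)
    ... | yes p | yes q = contradiction (p , q) ¬close
    ... | no ¬p | _     = ∑-sq-strict (λ R → ∑ R ℓ) {P′ ∷ Q′ ∷ []} {P ∷ Q ∷ []} (bal ℓ∈) refl (sums ℓ) {P} {Q} (here refl) (there (here refl)) (≰⇒> ¬p)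
    ... | _     | no ¬q = ∑-sq-strict (λ R → ∑ R ℓ) {P′ ∷ Q′ ∷ []} {P ∷ Q ∷ []} (bal ℓ∈) refl (sums ℓ) {Q} {P} (there (here refl)) (here refl) (≰⇒> ¬q)

  Rebalanced : List (A → ℕ) → Set
  Rebalanced Ps = ∃[ Qs ] (length Qs ≡ length Ps × (∀ a → ∑ (λ Q → Q a) Qs ≡ ∑ (λ P → P a) Ps) × AllPairs CloseOnL Qs)

  -- While some pair of parts is far apart on a functional, it is replaced by an even splitting of
  -- its sum. The total energy drops each time, so this ends.
  rebalance : ∀ Ps → Rebalanced Ps
  rebalance Ps = go Ps (<-wellFounded (∑ energy Ps))
    where
    go : ∀ Ps → Acc _<_ (∑ energy Ps) → Rebalanced Ps
    go Ps (acc rec) with pairwise? Ps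
    ... | inj₁ close = Ps , refl , (λ _ → refl) , close
    ... | inj₂ (P , Q , Rs , perm , far) =
      let P′ , Q′ , eq , close = split (λ a → P a + Q a)
          Qs , len , sums , close′ = go (P′ ∷ Q′ ∷ Rs) (rec (subst₂ _<_ (+-assoc (energy P′) _ _)
            (trans (+-assoc (energy P) _ _) (sym (∑-↭ energy perm)))
            (+-monoˡ-< (∑ energy Rs) (swap-energy {P} {Q} eq (All.tabulate close) far))))
      in Qs , trans len (sym (↭-length perm)) , (λ a →
           trans (sums a) (trans (regroup a {P′} {Q′} eq Rs) (sym (∑-↭ (λ R → R a) perm)))) , close′
      where
      regroup : ∀ a {P′ Q′} → (∀ a → P′ a + Q′ a ≡ P a + Q a) → ∀ Rs →
                ∑ (λ R → R a) (P′ ∷ Q′ ∷ Rs) ≡ ∑ (λ R → R a) (P ∷ Q ∷ Rs)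
      regroup a {P′} eq Rs = trans (sym (+-assoc (P′ a) _ _))
        (trans (cong (_+ ∑ (λ R → R a) Rs) (eq a)) (+-assoc (P a) _ _))

-- Monomials

module _ {N : ℕ} where

  ·-comm : (u v : Monomial N) → u · v ≡ v · u
  ·-comm = Vec.zipWith-comm +-comm

  ·-assoc : (u v w : Monomial N) → (u · v) · w ≡ u · (v · w)
  ·-assoc = Vec.zipWith-assoc +-assoc

  ·-identityˡ : (u : Monomial N) → 𝟙 · u ≡ u
  ·-identityˡ = Vec.zipWith-identityˡ +-identityˡ

  lookup-· : ∀ (u v : Monomial N) i → lookup (u · v) i ≡ lookup u i + lookup v i
  lookup-· u v i = Vec.lookup-zipWith _+_ i u v

  lookup-injective : ∀ {u v : Monomial N} → (∀ i → lookup u i ≡ lookup v i) → u ≡ v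
  lookup-injective eq = trans (sym (Vec.tabulate∘lookup _)) (trans (Vec.tabulate-cong eq) (Vec.tabulate∘lookup _))

  ≤⇒divides : ∀ {u v : Monomial N} → (∀ i → lookup u i ≤ lookup v i) → u Divides v
  ≤⇒divides {u} {v} u≤v = zipWith _∸_ v u , lookup-injective λ i →
    trans (sym (m∸n+n≡m (u≤v i)))
      (sym (trans (lookup-· (zipWith _∸_ v u) u i) (cong (_+ lookup u i) (Vec.lookup-zipWith _∸_ i v u))))

unit : ∀ {N} → Fin N → Monomial N
unit zero    = 1 ∷ 𝟙
unit (suc i) = 0 ∷ unit i

mon : ∀ {N} → List (Fin N) → Monomial N
mon []       = 𝟙
mon (i ∷ is) = unit i · mon is

-- The additive extension of `f` from variables to monomials. Degree, weight and the coordinates of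
-- the sum of the points are all of this form.
dot : ∀ {N} → (Fin N → ℕ) → Monomial N → ℕ
dot f []      = 0
dot f (x ∷ u) = x * f zero + dot (f ∘ suc) u

dot-𝟙 : ∀ {N} (f : Fin N → ℕ) → dot f 𝟙 ≡ 0
dot-𝟙 {zero}  f = refl
dot-𝟙 {suc N} f = dot-𝟙 (f ∘ suc)

dot-· : ∀ {N} (f : Fin N → ℕ) u v → dot f (u · v) ≡ dot f u + dot f v
dot-· f []      []      = refl
dot-· f (x ∷ u) (y ∷ v) = trans (cong ((x + y) * f zero +_) (dot-· (f ∘ suc) u v))
                                (rearrange x y (f zero) _ _)
  where
  rearrange : ∀ x y a b c → (x + y) * a + (b + c) ≡ (x * a + b) + (y * a + c)
  rearrange = solve-∀

dot-unit : ∀ {N} (f : Fin N → ℕ) i → dot f (unit i) ≡ f i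
dot-unit f zero    = trans (cong (1 * f zero +_) (dot-𝟙 (f ∘ suc))) (trans (+-identityʳ _) (*-identityˡ _))
dot-unit f (suc i) = dot-unit (f ∘ suc) i

dot-mon : ∀ {N} (f : Fin N → ℕ) is → dot f (mon is) ≡ ∑ f is
dot-mon f []       = dot-𝟙 f
dot-mon f (i ∷ is) = trans (dot-· f (unit i) (mon is)) (cong₂ _+_ (dot-unit f i) (dot-mon f is))

dot-degree : ∀ {N} (u : Monomial N) → dot (const 1) u ≡ degree u
dot-degree []      = refl
dot-degree (x ∷ u) = cong₂ _+_ (*-identityʳ x) (dot-degree u)

degree-· : ∀ {N} (u v : Monomial N) → degree (u · v) ≡ degree u + degree v
degree-· u v = trans (sym (dot-degree (u · v))) (trans (dot-· _ u v) (cong₂ _+_ (dot-degree u) (dot-degree v)))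

degree-unit : ∀ {N} (i : Fin N) → degree (unit i) ≡ 1
degree-unit i = trans (sym (dot-degree (unit i))) (dot-unit (const 1) i)

degree-mon : ∀ {N} (is : List (Fin N)) → degree (mon is) ≡ length is
degree-mon is = trans (sym (dot-degree (mon is))) (trans (dot-mon _ is) (trans (∑-const 1 is) (*-identityʳ _)))

degree≡0⇒≡𝟙 : ∀ {N} (u : Monomial N) → degree u ≡ 0 → u ≡ 𝟙
degree≡0⇒≡𝟙 []         _  = refl
degree≡0⇒≡𝟙 (zero ∷ u) eq = cong (0 ∷_) (degree≡0⇒≡𝟙 u eq)

degree-𝟙 : ∀ N → degree (𝟙 {N}) ≡ 0
degree-𝟙 zero    = refl
degree-𝟙 (suc N) = degree-𝟙 N

lookup≤degree : ∀ {N} (u : Monomial N) i → lookup u i ≤ degree u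
lookup≤degree (x ∷ u) zero    = m≤m+n x _
lookup≤degree (x ∷ u) (suc i) = ≤-trans (lookup≤degree u i) (m≤n+m _ x)

lookup-unit-same : ∀ {N} (i : Fin N) → lookup (unit i) i ≡ 1
lookup-unit-same zero    = refl
lookup-unit-same (suc i) = lookup-unit-same i

lookup-unit-other : ∀ {N} {i j : Fin N} → i ≢ j → lookup (unit i) j ≡ 0
lookup-unit-other {i = zero}  {zero}  i≢j = contradiction refl i≢j
lookup-unit-other {i = zero}  {suc j} i≢j = Vec.lookup-replicate j 0
lookup-unit-other {i = suc i} {zero}  i≢j = refl
lookup-unit-other {i = suc i} {suc j} i≢j = lookup-unit-other (i≢j ∘ cong suc)

∈⇒lookup-mon≥1 : ∀ {N} {i : Fin N} {is} → i ∈ is → 1 ≤ lookup (mon is) i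
∈⇒lookup-mon≥1 {i = i} {j ∷ is} (here refl) =
  ≤-trans (≤-reflexive (sym (lookup-unit-same i))) (≤-trans (m≤m+n _ _) (≤-reflexive (sym (lookup-· (unit i) (mon is) i))))
∈⇒lookup-mon≥1 {i = i} {j ∷ is} (there i∈) =
  ≤-trans (∈⇒lookup-mon≥1 i∈) (≤-trans (m≤n+m _ (lookup (unit j) i)) (≤-reflexive (sym (lookup-· (unit j) (mon is) i))))

∉⇒lookup-mon≡0 : ∀ {N} {i : Fin N} {is} → i ∉ is → lookup (mon is) i ≡ 0
∉⇒lookup-mon≡0 {i = i} {[]}     i∉ = Vec.lookup-replicate i 0
∉⇒lookup-mon≡0 {i = i} {j ∷ is} i∉ = trans (lookup-· (unit j) (mon is) i)
  (cong₂ _+_ (lookup-unit-other (i∉ ∘ here ∘ sym)) (∉⇒lookup-mon≡0 (i∉ ∘ there)))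

lookup-mon≤1 : ∀ {N} {is : List (Fin N)} → Unique is → ∀ i → lookup (mon is) i ≤ 1
lookup-mon≤1 []                       i = ≤-trans (≤-reflexive (Vec.lookup-replicate i 0)) z≤n
lookup-mon≤1 {is = j ∷ is} (j∉ ∷ u) i with j Fin.≟ i
... | yes refl = ≤-reflexive (trans (lookup-· (unit i) (mon is) i)
                   (cong₂ _+_ (lookup-unit-same i) (∉⇒lookup-mon≡0 (λ i∈ → All.lookup j∉ i∈ refl))))
... | no j≢i   = ≤-trans (≤-reflexive (trans (lookup-· (unit j) (mon is) i) (cong (_+ _) (lookup-unit-other j≢i))))
                   (lookup-mon≤1 u i)

squarefree-mon : ∀ {N} {is : List (Fin N)} → Unique is → SquarefreeMonomial (mon is)
squarefree-mon u = lookup⁻ (lookup-mon≤1 u)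

mon-divides : ∀ {N} {is js : List (Fin N)} → Unique is → (∀ {i} → i ∈ is → i ∈ js) → mon is Divides mon js
mon-divides {is = is} u sub = ≤⇒divides λ i → bound i
  where
  open import Data.List.Membership.DecPropositional Fin._≟_ using (_∈?_)
  bound : ∀ i → _
  bound i with i ∈? is
  ... | yes i∈ = ≤-trans (lookup-mon≤1 u i) (∈⇒lookup-mon≥1 (sub i∈))
  ... | no  i∉ = ≤-trans (≤-reflexive (∉⇒lookup-mon≡0 i∉)) z≤n

variables : ∀ {N} → Monomial N → List (Fin N)
variables []      = []
variables (x ∷ u) = List.replicate x zero ++ map suc (variables u)

mon-variables : ∀ {N} (u : Monomial N) → mon (variables u) ≡ u
mon-variables []          = refl
mon-variables (zero ∷ u)  = trans (mon-suc (variables u)) (cong (0 ∷_) (mon-variables u))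
  where
  mon-suc : ∀ {N} (is : List (Fin N)) → mon (map suc is) ≡ 0 ∷ mon is
  mon-suc []       = refl
  mon-suc (i ∷ is) = cong (unit (suc i) ·_) (mon-suc is)
mon-variables (suc x ∷ u) = trans (cong (unit zero ·_) (mon-variables (x ∷ u))) (cong (suc x ∷_) (·-identityˡ u))

∈-variables : ∀ {N} (u : Monomial N) {i} → i ∈ variables u → ∃[ v ] u ≡ unit i · v
∈-variables u i∈ with ∈-∃++ i∈
... | is , js , eq = _ , trans (sym (mon-variables u)) (trans (cong mon eq) (extract is))
  where
  extract : ∀ is {i js} → mon (is ++ i ∷ js) ≡ unit i · mon (is ++ js)
  extract []       = refl
  extract (j ∷ is) {i} = trans (cong (unit j ·_) (extract is))
    (trans (sym (·-assoc (unit j) (unit i) _))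
      (trans (cong (_· _) (·-comm (unit j) (unit i))) (·-assoc (unit i) (unit j) _)))

length-variables : ∀ {N} (u : Monomial N) → length (variables u) ≡ degree u
length-variables u = trans (sym (degree-mon (variables u))) (cong degree (mon-variables u))

lookup≥1⇒∈ : ∀ {N} (u : Monomial N) {i} → 1 ≤ lookup u i → i ∈ variables u
lookup≥1⇒∈ u {i} pos with i ∈? variables u
  where open import Data.List.Membership.DecPropositional Fin._≟_ using (_∈?_)
... | yes i∈ = i∈
... | no  i∉ = contradiction
  (trans (cong (λ w → lookup w i) (sym (mon-variables u))) (∉⇒lookup-mon≡0 i∉)) (>⇒≢ pos)

∈⇒lookup≥1 : ∀ {N} (u : Monomial N) {i} → i ∈ variables u → 1 ≤ lookup u i
∈⇒lookup≥1 u {i} i∈ = subst (λ w → 1 ≤ lookup w i) (mon-variables u) (∈⇒lookup-mon≥1 i∈)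

-- Term orders refining degree and weight by a reverse lexicographic order

module _ {A : Set} (f : A → ℕ) (R : Rel A 0ℓ) where

  FirstBy : Rel A 0ℓ
  FirstBy u v = f u < f v ⊎ (f u ≡ f v × R u v)

  firstBy-refl : ∀ u → R u u → FirstBy u u
  firstBy-refl u r = inj₂ (refl , r)

  firstBy-trans : ∀ u v w → (R u v → R v w → R u w) → FirstBy u v → FirstBy v w → FirstBy u w
  firstBy-trans u v w t (inj₁ p)       (inj₁ q)       = inj₁ (<-trans p q)
  firstBy-trans u v w t (inj₁ p)       (inj₂ (q , _)) = inj₁ (<-≤-trans p (≤-reflexive q))
  firstBy-trans u v w t (inj₂ (p , _)) (inj₁ q)       = inj₁ (≤-<-trans (≤-reflexive p) q)
  firstBy-trans u v w t (inj₂ (p , r)) (inj₂ (q , s)) = inj₂ (trans p q , t r s)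

  firstBy-total : ∀ u v → R u v ⊎ R v u → FirstBy u v ⊎ FirstBy v u
  firstBy-total u v t with <-cmp (f u) (f v)
  ... | tri< p _ _ = inj₁ (inj₁ p)
  ... | tri> _ _ p = inj₂ (inj₁ p)
  firstBy-total u v (inj₁ r) | tri≈ _ p _ = inj₁ (inj₂ (p , r))
  firstBy-total u v (inj₂ r) | tri≈ _ p _ = inj₂ (inj₂ (sym p , r))

  firstBy-antisym : ∀ u v → FirstBy u v → FirstBy v u → R u v × R v u
  firstBy-antisym u v (inj₁ p)       (inj₁ q)       = contradiction q (<-asym p)
  firstBy-antisym u v (inj₁ p)       (inj₂ (q , _)) = contradiction (sym q) (<⇒≢ p)
  firstBy-antisym u v (inj₂ (p , _)) (inj₁ q)       = contradiction (sym p) (<⇒≢ q)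
  firstBy-antisym u v (inj₂ (_ , r)) (inj₂ (_ , s)) = r , s

module WeightedRevLex {N : ℕ} (weight : Fin N → ℕ) (vars : List (Fin N)) where

  -- The first variable of the list in which two monomials differ counts as the cheapest:
  -- the monomial with more of it is smaller.
  RevLex : List (Fin N) → Rel (Monomial N) 0ℓ
  RevLex []       u v = ⊤
  RevLex (i ∷ is) u v = lookup v i < lookup u i ⊎ (lookup u i ≡ lookup v i × RevLex is u v)

  ByWeight : Rel (Monomial N) 0ℓ
  ByWeight = FirstBy (dot weight) (RevLex vars)

  infix 4 _≼_
  _≼_ : Rel (Monomial N) 0ℓ
  _≼_ = FirstBy degree ByWeight


  revLex-refl : ∀ is {u} → RevLex is u u
  revLex-refl []       = tt
  revLex-refl (i ∷ is) = inj₂ (refl , revLex-refl is)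

  revLex-trans : ∀ is {u v w} → RevLex is u v → RevLex is v w → RevLex is u w
  revLex-trans []       _              _              = tt
  revLex-trans (i ∷ is) (inj₁ p)       (inj₁ q)       = inj₁ (<-trans q p)
  revLex-trans (i ∷ is) (inj₁ p)       (inj₂ (q , _)) = inj₁ (≤-<-trans (≤-reflexive (sym q)) p)
  revLex-trans (i ∷ is) (inj₂ (p , _)) (inj₁ q)       = inj₁ (<-≤-trans q (≤-reflexive (sym p)))
  revLex-trans (i ∷ is) (inj₂ (p , r)) (inj₂ (q , s)) = inj₂ (trans p q , revLex-trans is r s)

  revLex-total : ∀ is u v → RevLex is u v ⊎ RevLex is v u
  revLex-total []       u v = inj₁ tt
  revLex-total (i ∷ is) u v with <-cmp (lookup u i) (lookup v i) | revLex-total is u v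
  ... | tri< p _ _ | _      = inj₂ (inj₁ p)
  ... | tri> _ _ p | _      = inj₁ (inj₁ p)
  ... | tri≈ _ p _ | inj₁ r = inj₁ (inj₂ (p , r))
  ... | tri≈ _ p _ | inj₂ r = inj₂ (inj₂ (sym p , r))

  revLex-antisym : ∀ is {u v} → RevLex is u v → RevLex is v u → All (λ i → lookup u i ≡ lookup v i) is
  revLex-antisym []       _              _              = []
  revLex-antisym (i ∷ is) (inj₁ p)       (inj₁ q)       = contradiction q (<-asym p)
  revLex-antisym (i ∷ is) (inj₁ p)       (inj₂ (q , _)) = contradiction q (<⇒≢ p)
  revLex-antisym (i ∷ is) (inj₂ (p , _)) (inj₁ q)       = contradiction p (<⇒≢ q)
  revLex-antisym (i ∷ is) (inj₂ (p , r)) (inj₂ (_ , s)) = p ∷ revLex-antisym is r s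

  revLex-· : ∀ is {u v} w → RevLex is u v → RevLex is (w · u) (w · v)
  revLex-· []       w _ = tt
  revLex-· (i ∷ is) {u} {v} w r rewrite lookup-· w u i | lookup-· w v i with r
  ... | inj₁ p       = inj₁ (+-monoʳ-< (lookup w i) p)
  ... | inj₂ (p , s) = inj₂ (cong (lookup w i +_) p , revLex-· is w s)

  isTermOrder : (∀ i → i ∈ vars) → IsTermOrder _≼_
  isTermOrder complete = record
    { isTotalOrder = record
      { isPartialOrder = record
        { isPreorder = record
          { isEquivalence = isEquivalence
          ; reflexive     = λ { {u} refl → refl-≼ u }
          ; trans         = λ {u} {v} {w} →
              firstBy-trans degree ByWeight u v w (firstBy-trans (dot weight) (RevLex vars) u v w (revLex-trans vars {u}))
          }
        ; antisym = antisym
        }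
      ; total = λ u v →
          firstBy-total degree ByWeight u v (firstBy-total (dot weight) (RevLex vars) u v (revLex-total vars u v))
      }
    ; 𝟙-minimum  = minimum-𝟙
    ; ·-monotone = monotone
    }
    where
    refl-≼ : ∀ u → u ≼ u
    refl-≼ u = firstBy-refl degree ByWeight u (firstBy-refl (dot weight) (RevLex vars) u (revLex-refl vars))

    antisym : ∀ {u v} → u ≼ v → v ≼ u → u ≡ v
    antisym {u} {v} p q =
      let p₁ , q₁ = firstBy-antisym degree ByWeight u v p q
          p₂ , q₂ = firstBy-antisym (dot weight) (RevLex vars) u v p₁ q₁
      in lookup-injective λ i → All.lookup (revLex-antisym vars {u} {v} p₂ q₂) (complete i)

    minimum-𝟙 : ∀ u → 𝟙 ≼ u
    minimum-𝟙 u with degree u ≟ 0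
    ... | yes eq = subst (𝟙 ≼_) (sym (degree≡0⇒≡𝟙 u eq)) (refl-≼ 𝟙)
    ... | no  ne = inj₁ (≤-<-trans (≤-reflexive (degree-𝟙 N)) (n≢0⇒n>0 ne))

    monotone : ∀ {u v} w → u ≼ v → (w · u) ≼ (w · v)
    monotone {u} {v} w p rewrite degree-· w u | degree-· w v | dot-· weight w u | dot-· weight w v with p
    ... | inj₁ q = inj₁ (+-monoʳ-< (degree w) q)
    ... | inj₂ (eq , inj₁ q) = inj₂ (cong (degree w +_) eq , inj₁ (+-monoʳ-< (dot weight w) q))
    ... | inj₂ (eq , inj₂ (eq′ , q)) =
      inj₂ (cong (degree w +_) eq , inj₂ (cong (dot weight w +_) eq′ , revLex-· vars w q))

  ≼⇒degree≤ : ∀ {u v} → u ≼ v → degree u ≤ degree v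
  ≼⇒degree≤ (inj₁ p)       = <⇒≤ p
  ≼⇒degree≤ (inj₂ (p , _)) = ≤-reflexive p

  ≼⇒weight≤ : ∀ {u v} → degree u ≡ degree v → u ≼ v → dot weight u ≤ dot weight v
  ≼⇒weight≤ eq (inj₁ p)                    = contradiction eq (<⇒≢ p)
  ≼⇒weight≤ eq (inj₂ (_ , inj₁ p))       = <⇒≤ p
  ≼⇒weight≤ eq (inj₂ (_ , inj₂ (p , _))) = ≤-reflexive p

  weight<⇒≼ : ∀ {u v} → degree u ≡ degree v → dot weight u < dot weight v → u ≼ v
  weight<⇒≼ eq lt = inj₂ (eq , inj₁ lt)

  -- `u` contains neither `b` nor a cheaper variable.
  Precedes : Fin N → Monomial N → Set
  Precedes b u = ∃₂ λ is js → vars ≡ is ++ b ∷ js × All (λ i → lookup u i ≡ 0) (is ++ b ∷ [])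

  -- `v` contains `b` and `u` nothing up to `b` in `vars`, so on a tie of weights the first
  -- difference is a variable of which `v` has more.
  precedes-≼ : ∀ {b u v} → degree v ≡ degree u → dot weight v ≤ dot weight u →
               1 ≤ lookup v b → Precedes b u → v ≼ u
  precedes-≼ {b} {u} {v} deg w≤ pos (is , js , eq , zeros) with m≤n⇒m<n∨m≡n w≤
  ... | inj₁ lt = weight<⇒≼ deg lt
  ... | inj₂ w≡ = inj₂ (deg , inj₂ (w≡ , subst (λ vs → RevLex vs v u) (sym eq) (go is zeros)))
    where
    go : ∀ is → All (λ i → lookup u i ≡ 0) (is ++ b ∷ []) → RevLex (is ++ b ∷ js) v u
    go []       (z ∷ _) rewrite z = inj₁ pos
    go (i ∷ is) (z ∷ zs) with lookup v i in eqv
    ... | zero  = inj₂ (sym z , go is zs)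
    ... | suc _ rewrite z = inj₁ z<s

  -- Once degree and weight tie, the first variable with different exponents decides, and `v` has
  -- more of it. Disjointness makes the exponent of `u` zero there, and turns the equal exponents
  -- before it into zeros.
  ≼-precedes : (∀ i → i ∈ vars) → ∀ {u v} → v ≼ u → v ≢ u → degree v ≡ degree u → dot weight v ≡ dot weight u →
               (∀ i → ¬ (1 ≤ lookup v i × 1 ≤ lookup u i)) → ∃[ b ] (1 ≤ lookup v b × Precedes b u)
  ≼-precedes complete (inj₁ p) v≢u deg w≡ dis = contradiction deg (<⇒≢ p)
  ≼-precedes complete (inj₂ (_ , inj₁ p)) v≢u deg w≡ dis = contradiction w≡ (<⇒≢ p)
  ≼-precedes complete {u} {v} (inj₂ (_ , inj₂ (_ , r))) v≢u deg w≡ dis with first vars r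
    where
    First : List (Fin N) → Set
    First vs = ∃[ b ] (1 ≤ lookup v b × ∃₂ λ is js → vs ≡ is ++ b ∷ js × All (λ i → lookup u i ≡ 0) (is ++ b ∷ []))
    zero-of : ∀ i → 1 ≤ lookup v i → lookup u i ≡ 0
    zero-of i pos with lookup u i in eq
    ... | zero  = refl
    ... | suc _ = contradiction (pos , ≤-trans (s≤s z≤n) (≤-reflexive (sym eq))) (dis i)
    first : ∀ vs → RevLex vs v u → First vs ⊎ All (λ i → lookup v i ≡ lookup u i) vs
    first []       _        = inj₂ []
    first (i ∷ vs) (inj₁ p) = inj₁ (i , pos , [] , vs , refl , zero-of i pos ∷ [])
      where
      pos : 1 ≤ lookup v i
      pos = ≤-trans (s≤s z≤n) p
    first (i ∷ vs) (inj₂ (eq , r)) with first vs r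
    ... | inj₂ eqs = inj₂ (eq ∷ eqs)
    ... | inj₁ (b , pos , is , js , refl , zeros) = inj₁ (b , pos , i ∷ is , js , refl , both ∷ zeros)
      where
      both : lookup u i ≡ 0
      both with lookup u i in equ
      ... | zero  = refl
      ... | suc _ = contradiction (≤-trans (s≤s z≤n) (≤-reflexive (sym eq)) , ≤-trans (s≤s z≤n) (≤-reflexive (sym equ))) (dis i)
  ... | inj₁ found = found
  ... | inj₂ eqs   = contradiction (lookup-injective λ i → All.lookup eqs (complete i)) v≢u

-- Small squarefree divisors of reducible monomials

dominoFunctionals : {Cell : Set} {q : ℕ} → (Fin q → Cell × Cell) → List (List Cell)
dominoFunctionals {q = q} D = concatMap (λ t → pair (D t) ∷ (proj₁ (D t) ∷ []) ∷ (proj₂ (D t) ∷ []) ∷ []) (allFin q)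

-- The grid enters only through these parameters: dominoes that cover every cell except possibly the
-- corner, and the removal of points `Bs` from `As` with a balanced remainder. `large` is there
-- because points far apart call for a divisor of degree 2.
module Core {Cell : Set} {N q : ℕ} (pt : Fin N → Cell → ℕ) (corner : Cell) (D : Fin q → Cell × Cell)
            (cover : ∀ c → c ≡ corner ⊎ ∃[ t ] (c ≡ proj₁ (D t) ⊎ c ≡ proj₂ (D t)))
            (decompose : ∀ As Bs e → length As ≡ e + length Bs →
               (∀ c → ∑ (λ B → pt B c) Bs ≤ ∑ (λ A → pt A c) As) →
               ∃[ Cs ] (length Cs ≡ e × (∀ c → ∑ (λ C → pt C c) (Bs ++ Cs) ≡ ∑ (λ A → pt A c) As) ×
                        (∀ {ℓ} → ℓ ∈ dominoFunctionals D → Balanced (λ C → ∑ (pt C) ℓ) Cs)))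
            (large : 2 ≤ q ⊎ (∀ (A B : Fin N) → A ≡ B))
            (vars : List (Fin N)) (complete : ∀ A → A ∈ vars)
            (sorted : AllPairs (λ A B → pt A corner ≤ pt B corner) vars)
            where

  L : List (List Cell)
  L = dominoFunctionals D

  val : List Cell → Fin N → ℕ
  val ℓ A = ∑ (pt A) ℓ

  weight : Fin N → ℕ
  weight A = ∑ (λ ℓ → val ℓ A * val ℓ A) L

  open WeightedRevLex weight vars public

  Fibre : Monomial N → Monomial N → Set
  Fibre u v = ∀ c → dot (λ A → pt A c) u ≡ dot (λ A → pt A c) v

  -- Not the least monomial of its fibre. For the toric ideal these are the monomials of the initial
  -- ideal.
  Reducible : Monomial N → Set
  Reducible u = ∃[ v ] (Fibre u v × v ≼ u × v ≢ u)

  squares : List (Fin N) → List Cell → ℕ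
  squares As ℓ = ∑ (λ A → val ℓ A * val ℓ A) As

  -- Exchanging the sums splits the weight into one sum of squares per functional, each of them
  -- minimised by balance.
  dot-weight : ∀ As → dot weight (mon As) ≡ ∑ (squares As) L
  dot-weight As = trans (dot-mon weight As) (∑-swap (λ A ℓ → val ℓ A * val ℓ A) As L)

  Same : List (Fin N) → List (Fin N) → Set
  Same As Bs = ∀ c → ∑ (λ A → pt A c) As ≡ ∑ (λ A → pt A c) Bs

  ∑-val : ∀ {As Bs} → Same As Bs → ∀ ℓ → ∑ (val ℓ) As ≡ ∑ (val ℓ) Bs
  ∑-val {As} {Bs} same ℓ = trans (∑-swap pt As ℓ) (trans (∑-cong same ℓ) (sym (∑-swap pt Bs ℓ)))

  same⇒fibre : ∀ {As Bs} → Same As Bs → Fibre (mon As) (mon Bs)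
  same⇒fibre {As} {Bs} same c = trans (dot-mon _ As) (trans (same c) (sym (dot-mon _ Bs)))

  fibre⇒same : ∀ {u v} → Fibre u v → Same (variables u) (variables v)
  fibre⇒same {u} {v} fib c = trans (sym (dot-mon _ (variables u)))
    (trans (cong (dot _) (mon-variables u)) (trans (fib c)
      (trans (cong (dot _) (sym (mon-variables v))) (dot-mon _ (variables v)))))

  private
    dominoPieces : Fin q → List (List Cell)
    dominoPieces t = pair (D t) ∷ (proj₁ (D t) ∷ []) ∷ (proj₂ (D t) ∷ []) ∷ []

  functional∈L : ∀ t {ℓ} → ℓ ∈ dominoPieces t → ℓ ∈ L
  functional∈L t ℓ∈ = ∈-concatMap⁺ dominoPieces (lose (∈-allFin t) ℓ∈)

  Agree : Fin q → Fin N → Fin N → Set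
  Agree t A B = pt A (proj₁ (D t)) ≡ pt B (proj₁ (D t)) × pt A (proj₂ (D t)) ≡ pt B (proj₂ (D t))

  -- A functional sees one domino only, so the point picked for that domino can stand in for `b`
  -- there.
  agree-val : ∀ {ℓ} → ℓ ∈ L → ∃[ t ] (∀ {A B} → Agree t A B → val ℓ A ≡ val ℓ B)
  agree-val ℓ∈ with find (∈-concatMap⁻ dominoPieces {xs = allFin q} ℓ∈)
  ... | t , _ , here refl                 = t , λ (p , q) → cong₂ (λ x y → x + (y + 0)) p q
  ... | t , _ , there (here refl)         = t , λ (p , _) → cong (_+ 0) p
  ... | t , _ , there (there (here refl)) = t , λ (_ , q) → cong (_+ 0) q

  ∑-equal-terms : ∀ {f g : List Cell → ℕ} {ℓs ℓ} → All (λ ℓ → f ℓ ≤ g ℓ) ℓs → ∑ g ℓs ≤ ∑ f ℓs → ℓ ∈ ℓs → g ℓ ≤ f ℓ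
  ∑-equal-terms f≤g le ℓ∈ = ≮⇒≥ λ lt → <⇒≱ (∑-mono-< f≤g ℓ∈ lt) le

  all-equal⇒≡ : ∀ {N} → (∀ (A B : Fin N) → A ≡ B) → ∀ (u v : Monomial N) → degree u ≡ degree v → u ≡ v
  all-equal⇒≡ {zero}        eq []       []       deg = refl
  all-equal⇒≡ {suc zero}    eq (x ∷ []) (y ∷ []) deg = cong (_∷ []) (+-cancelʳ-≡ 0 x y deg)
  all-equal⇒≡ {suc (suc N)} eq u v deg with () ← eq zero (suc zero)

  -- Points 1, 2 and 3 agree with b on the first cell, the second cell and the sum of a domino. If their
  -- values are pairwise within 1, then one of them agrees with b on both cells.
  agreement : ∀ {x₁ y₁ x₂ y₂ x₃ y₃ bx by} → x₁ ≡ bx → y₂ ≡ by → x₃ + y₃ ≡ bx + by →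
              y₁ ≤ suc y₃ → y₃ ≤ suc y₁ → x₂ ≤ suc x₃ → x₃ ≤ suc x₂ →
              x₁ + y₁ ≤ suc (x₂ + y₂) → x₂ + y₂ ≤ suc (x₁ + y₁) →
              y₁ ≡ by ⊎ x₂ ≡ bx ⊎ (x₃ ≡ bx × y₃ ≡ by)
  agreement {x₁} {y₁} {x₂} {y₂} {x₃} {y₃} {bx} {by} refl refl sums y₁≤ y₃≤ x₂≤ x₃≤ s₁≤ s₂≤
    with y₁ ≟ y₂ | x₂ ≟ x₁ | <-cmp x₃ x₁
  ... | yes eq | _ | _ = inj₁ eq
  ... | _ | yes eq | _ = inj₂ (inj₁ eq)
  ... | _ | _ | tri≈ _ refl _ = inj₂ (inj₂ (refl , +-cancelˡ-≡ x₃ y₃ y₂ sums))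
  -- Point 3 is above b on the first cell, hence below it on the second. Balance then forces `y₁`
  -- below `y₂` and `x₂` above `x₁`, so the sums of points 1 and 2 are at least 2 apart. The
  -- remaining case is the mirror image.
  ... | no y≢ | no x≢ | tri> _ _ x₃> = contradiction s₂≤ (<⇒≱ (begin-strict
    suc (x₁ + y₁)  ≡⟨ +-suc x₁ y₁ ⟨
    x₁ + suc y₁    ≤⟨ +-monoʳ-≤ x₁ y₁< ⟩
    x₁ + y₂        <⟨ +-monoˡ-< y₂ x₂> ⟩
    x₂ + y₂        ∎))
    where
    open ≤-Reasoning
    y₃< : y₃ < y₂
    y₃< = +-cancelˡ-< x₁ y₃ y₂ (<-≤-trans (+-monoˡ-< y₃ x₃>) (≤-reflexive sums))
    y₁< : y₁ < y₂
    y₁< = ≤∧≢⇒< (≤-trans y₁≤ y₃<) y≢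
    x₂> : x₁ < x₂
    x₂> = ≤∧≢⇒< (≤-pred (≤-trans x₃> x₃≤)) (x≢ ∘ sym)
  ... | no y≢ | no x≢ | tri< x₃< _ _ = contradiction s₁≤ (<⇒≱ (begin-strict
    suc (x₂ + y₂)  ≤⟨ +-monoˡ-≤ y₂ x₂< ⟩
    x₁ + y₂        <⟨ +-monoʳ-< x₁ y₁> ⟩
    x₁ + y₁        ∎))
    where
    open ≤-Reasoning
    y₃> : y₂ < y₃
    y₃> = +-cancelˡ-< x₁ y₂ y₃ (≤-<-trans (≤-reflexive (sym sums)) (+-monoˡ-< y₃ x₃<))
    y₁> : y₂ < y₁
    y₁> = ≤∧≢⇒< (≤-pred (≤-trans y₃> y₃≤)) (y≢ ∘ sym)
    x₂< : x₂ < x₁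
    x₂< = ≤∧≢⇒< (≤-trans x₂≤ x₃<) x≢

  record SmallDivisor (u : Monomial N) : Set where
    field
      divisor    : Monomial N
      divides    : divisor Divides u
      squarefree : SquarefreeMonomial divisor
      bounded    : degree divisor ≤ q
      reducible  : Reducible divisor

  Far : List (Fin N) → Set
  Far As = ∃[ A ] ∃[ B ] ∃[ ℓ ] (A ∈ As × B ∈ As × ℓ ∈ L × suc (val ℓ B) < val ℓ A)

  far? : ∀ As → Far As ⊎ (∀ {ℓ} → ℓ ∈ L → Balanced (val ℓ) As)
  far? As with any? (λ A → any? (λ B → any? (λ ℓ → suc (val ℓ B) <? val ℓ A) L) As) As
  ... | yes some =
    let A , A∈ , someB = find some
        B , B∈ , someℓ = find someB
        ℓ , ℓ∈ , lt    = find someℓ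
    in inj₁ (A , B , ℓ , A∈ , B∈ , ℓ∈ , lt)
  ... | no none = inj₂ λ ℓ∈ A∈ B∈ → ≮⇒≥ λ lt → none (lose A∈ (lose B∈ (lose ℓ∈ lt)))

  -- Decomposing the two points afresh gives a balanced pair with the same sum, of strictly smaller
  -- weight because of `ℓ`. Being far apart, the points differ, so the divisor is squarefree.
  far-divisor : 2 ≤ q → ∀ u → Far (variables u) → SmallDivisor u
  far-divisor 2≤q u (A , B , ℓ , A∈ , B∈ , ℓ∈ , lt) with decompose (A ∷ B ∷ []) [] 2 refl (λ _ → z≤n)
  ... | Cs , len , same , bal = record
    { divisor    = mon (A ∷ B ∷ [])
    ; divides    = subst (_ Divides_) (mon-variables u) (mon-divides unique λ { (here refl) → A∈ ; (there (here refl)) → B∈ })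
    ; squarefree = squarefree-mon unique
    ; bounded    = ≤-trans (≤-reflexive (degree-mon (A ∷ B ∷ []))) 2≤q
    ; reducible  = mon Cs , same⇒fibre {A ∷ B ∷ []} {Cs} (λ c → sym (same c)) ,
                   weight<⇒≼ (trans (degree-mon Cs) (trans len (sym (degree-mon (A ∷ B ∷ []))))) smaller ,
                   λ eq → <⇒≢ smaller (cong (dot weight) eq)
    }
    where
    unique : Unique (A ∷ B ∷ [])
    unique = ((λ { refl → <⇒≱ lt (n≤1+n _) }) ∷ []) ∷ [] ∷ []
    smaller : dot weight (mon Cs) < dot weight (mon (A ∷ B ∷ []))
    smaller = subst₂ _<_ (sym (dot-weight Cs)) (sym (dot-weight (A ∷ B ∷ [])))
      (∑-mono-< (All.tabulate λ {ℓ′} ℓ′∈ → ∑-sq-min (val ℓ′) {Cs} {A ∷ B ∷ []} (bal ℓ′∈) len (∑-val {Cs} {A ∷ B ∷ []} same ℓ′)) ℓ∈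
        (∑-sq-strict (val ℓ) {Cs} {A ∷ B ∷ []} (bal ℓ∈) len (∑-val {Cs} {A ∷ B ∷ []} same ℓ)
          {A} {B} (here refl) (there (here refl)) lt))

  after : ∀ {B} is {js A} → AllPairs (λ A B → pt A corner ≤ pt B corner) (is ++ B ∷ js) →
          A ∈ is ++ B ∷ js → A ∉ is ++ B ∷ [] → pt B corner ≤ pt A corner
  after []       (B≤ ∷ _)  (here refl) A∉ = contradiction (here refl) A∉
  after []       (B≤ ∷ _)  (there A∈)  A∉ = All.lookup B≤ A∈
  after (i ∷ is) (_ ∷ srt) (here refl) A∉ = contradiction (here refl) A∉
  after (i ∷ is) (_ ∷ srt) (there A∈)  A∉ = after is srt A∈ (A∉ ∘ there)

  module _ (us : List (Fin N)) (bal : ∀ {ℓ} → ℓ ∈ L → Balanced (val ℓ) us) (b : Fin N)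
           (agree-somewhere : ∀ {ℓ} → ℓ ∈ L → ∃[ A ] (A ∈ us × val ℓ A ≡ val ℓ b)) where

    -- Each functional of the domino offers a point of `us`; `agreement` finds among the three one
    -- that is right on both cells.
    pick : ∀ t → ∃[ A ] (A ∈ us × Agree t A b)
    pick t with agree-somewhere x∈L | agree-somewhere y∈L | agree-somewhere xy∈L
      where
      xy∈L = functional∈L t (here refl)
      x∈L  = functional∈L t (there (here refl))
      y∈L  = functional∈L t (there (there (here refl)))
    ... | A₁ , A₁∈ , eq₁ | A₂ , A₂∈ , eq₂ | A₃ , A₃∈ , eq₃ = choose
      (agreement (strip eq₁) (strip eq₂) (strip₂ {pt A₃ x} {_} {pt b x} eq₃)
        (at y∈L A₁∈ A₃∈) (at y∈L A₃∈ A₁∈) (at x∈L A₂∈ A₃∈) (at x∈L A₃∈ A₂∈) (at₂ A₁∈ A₂∈) (at₂ A₂∈ A₁∈))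
      where
      x = proj₁ (D t)
      y = proj₂ (D t)
      x∈L = functional∈L t (there (here refl))
      y∈L = functional∈L t (there (there (here refl)))
      strip : ∀ {k l} → k + 0 ≡ l + 0 → k ≡ l
      strip {k} {l} = +-cancelʳ-≡ 0 k l
      strip₂ : ∀ {k l k′ l′} → k + (l + 0) ≡ k′ + (l′ + 0) → k + l ≡ k′ + l′
      strip₂ {k} {l} {k′} {l′} eq = trans (cong (k +_) (sym (+-identityʳ l))) (trans eq (cong (k′ +_) (+-identityʳ l′)))
      at : ∀ {c A B} → c ∷ [] ∈ L → A ∈ us → B ∈ us → pt A c ≤ suc (pt B c)
      at {c} ℓ∈ A∈ B∈ = subst₂ _≤_ (+-identityʳ _) (cong suc (+-identityʳ _)) (bal ℓ∈ A∈ B∈)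
      at₂ : ∀ {A B} → A ∈ us → B ∈ us → pt A x + pt A y ≤ suc (pt B x + pt B y)
      at₂ {A} {B} A∈ B∈ = subst₂ _≤_ (cong (pt A x +_) (+-identityʳ _)) (cong suc (cong (pt B x +_) (+-identityʳ _)))
                            (bal (functional∈L t (here refl)) A∈ B∈)
      choose : pt A₁ y ≡ pt b y ⊎ pt A₂ x ≡ pt b x ⊎ (pt A₃ x ≡ pt b x × pt A₃ y ≡ pt b y) → ∃[ A ] (A ∈ us × Agree t A b)
      choose (inj₁ p)        = A₁ , A₁∈ , strip eq₁ , p
      choose (inj₂ (inj₁ p)) = A₂ , A₂∈ , p , strip eq₂
      choose (inj₂ (inj₂ p)) = A₃ , A₃∈ , p

  module Cover (F : List (Fin N)) (b : Fin N) (b∉F : b ∉ F) (nonempty : ∃[ A ] A ∈ F)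
               (b-corner : ∀ {A} → A ∈ F → pt b corner ≤ pt A corner)
               (pick : ∀ t → ∃[ A ] (A ∈ F × Agree t A b)) where

    -- On a tiled cell some member of `F` has the value of `b`. The corner may be untiled; there the
    -- order of the variables bounds `b` by any member.
    b≤F : ∀ c → ∑ (λ B → pt B c) (b ∷ []) ≤ ∑ (λ A → pt A c) F
    b≤F c = ≤-trans (≤-reflexive (+-identityʳ (pt b c))) (bound (cover c))
      where
      bound : (c ≡ corner ⊎ ∃[ t ] (c ≡ proj₁ (D t) ⊎ c ≡ proj₂ (D t))) → pt b c ≤ ∑ (λ A → pt A c) F
      bound (inj₁ refl) = ≤-trans (b-corner (proj₂ nonempty)) (term≤∑ (λ A → pt A c) (proj₂ nonempty))
      bound (inj₂ (t , c≡)) with pick t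
      bound (inj₂ (t , inj₁ refl)) | A , A∈ , eq , _ = ≤-trans (≤-reflexive (sym eq)) (term≤∑ (λ A → pt A c) A∈)
      bound (inj₂ (t , inj₂ refl)) | A , A∈ , _ , eq = ≤-trans (≤-reflexive (sym eq)) (term≤∑ (λ A → pt A c) A∈)

    length-F : length F ≡ pred (length F) + 1
    length-F = pred+1 (proj₂ nonempty)
      where
      pred+1 : ∀ {As : List (Fin N)} {A} → A ∈ As → length As ≡ pred (length As) + 1
      pred+1 {_ ∷ As} _ = +-comm 1 (length As)

    -- The member `A` of `F` picked for the domino of `ℓ` has the same value as `b`, so the two
    -- cancel, and the balanced `Cs` are compared with `F` without `A`. That `A` depends on `ℓ` is
    -- harmless, as the weight is compared one functional at a time.
    squares≤ : ∀ {Cs} → length (b ∷ Cs) ≡ length F → Same (b ∷ Cs) F → ∀ {ℓ} → Balanced (val ℓ) Cs →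
               ℓ ∈ L → squares (b ∷ Cs) ℓ ≤ squares F ℓ
    squares≤ {Cs} len same {ℓ} bal ℓ∈ with agree-val ℓ∈
    ... | t , agrees with pick t
    ...   | A , A∈ , agree with ∈-∃++ A∈ | agrees {A} {b} agree
    ...     | As , Bs , F≡ | A≡b = begin
      val ℓ b * val ℓ b + squares Cs ℓ           ≤⟨ +-monoʳ-≤ (val ℓ b * val ℓ b) (∑-sq-min (val ℓ) {Cs} {As ++ Bs} bal len′ sum′) ⟩
      val ℓ b * val ℓ b + squares (As ++ Bs) ℓ   ≡⟨ cong (λ k → k * k + squares (As ++ Bs) ℓ) A≡b ⟨
      squares (A ∷ As ++ Bs) ℓ                   ≡⟨ ∑-↭ (λ A → val ℓ A * val ℓ A) perm ⟨
      squares F ℓ                                ∎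
      where
      open ≤-Reasoning
      perm : F ↭ A ∷ As ++ Bs
      perm = ↭-trans (↭.↭-reflexive F≡) (shift A As Bs)
      len′ : length Cs ≡ length (As ++ Bs)
      len′ = suc-injective (trans len (↭-length perm))
      sum′ : ∑ (val ℓ) Cs ≡ ∑ (val ℓ) (As ++ Bs)
      sum′ = +-cancelˡ-≡ (val ℓ b) _ _ (trans (∑-val {b ∷ Cs} {F} same ℓ)
        (trans (∑-↭ (val ℓ) perm) (cong (_+ ∑ (val ℓ) (As ++ Bs)) A≡b)))

    -- Splitting `b` off does not raise the weight, and `b` precedes all of `F`, so the result is
    -- smaller even on a tie.
    cover-reducible : Precedes b (mon F) → Reducible (mon F)
    cover-reducible b-first with decompose F (b ∷ []) (pred (length F)) length-F b≤F
    ... | Cs , lenC , same , bal =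
      mon (b ∷ Cs) , same⇒fibre {F} {b ∷ Cs} (λ c → sym (same c)) ,
      precedes-≼ deg weight≤ b-pos b-first ,
      λ eq → >⇒≢ b-pos (trans (cong (λ w → lookup w b) eq) (∉⇒lookup-mon≡0 b∉F))
      where
      len : length (b ∷ Cs) ≡ length F
      len = trans (cong suc lenC) (trans (+-comm 1 _) (sym length-F))
      deg : degree (mon (b ∷ Cs)) ≡ degree (mon F)
      deg = trans (degree-mon (b ∷ Cs)) (trans len (sym (degree-mon F)))
      b-pos : 1 ≤ lookup (mon (b ∷ Cs)) b
      b-pos = ∈⇒lookup-mon≥1 {is = b ∷ Cs} (here refl)
      weight≤ : dot weight (mon (b ∷ Cs)) ≤ dot weight (mon F)
      weight≤ = subst₂ _≤_ (sym (dot-weight (b ∷ Cs))) (sym (dot-weight F))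
        (∑-mono (All.tabulate λ ℓ∈ → squares≤ len same (bal ℓ∈) ℓ∈))

  pick-divisor : 2 ≤ q → ∀ u b → b ∉ variables u → Precedes b u →
                 (∀ {A} → A ∈ variables u → pt b corner ≤ pt A corner) →
                 (pick : Fin q → Fin N) → (∀ t → pick t ∈ variables u) → (∀ t → Agree t (pick t) b) → SmallDivisor u
  pick-divisor 2≤q u b b∉u (is , js , eq , zeros) b-corner pick pick∈ agree = record
    { divisor    = mon F
    ; divides    = subst (mon F Divides_) (mon-variables u) (mon-divides unique F⊆us)
    ; squarefree = squarefree-mon unique
    ; bounded    = ≤-trans (≤-reflexive (degree-mon F)) length-F
    ; reducible  = Cover.cover-reducible F b (b∉u ∘ F⊆us) (some 2≤q) (b-corner ∘ F⊆us)
        (λ t → pick t , picked∈F t , agree t)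
        (is , js , eq , All.map (λ ui≡0 → ∉⇒lookup-mon≡0 λ i∈ → >⇒≢ (∈⇒lookup≥1 u (F⊆us i∈)) ui≡0) zeros)
    }
    where
    -- One point may serve several dominoes; dropping repetitions keeps the divisor squarefree and
    -- its degree at most `q`.
    F : List (Fin N)
    F = deduplicate Fin._≟_ (map pick (allFin q))

    unique : Unique F
    unique = deduplicate-! Fin._≟_ (map pick (allFin q))

    picked∈F : ∀ t → pick t ∈ F
    picked∈F t = ∈-deduplicate⁺ Fin._≟_ (∈-map⁺ pick (∈-allFin t))

    some : 2 ≤ q → ∃[ A ] A ∈ F
    some (s≤s _) = _ , picked∈F zero

    F⊆us : ∀ {A} → A ∈ F → A ∈ variables u
    F⊆us A∈ with ∈-map⁻ pick (∈-deduplicate⁻ Fin._≟_ (map pick (allFin q)) A∈)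
    ... | t , _ , refl = pick∈ t

    length-F : length F ≤ q
    length-F = ≤-trans (length-deduplicate Fin._≟_ (map pick (allFin q)))
      (≤-reflexive (trans (length-map pick (allFin q)) (length-tabulate {n = q} (λ t → t))))

  -- A balanced `u` has the least weight among monomials of its fibre and degree, so `v` ties with
  -- it, on each functional separately. Hence the reverse lexicographic order decides, and its first
  -- difference is the `b` to split off.
  close-divisor : 2 ≤ q → ∀ u v → Fibre u v → degree v ≡ degree u → v ≼ u → v ≢ u →
                  (∀ i → ¬ (1 ≤ lookup v i × 1 ≤ lookup u i)) →
                  (∀ {ℓ} → ℓ ∈ L → Balanced (val ℓ) (variables u)) → SmallDivisor u
  close-divisor 2≤q u v fib deg v≼u v≢u disjoint bal = conclude (≼-precedes complete v≼u v≢u deg weight≡ disjoint)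
    where
    us vs : List (Fin N)
    us = variables u
    vs = variables v

    same : Same us vs
    same = fibre⇒same {u} {v} fib

    len : length us ≡ length vs
    len = trans (length-variables u) (trans (sym deg) (sym (length-variables v)))

    weight-variables : ∀ w → dot weight w ≡ ∑ (squares (variables w)) L
    weight-variables w = trans (cong (dot weight) (sym (mon-variables w))) (dot-weight (variables w))

    min : All (λ ℓ → squares us ℓ ≤ squares vs ℓ) L
    min = All.tabulate λ {ℓ} ℓ∈ → ∑-sq-min (val ℓ) {us} {vs} (bal ℓ∈) len (∑-val {us} {vs} same ℓ)

    weight≤ : ∑ (squares vs) L ≤ ∑ (squares us) L
    weight≤ = subst₂ _≤_ (weight-variables v) (weight-variables u) (≼⇒weight≤ {v} {u} deg v≼u)

    weight≡ : dot weight v ≡ dot weight u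
    weight≡ = trans (weight-variables v) (trans (≤-antisym weight≤ (∑-mono min)) (sym (weight-variables u)))

    conclude : ∃[ b ] (1 ≤ lookup v b × Precedes b u) → SmallDivisor u
    conclude (b , pos , before@(is , js , eq , zeros)) =
      pick-divisor 2≤q u b (λ b∈ → disjoint b (pos , ∈⇒lookup≥1 u b∈)) before b-corner
        (proj₁ ∘ picked) (proj₁ ∘ proj₂ ∘ picked) (proj₂ ∘ proj₂ ∘ picked)
      where
      b-corner : ∀ {A} → A ∈ us → pt b corner ≤ pt A corner
      b-corner {A} A∈ = after is (subst (AllPairs _) eq sorted) (subst (A ∈_) eq (complete A))
        λ A∈′ → >⇒≢ (∈⇒lookup≥1 u A∈) (All.lookup zeros A∈′)

      -- `b` is a variable of `v`, and the tie leaves it no value on `ℓ` that is not taken in `us`.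
      agree-somewhere : ∀ {ℓ} → ℓ ∈ L → ∃[ A ] (A ∈ us × val ℓ A ≡ val ℓ b)
      agree-somewhere {ℓ} ℓ∈ = proj₁ (∑-sq-equality (val ℓ) {us} {vs} (bal ℓ∈) len (∑-val {us} {vs} same ℓ)
                                        (∑-equal-terms min weight≤ ℓ∈) (lookup≥1⇒∈ v pos))

      picked : ∀ t → ∃[ A ] (A ∈ us × Agree t A b)
      picked = pick us bal b agree-somewhere

  smallDivisor : ∀ u v → Fibre u v → degree v ≡ degree u → v ≼ u → v ≢ u →
                 (∀ i → ¬ (1 ≤ lookup v i × 1 ≤ lookup u i)) → SmallDivisor u
  smallDivisor u v fib deg v≼u v≢u disjoint = [ by-size , (λ equal → contradiction (all-equal⇒≡ equal v u deg) v≢u) ]′ large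
    where
    by-size : 2 ≤ q → SmallDivisor u
    by-size 2≤q = [ far-divisor 2≤q u , close-divisor 2≤q u v fib deg v≼u v≢u disjoint ]′ (far? (variables u))

boxes : ℕ → ∀ N → List (Monomial N)
boxes b zero    = [] ∷ []
boxes b (suc N) = cartesianProductWith _∷_ (upTo (suc b)) (boxes b N)

∈-boxes : ∀ {b N} (u : Monomial N) → (∀ i → lookup u i ≤ b) → u ∈ boxes b N
∈-boxes []      _  = here refl
∈-boxes (x ∷ u) ≤b = ∈-cartesianProductWith⁺ _∷_ (∈-upTo⁺ (s≤s (≤b zero))) (∈-boxes u (≤b ∘ suc))

_≟ᴹ_ : ∀ {N} (u v : Monomial N) → Dec (u ≡ v)
_≟ᴹ_ = Vec.≡-dec _≟_

-- Evaluation at monomials of the Laurent ring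

module Evaluation {c ℓ₁ ℓ₂} (k : HeytingField c ℓ₁ ℓ₂) (d : ℕ) where
  private module k = HeytingField k
  open Laurent k d
  open RawSemiring rawSemiring using () renaming (_*_ to _*ᴸ_)
  open RawSemiringDefs rawSemiring using (product) renaming (_^_ to _^ᴸ_)

  private
    _⊕_ : Vec ℤ d → Vec ℤ d → Vec ℤ d
    _⊕_ = zipWith ℤ._+_

  -- `evaluate` sends a monomial to a single term on the nose, but with its coefficient multiplied
  -- by a nested product of ones. Carrying that product along keeps `term-^` and `product-terms`
  -- propositional; only afterwards is it replaced by 1.
  powC : ℕ → k.Carrier
  powC zero    = k.1#
  powC (suc n) = k.1# k.* powC n

  powC≈1 : ∀ n → powC n k.≈ k.1#
  powC≈1 zero    = k.refl
  powC≈1 (suc n) = k.trans (k.*-identityˡ _) (powC≈1 n)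

  powV : Vec ℤ d → ℕ → Vec ℤ d
  powV a zero    = replicate d 0ℤ
  powV a (suc n) = a ⊕ powV a n

  term-^ : ∀ a n → term k.1# a ^ᴸ n ≡ term (powC n) (powV a n)
  term-^ a zero    = refl
  term-^ a (suc n) = cong (term k.1# a *ᴸ_) (term-^ a n)

  prodC : ∀ {N} → (Fin N → k.Carrier) → k.Carrier
  prodC {zero}  c = k.1#
  prodC {suc N} c = c zero k.* prodC (c ∘ suc)

  prodC≈1 : ∀ {N} (c : Fin N → k.Carrier) → (∀ i → c i k.≈ k.1#) → prodC c k.≈ k.1#
  prodC≈1 {zero}  c c≈1 = k.refl
  prodC≈1 {suc N} c c≈1 = k.trans (k.*-cong (c≈1 zero) (prodC≈1 (c ∘ suc) (c≈1 ∘ suc))) (k.*-identityˡ _)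

  prodV : ∀ {N} → (Fin N → Vec ℤ d) → Vec ℤ d
  prodV {zero}  v = replicate d 0ℤ
  prodV {suc N} v = v zero ⊕ prodV (v ∘ suc)

  product-terms : ∀ {N} (f : Fin N → Elem) c v → (∀ i → f i ≡ term (c i) (v i)) → product f ≡ term (prodC c) (prodV v)
  product-terms {zero}  f c v eq = refl
  product-terms {suc N} f c v eq = cong₂ _*ᴸ_ (eq zero) (product-terms (f ∘ suc) (c ∘ suc) (v ∘ suc) (eq ∘ suc))

  module _ {N : ℕ} (𝒜 : Fin N → Vec ℤ d) where

    -- The exponent of the Laurent monomial to which `u` is sent. The zero vector in front comes
    -- from the constant term that carries the coefficient.
    image : Monomial N → Vec ℤ d
    image u = replicate d 0ℤ ⊕ prodV (λ i → powV (𝒜 i) (lookup u i))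

    unitFactor : Monomial N → k.Carrier
    unitFactor u = prodC (λ i → powC (lookup u i))

    evaluate-∷ : ∀ a u f → evaluate k (λ i → term k.1# (𝒜 i)) ((a , u) ∷ f) ≡
                 (a k.* unitFactor u , image u) ∷ evaluate k (λ i → term k.1# (𝒜 i)) f
    evaluate-∷ a u f = cong (λ p → (term a (replicate d 0ℤ) *ᴸ p) ++ evaluate k _ f)
      (product-terms _ _ _ (λ i → term-^ (𝒜 i) (lookup u i)))

    fibreCoeff : Polynomial k N → Vec ℤ d → k.Carrier
    fibreCoeff []            t = k.0#
    fibreCoeff ((a , u) ∷ f) t = if does (Vec.≡-dec ℤ._≟_ (image u) t) then a k.+ fibreCoeff f t else fibreCoeff f t

    coeff-evaluate : ∀ f t → coeff (evaluate k (λ i → term k.1# (𝒜 i)) f) t k.≈ fibreCoeff f t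
    coeff-evaluate []            t = k.refl
    coeff-evaluate ((a , u) ∷ f) t rewrite evaluate-∷ a u f with does (Vec.≡-dec ℤ._≟_ (image u) t)
    ... | true  = k.+-cong (k.trans (k.*-cong k.refl (prodC≈1 _ (λ i → powC≈1 (lookup u i)))) (k.*-identityʳ a))
                           (coeff-evaluate f t)
    ... | false = coeff-evaluate f t

    module _ (p : Fin N → ℕ) (t : Fin d) (𝒜≡p : ∀ i → lookup (𝒜 i) t ≡ ℤ.+ p i) where

      private
        lookup-⊕ : ∀ v w → lookup (v ⊕ w) t ≡ lookup v t ℤ.+ lookup w t
        lookup-⊕ v w = Vec.lookup-zipWith ℤ._+_ t v w

      lookup-powV : ∀ i n → lookup (powV (𝒜 i) n) t ≡ ℤ.+ (n * p i)
      lookup-powV i zero    = Vec.lookup-replicate t 0ℤ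
      lookup-powV i (suc n) = trans (lookup-⊕ (𝒜 i) _) (cong₂ ℤ._+_ (𝒜≡p i) (lookup-powV i n))

    lookup-prodV : ∀ {M} (v : Fin M → Vec ℤ d) t (u : Monomial M) p →
                   (∀ i → lookup (v i) t ≡ ℤ.+ (lookup u i * p i)) → lookup (prodV v) t ≡ ℤ.+ dot p u
    lookup-prodV v t []      p eq = Vec.lookup-replicate t 0ℤ
    lookup-prodV v t (x ∷ u) p eq = trans (Vec.lookup-zipWith ℤ._+_ t (v zero) _)
      (cong₂ ℤ._+_ (eq zero) (lookup-prodV (v ∘ suc) t u (p ∘ suc) (eq ∘ suc)))

    lookup-image : ∀ p t → (∀ i → lookup (𝒜 i) t ≡ ℤ.+ p i) → ∀ u → lookup (image u) t ≡ ℤ.+ dot p u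
    lookup-image p t 𝒜≡p u = trans (Vec.lookup-zipWith ℤ._+_ t (replicate d 0ℤ) _)
      (trans (cong₂ ℤ._+_ (Vec.lookup-replicate t 0ℤ)
                (lookup-prodV _ t u p (λ i → lookup-powV p t 𝒜≡p i (lookup u i))))
             (ℤ.+-identityˡ _))

-- A squarefree reduced Gröbner basis from squarefree divisors of reducible monomials

module ToricGröbner
  {c ℓ₁ ℓ₂} (k : HeytingField c ℓ₁ ℓ₂) {N d : ℕ} (𝒜 : Fin N → Vec ℤ d)
  {Cell : Set} (p : Fin N → Cell → ℕ) (position : Cell → Fin d) (position-onto : ∀ t → ∃[ x ] position x ≡ t)
  (𝒜≡p : ∀ i x → lookup (𝒜 i) (position x) ≡ ℤ.+ p i x)
  (_≼_ : Rel (Monomial N) 0ℓ) (isTermOrder : IsTermOrder _≼_) (≼⇒degree≤ : ∀ {u v} → u ≼ v → degree u ≤ degree v)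
  where

  private module k = HeytingField k
  open IsTermOrder isTermOrder
  open IsTotalOrder isTotalOrder using (total; antisym) renaming (refl to ≼-refl; trans to ≼-trans)
  open Evaluation k d

  -- Fibres, normal forms and minimal reducible monomials

  Fibre : Rel (Monomial N) 0ℓ
  Fibre u v = ∀ x → dot (λ i → p i x) u ≡ dot (λ i → p i x) v

  fibre⇒image : ∀ u v → Fibre u v → image 𝒜 u ≡ image 𝒜 v
  fibre⇒image u v fib = trans (sym (Vec.tabulate∘lookup _)) (trans (Vec.tabulate-cong pointwise) (Vec.tabulate∘lookup _))
    where
    pointwise : ∀ t → lookup (image 𝒜 u) t ≡ lookup (image 𝒜 v) t
    pointwise t with position-onto t
    ... | x , refl = trans (lookup-image 𝒜 (λ i → p i x) (position x) (λ i → 𝒜≡p i x) u)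
      (trans (cong ℤ.+_ (fib x)) (sym (lookup-image 𝒜 (λ i → p i x) (position x) (λ i → 𝒜≡p i x) v)))

  image⇒fibre : ∀ u v → image 𝒜 u ≡ image 𝒜 v → Fibre u v
  image⇒fibre u v eq x = ℤ.+-injective (trans (sym (lookup-image 𝒜 (λ i → p i x) (position x) (λ i → 𝒜≡p i x) u))
    (trans (cong (λ w → lookup w (position x)) eq) (lookup-image 𝒜 (λ i → p i x) (position x) (λ i → 𝒜≡p i x) v)))

  fibre-·⁺ : ∀ w u v → Fibre u v → Fibre (w · u) (w · v)
  fibre-·⁺ w u v fib x = trans (dot-· (λ i → p i x) w u) (trans (cong₂ _+_ refl (fib x)) (sym (dot-· (λ i → p i x) w v)))

  fibre-·⁻ : ∀ w u v → Fibre (w · u) (w · v) → Fibre u v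
  fibre-·⁻ w u v fib x = +-cancelˡ-≡ (dot (λ i → p i x) w) _ _ (trans (sym (dot-· (λ i → p i x) w u)) (trans (fib x) (dot-· (λ i → p i x) w v)))

  ·-cancelˡ : ∀ (w : Monomial N) {u v} → w · u ≡ w · v → u ≡ v
  ·-cancelˡ w {u} {v} eq = lookup-injective λ i → +-cancelˡ-≡ (lookup w i) _ _
    (trans (sym (lookup-· w u i)) (trans (cong (λ z → lookup z i) eq) (lookup-· w v i)))

  Reducible : Monomial N → Set
  Reducible u = ∃[ v ] (Fibre u v × v ≼ u × v ≢ u)

  reducible-· : ∀ w {u} → Reducible u → Reducible (w · u)
  reducible-· w {u} (v , fib , v≼u , v≢u) = w · v , fibre-·⁺ w u v fib , ·-monotone w v≼u , v≢u ∘ ·-cancelˡ w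

  reducible-·⁻ : ∀ w {u v} → Fibre (w · u) (w · v) → (w · v) ≼ (w · u) → (w · v) ≢ (w · u) → Reducible u
  reducible-·⁻ w {u} {v} fib le ne with total v u
  ... | inj₁ v≼u = v , fibre-·⁻ w u v fib , v≼u , ne ∘ cong (w ·_)
  ... | inj₂ u≼v = contradiction (antisym le (·-monotone w u≼v)) ne

  least : ∀ u us → ∃[ v ] (v ∈ u ∷ us × (∀ {w} → w ∈ u ∷ us → v ≼ w))
  least u []        = u , here refl , λ { (here refl) → ≼-refl }
  least u (u′ ∷ us) with least u′ us
  ... | v , v∈ , v≼ with total u v
  ...   | inj₁ u≼v = u , here refl , λ { (here refl) → ≼-refl ; (there w∈) → ≼-trans u≼v (v≼ w∈) }
  ...   | inj₂ v≼u = v , there v∈ , λ { (here refl) → v≼u ; (there w∈) → v≼ w∈ }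

  sameImage? : ∀ u v → Dec (image 𝒜 v ≡ image 𝒜 u)
  sameImage? u v = Vec.≡-dec ℤ._≟_ (image 𝒜 v) (image 𝒜 u)

  private
    lesser : Monomial N → List (Monomial N)
    lesser u = filter (sameImage? u) (boxes (degree u) N)

  -- The least monomial of the fibre of `u`. Nothing smaller than `u` has larger degree, so the
  -- search is confined to a finite box.
  normalForm : Monomial N → Monomial N
  normalForm u = proj₁ (least u (lesser u))

  normalForm-fibre : ∀ u → Fibre u (normalForm u)
  normalForm-fibre u with least u (lesser u)
  ... | _ , here refl , _ = λ _ → refl
  ... | v , there v∈ , _  = image⇒fibre u v (sym (proj₂ (∈-filter⁻ (sameImage? u) {xs = boxes (degree u) N} v∈)))

  normalForm-≼ : ∀ u v → Fibre u v → normalForm u ≼ v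
  normalForm-≼ u v fib with least u (lesser u)
  ... | _ , _ , least≼ with total u v
  ...   | inj₁ u≼v = ≼-trans (least≼ (here refl)) u≼v
  ...   | inj₂ v≼u = least≼ (there (∈-filter⁺ (sameImage? u)
    (∈-boxes v (λ i → ≤-trans (lookup≤degree v i) (≼⇒degree≤ v≼u))) (sym (fibre⇒image u v fib))))

  normalForm-irreducible : ∀ u → ¬ Reducible (normalForm u)
  normalForm-irreducible u (v , fib , v≼ , v≢) =
    v≢ (antisym v≼ (normalForm-≼ u v (λ x → trans (normalForm-fibre u x) (fib x))))

  reducible⇒≢normalForm : ∀ {u} → Reducible u → u ≢ normalForm u
  reducible⇒≢normalForm {u} red eq = normalForm-irreducible u (subst Reducible eq red)

  reducible? : ∀ u → Dec (Reducible u)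
  reducible? u with normalForm u ≟ᴹ u
  ... | yes eq = no (λ red → reducible⇒≢normalForm red (sym eq))
  ... | no  ne = yes (normalForm u , normalForm-fibre u , normalForm-≼ u u (λ _ → refl) , ne)

  _÷_ : Monomial N → Fin N → Monomial N
  u ÷ i = zipWith _∸_ u (unit i)

  unit-÷ : ∀ u i → 1 ≤ lookup u i → unit i · (u ÷ i) ≡ u
  unit-÷ u i pos = lookup-injective λ j → trans (lookup-· (unit i) (u ÷ i) j)
    (trans (cong₂ _+_ refl (Vec.lookup-zipWith _∸_ j u (unit i))) (m+[n∸m]≡n (bound j)))
    where
    bound : ∀ j → lookup (unit i) j ≤ lookup u j
    bound j with i Fin.≟ j
    ... | yes refl = ≤-trans (≤-reflexive (lookup-unit-same i)) pos
    ... | no i≢j   = ≤-trans (≤-reflexive (lookup-unit-other i≢j)) z≤n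

  ÷-unit : ∀ i v → (unit i · v) ÷ i ≡ v
  ÷-unit i v = ·-cancelˡ (unit i) (unit-÷ (unit i · v) i (≤-trans (≤-reflexive (sym (lookup-unit-same i)))
    (≤-trans (m≤m+n _ _) (≤-reflexive (sym (lookup-· (unit i) v i))))))

  -- The minimal generators of the initial ideal. Since multiples of reducible monomials are
  -- reducible, it is enough to test the quotients by one variable.
  MinimalReducible : Monomial N → Set
  MinimalReducible u = Reducible u × (∀ i → 1 ≤ lookup u i → ¬ Reducible (u ÷ i))

  minimalReducible? : ∀ u → Dec (MinimalReducible u)
  minimalReducible? u = reducible? u ×-dec Fin.all? (λ i → (1 ≤? lookup u i) →-dec ¬? (reducible? (u ÷ i)))

  minimal-divisor : ∀ u → Reducible u → ∃[ g ] (MinimalReducible g × g Divides u)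
  minimal-divisor u = go u (<-wellFounded (degree u))
    where
    go : ∀ u → Acc _<_ (degree u) → Reducible u → ∃[ g ] (MinimalReducible g × g Divides u)
    go u (acc rec) red with Fin.any? (λ i → (1 ≤? lookup u i) ×-dec reducible? (u ÷ i))
    ... | no none = u , (red , λ i pos red′ → none (i , pos , red′)) , 𝟙 , sym (·-identityˡ u)
    ... | yes (i , pos , red′) with go (u ÷ i) (rec smaller) red′
      where
      smaller : degree (u ÷ i) < degree u
      smaller = ≤-reflexive (trans (cong (_+ degree (u ÷ i)) (sym (degree-unit i)))
        (trans (sym (degree-· (unit i) (u ÷ i))) (cong degree (unit-÷ u i pos))))
    ...   | g , min , w , eq = g , min , unit i · w ,
      trans (sym (unit-÷ u i pos)) (trans (cong (unit i ·_) eq) (sym (·-assoc (unit i) w g)))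

  minimal-divides : ∀ {g u} → MinimalReducible u → Reducible g → g Divides u → g ≡ u
  minimal-divides {g} {u} (_ , min) red (w , eq) with variables w in vars
  ... | [] = sym (trans eq (trans (cong (_· g) (trans (sym (mon-variables w)) (cong mon vars))) (·-identityˡ g)))
  ... | i ∷ _ with ∈-variables w (subst (i ∈_) (sym vars) (here refl))
  ...   | w′ , w≡ = contradiction (subst Reducible (sym u÷i) (reducible-· w′ red)) (min i pos)
    where
    u≡ : u ≡ unit i · (w′ · g)
    u≡ = trans eq (trans (cong (_· g) w≡) (·-assoc (unit i) w′ g))
    u÷i : u ÷ i ≡ w′ · g
    u÷i = trans (cong (_÷ i) u≡) (÷-unit i _)
    pos : 1 ≤ lookup u i
    pos = ≤-trans (≤-reflexive (sym (lookup-unit-same i))) (≤-trans (m≤m+n _ _)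
      (≤-reflexive (sym (trans (cong (λ z → lookup z i) u≡) (lookup-· (unit i) _ i)))))

  -- A common variable could be cancelled from `u` and `v`, and `u ÷ i` would still be reducible.
  minimal-disjoint : ∀ {u v} → MinimalReducible u → Fibre u v → v ≼ u → v ≢ u →
                     ∀ i → ¬ (1 ≤ lookup v i × 1 ≤ lookup u i)
  minimal-disjoint {u} {v} (_ , min) fib v≼u v≢u i (posv , posu) = min i posu
    (reducible-·⁻ (unit i) {u ÷ i} {v ÷ i} (subst₂ Fibre (sym u≡) (sym v≡) fib)
      (subst₂ _≼_ (sym v≡) (sym u≡) v≼u) (subst₂ _≢_ (sym v≡) (sym u≡) v≢u))
    where
    u≡ = unit-÷ u i posu
    v≡ = unit-÷ v i posv

  -- Leading monomials of the toric ideal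

  open Poly k N
  I : Polynomial k N → Set ℓ₁
  I = toricIdeal k 𝒜

  -- Tightness makes equality the negation of apartness, hence stable. This replaces a decision
  -- whether a coefficient vanishes.
  ≈-stable : ∀ {x y} → ¬ ¬ (x k.≈ y) → x k.≈ y
  ≈-stable {x} {y} ¬¬eq = proj₁ (k.tight x y) λ x#y → ¬¬eq λ eq → proj₂ (k.tight x y) eq x#y

  1≉0 : ¬ (k.1# k.≈ k.0#)
  1≉0 eq = proj₂ (k.tight k.1# k.0#) eq (k.invertible⇒# (k.1# , inverse , inverse′))
    where
    1-0≈1 : (k.1# k.+ (k.- k.0#)) k.≈ k.1#
    1-0≈1 = k.trans (k.+-cong k.refl (k.trans (k.sym (k.+-identityˡ _)) (k.-‿inverseʳ k.0#))) (k.+-identityʳ _)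
    inverse : (k.1# k.* (k.1# k.+ (k.- k.0#))) k.≈ k.1#
    inverse = k.trans (k.*-identityˡ _) 1-0≈1
    inverse′ : ((k.1# k.+ (k.- k.0#)) k.* k.1#) k.≈ k.1#
    inverse′ = k.trans (k.*-identityʳ _) 1-0≈1

  sumCoeff : Polynomial k N → List (Monomial N) → k.Carrier
  sumCoeff f []       = k.0#
  sumCoeff f (u ∷ us) = coeff f u k.+ sumCoeff f us

  sumCoeff-∉ : ∀ a m f {us} → m ∉ us → sumCoeff ((a , m) ∷ f) us k.≈ sumCoeff f us
  sumCoeff-∉ a m f {[]}     m∉ = k.refl
  sumCoeff-∉ a m f {u ∷ us} m∉ with m ≟ᴹ u
  ... | yes refl = contradiction (here refl) m∉
  ... | no _     = k.+-cong k.refl (sumCoeff-∉ a m f (m∉ ∘ there))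

  sumCoeff-∈ : ∀ a m f {us} → Unique us → m ∈ us → sumCoeff ((a , m) ∷ f) us k.≈ (a k.+ sumCoeff f us)
  sumCoeff-∈ a m f {u ∷ us} (u∉ ∷ uniq) m∈ with m ≟ᴹ u | m∈
  ... | yes refl | _ = k.trans (k.+-cong k.refl (sumCoeff-∉ a m f (λ m∈ → All.lookup u∉ m∈ refl))) (k.+-assoc _ _ _)
  ... | no m≢u | here m≡u = contradiction m≡u m≢u
  ... | no m≢u | there m∈us = k.trans (k.+-cong k.refl (sumCoeff-∈ a m f uniq m∈us))
    (k.trans (k.sym (k.+-assoc _ _ _)) (k.trans (k.+-cong (k.+-comm _ _) k.refl) (k.+-assoc _ _ _)))

  -- A monomial may occur in several terms of `f`, and `coeff` gathers them all; listing each
  -- monomial of `f` over `t` once therefore counts every term over `t` exactly once.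
  sumCoeff-fibre : ∀ f t {us} → Unique us → All (λ u → image 𝒜 u ≡ t) us →
                   (∀ {a m} → (a , m) ∈ f → image 𝒜 m ≡ t → m ∈ us) → sumCoeff f us k.≈ fibreCoeff 𝒜 f t
  sumCoeff-fibre [] t {us} uniq im all∈ = zero-sum us
    where
    zero-sum : ∀ us → sumCoeff [] us k.≈ k.0#
    zero-sum []       = k.refl
    zero-sum (_ ∷ us) = k.trans (k.+-identityˡ _) (zero-sum us)
  sumCoeff-fibre ((a , m) ∷ f) t {us} uniq im all∈ with Vec.≡-dec ℤ._≟_ (image 𝒜 m) t
  ... | yes eq = k.trans (sumCoeff-∈ a m f uniq (all∈ (here refl) eq))
                         (k.+-cong k.refl (sumCoeff-fibre f t uniq im (all∈ ∘ there)))
  ... | no  ne = k.trans (sumCoeff-∉ a m f (ne ∘ All.lookup im)) (sumCoeff-fibre f t uniq im (all∈ ∘ there))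

  fibreCoeff-lead : ∀ f u → (∀ v → Fibre u v → v ≢ u → coeff f v k.≈ k.0#) → fibreCoeff 𝒜 f (image 𝒜 u) k.≈ coeff f u
  fibreCoeff-lead f u zeros = k.trans (k.sym (sumCoeff-fibre f (image 𝒜 u) (deduplicate-! _≟ᴹ_ (u ∷ others)) images all∈)) (rest support tails)
    where
    others : List (Monomial N)
    others = filter (sameImage? u) (map proj₂ f)
    -- `u` followed by this list is what `deduplicate _≟ᴹ_ (u ∷ others)` computes to, so the summand
    -- of `u` comes first.
    support : List (Monomial N)
    support = filter (λ v → ¬? (u ≟ᴹ v)) (deduplicate _≟ᴹ_ others)
    same∈ : ∀ {v} → v ∈ others → image 𝒜 v ≡ image 𝒜 u
    same∈ v∈ = proj₂ (∈-filter⁻ (sameImage? u) {xs = map proj₂ f} v∈)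
    images : All (λ v → image 𝒜 v ≡ image 𝒜 u) (deduplicate _≟ᴹ_ (u ∷ others))
    images = All.tabulate λ v∈ → aux (∈-deduplicate⁻ _≟ᴹ_ (u ∷ others) v∈)
      where
      aux : ∀ {v} → v ∈ u ∷ others → image 𝒜 v ≡ image 𝒜 u
      aux (here refl) = refl
      aux (there v∈)  = same∈ v∈
    all∈ : ∀ {a m} → (a , m) ∈ f → image 𝒜 m ≡ image 𝒜 u → m ∈ deduplicate _≟ᴹ_ (u ∷ others)
    all∈ am∈ eq = ∈-deduplicate⁺ _≟ᴹ_ (there (∈-filter⁺ (sameImage? u) (∈-map⁺ proj₂ am∈) eq))
    tails : All (λ v → coeff f v k.≈ k.0#) support
    tails = All.tabulate λ {v} v∈ →
      let v∈′ , u≢v = ∈-filter⁻ (λ v → ¬? (u ≟ᴹ v)) {xs = deduplicate _≟ᴹ_ others} v∈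
      in zeros v (image⇒fibre u v (sym (same∈ (∈-deduplicate⁻ _≟ᴹ_ others v∈′)))) (u≢v ∘ sym)
    rest : ∀ us → All (λ v → coeff f v k.≈ k.0#) us → (coeff f u k.+ sumCoeff f us) k.≈ coeff f u
    rest us all = k.trans (k.+-cong k.refl (vanish all)) (k.+-identityʳ _)
      where
      vanish : ∀ {us} → All (λ v → coeff f v k.≈ k.0#) us → sumCoeff f us k.≈ k.0#
      vanish []          = k.refl
      vanish (eq ∷ eqs) = k.trans (k.+-cong eq (vanish eqs)) (k.+-identityˡ _)

  -- If `u` were least in its fibre, nothing else of the fibre could lie in the support, and the
  -- image of `f` would have at `image 𝒜 u` the coefficient of `u`, which is not zero.
  leading-reducible : ∀ {f u} → I f → IsLeadingMonomial k _≼_ f u → Reducible u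
  leading-reducible {f} {u} f∈I (u∈ , lead) with reducible? u
  ... | yes red = red
  ... | no irr = contradiction (k.trans (k.sym (fibreCoeff-lead f u zeros))
                   (k.trans (k.sym (coeff-evaluate 𝒜 f (image 𝒜 u))) (f∈I (image 𝒜 u)))) u∈
    where
    zeros : ∀ v → Fibre u v → v ≢ u → coeff f v k.≈ k.0#
    zeros v fib v≢u = ≈-stable λ v∈ → irr (v , fib , lead v v∈ , v≢u)

  -- Binomials and the reduced Gröbner basis

  binomial : Monomial N → Polynomial k N
  binomial u = (k.1# , u) ∷ (k.- k.1# , normalForm u) ∷ []

  binomial∈I : ∀ u → I (binomial u)
  binomial∈I u t = k.trans (coeff-evaluate 𝒜 (binomial u) t) (cancel (fibre⇒image u (normalForm u) (normalForm-fibre u)))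
    where
    cancel : ∀ {x y} → x ≡ y → (if does (Vec.≡-dec ℤ._≟_ x t)
      then k.1# k.+ (if does (Vec.≡-dec ℤ._≟_ y t) then (k.- k.1#) k.+ k.0# else k.0#)
      else (if does (Vec.≡-dec ℤ._≟_ y t) then (k.- k.1#) k.+ k.0# else k.0#)) k.≈ k.0#
    cancel {x} refl with does (Vec.≡-dec ℤ._≟_ x t)
    ... | true  = k.trans (k.+-cong k.refl (k.+-identityʳ _)) (k.-‿inverseʳ k.1#)
    ... | false = k.refl

  coeff-binomial-lead : ∀ {u} → Reducible u → coeff (binomial u) u k.≈ k.1#
  coeff-binomial-lead {u} red with u ≟ᴹ u | normalForm u ≟ᴹ u
  ... | no u≢u | _      = contradiction refl u≢u
  ... | yes _  | yes eq = contradiction (sym eq) (reducible⇒≢normalForm red)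
  ... | yes _  | no _   = k.+-identityʳ _

  supp-binomial : ∀ u v → v ∈supp binomial u → v ≡ u ⊎ v ≡ normalForm u
  supp-binomial u v v∈ with u ≟ᴹ v | normalForm u ≟ᴹ v
  ... | yes eq | _      = inj₁ (sym eq)
  ... | no _   | yes eq = inj₂ (sym eq)
  ... | no _   | no _   = contradiction k.refl v∈

  supp-binomial-≼ : ∀ u v → v ∈supp binomial u → v ≼ u
  supp-binomial-≼ u v v∈ with supp-binomial u v v∈
  ... | inj₁ refl = ≼-refl
  ... | inj₂ refl = normalForm-≼ u u (λ _ → refl)

  binomial-lead : ∀ {u} → Reducible u → IsLeadingMonomial k _≼_ (binomial u) u
  binomial-lead {u} red = (λ eq → 1≉0 (k.trans (k.sym (coeff-binomial-lead red)) eq)) , supp-binomial-≼ u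

  binomial-lead-unique : ∀ {u v} → Reducible u → IsLeadingMonomial k _≼_ (binomial u) v → v ≡ u
  binomial-lead-unique {u} {v} red (v∈ , lead) = antisym (supp-binomial-≼ u v v∈) (lead u (proj₁ (binomial-lead red)))

  ideal-mono : ∀ {a b} {S : Polynomial k N → Set a} {T : Polynomial k N → Set b} →
               (∀ {f} → S f → ⟨ k ⟩ T f) → ∀ {f} → ⟨ k ⟩ S f → ⟨ k ⟩ T f
  ideal-mono S⊆ (generator s)   = S⊆ s
  ideal-mono S⊆ zero            = zero
  ideal-mono S⊆ (add p q)       = add (ideal-mono S⊆ p) (ideal-mono S⊆ q)
  ideal-mono S⊆ (scale h p)     = scale h (ideal-mono S⊆ p)
  ideal-mono S⊆ (respects eq p) = respects eq (ideal-mono S⊆ p)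

  lookup-map-unique : ∀ {a} {A : Set} {B : Set a} (f : A → B) {xs} → Unique xs →
                      ∀ i j → i ≢ j → ∃₂ λ x y → x ∈ xs × y ∈ xs × x ≢ y × List.lookup (map f xs) i ≡ f x × List.lookup (map f xs) j ≡ f y
  lookup-map-unique f {x ∷ xs} (x∉ ∷ u) zero    zero    i≢j = contradiction refl i≢j
  lookup-map-unique f {x ∷ xs} (x∉ ∷ u) zero    (suc j) i≢j =
    let y , y∈ , eq = ∈-map⁻ f (∈-lookup {xs = map f xs} j) in x , y , here refl , there y∈ , All.lookup x∉ y∈ , refl , eq
  lookup-map-unique f {x ∷ xs} (x∉ ∷ u) (suc i) zero    i≢j =
    let y , y∈ , eq = ∈-map⁻ f (∈-lookup {xs = map f xs} i) in y , x , there y∈ , here refl , All.lookup x∉ y∈ ∘ sym , eq , refl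
  lookup-map-unique f {x ∷ xs} (x∉ ∷ u) (suc i) (suc j) i≢j =
    let y , z , y∈ , z∈ , rest = lookup-map-unique f u i j (i≢j ∘ cong suc) in y , z , there y∈ , there z∈ , rest

  module Basis (q : ℕ)
    (small : ∀ u v → Fibre u v → v ≼ u → v ≢ u → (∀ i → ¬ (1 ≤ lookup v i × 1 ≤ lookup u i)) →
             ∃[ g ] (g Divides u × SquarefreeMonomial g × degree g ≤ q × Reducible g)) where

    -- The small divisor is itself reducible, so minimality makes it all of `u`.
    minimal-small : ∀ {u} → MinimalReducible u → SquarefreeMonomial u × degree u ≤ q
    minimal-small {u} min@((v , fib , v≼u , v≢u) , _) with small u v fib v≼u v≢u (minimal-disjoint min fib v≼u v≢u)
    ... | g , g∣u , sqf , deg , red with minimal-divides min red g∣u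
    ...   | refl = sqf , deg

    -- Minimal reducible monomials are squarefree, so exponents 0 and 1 are all that has to be
    -- searched, and the basis is finite.
    leads : List (Monomial N)
    leads = deduplicate _≟ᴹ_ (filter minimalReducible? (boxes 1 N))

    ∈-leads : ∀ {u} → MinimalReducible u → u ∈ leads
    ∈-leads {u} min = ∈-deduplicate⁺ _≟ᴹ_ (∈-filter⁺ minimalReducible? (∈-boxes u (VecAll-lookup⁺ (proj₁ (minimal-small min)))) min)

    leads-minimal : ∀ {u} → u ∈ leads → MinimalReducible u
    leads-minimal u∈ = proj₂ (∈-filter⁻ minimalReducible? {xs = boxes 1 N} (∈-deduplicate⁻ _≟ᴹ_ _ u∈))

    basis : List (Polynomial k N)
    basis = map binomial leads

    all-basis : ∀ {a} {P : Polynomial k N → Set a} → (∀ {u} → MinimalReducible u → P (binomial u)) → All P basis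
    all-basis holds = All-map⁺ (All.tabulate (λ u∈ → holds (leads-minimal u∈)))

    contained : All I basis
    contained = all-basis λ {u} _ → binomial∈I u

    -- The leading monomial is reducible, hence a multiple of a minimal one; as the binomials are
    -- monic, multiplying by one term restores the coefficient.
    lead-term∈ : ∀ {f} → LeadingTermsOf k _≼_ I f → ⟨ k ⟩ (LeadingTermsOf k _≼_ (_∈ basis)) f
    lead-term∈ (f , u , f∈I , lead , refl) with minimal-divisor u (leading-reducible {f} {u} f∈I lead)
    ... | g , min , w , refl = respects same (scale (term (coeff f (w · g)) w)
      (generator (binomial g , g , ∈-map⁺ binomial (∈-leads min) , binomial-lead (proj₁ min) , refl)))
      where
      same : ∀ v → coeff ((coeff f (w · g) k.* coeff (binomial g) g , w · g) ∷ []) v k.≈ coeff (term (coeff f (w · g)) (w · g)) v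
      same v with does ((w · g) ≟ᴹ v)
      ... | true  = k.+-cong (k.trans (k.*-cong k.refl (coeff-binomial-lead (proj₁ min))) (k.*-identityʳ _)) k.refl
      ... | false = k.refl

    isReducedGröbnerBasis : IsReducedGröbnerBasis k _≼_ I basis
    isReducedGröbnerBasis = record
      { isGröbnerBasis = record
        { contained    = contained
        ; initialIdeal = ideal-mono lead-term∈ ,
            ideal-mono λ (f , u , f∈ , lead) → generator (f , u , All.lookup contained f∈ , lead)
        }
      ; monic   = all-basis λ {u} min → u , binomial-lead (proj₁ min) , coeff-binomial-lead (proj₁ min)
      ; reduced = reduced
      }
      where
      -- The lead of `y` is no multiple of another lead by minimality, and its normal form is none
      -- because multiples of reducible monomials are reducible.
      not-divides : ∀ {x y u v} → MinimalReducible x → MinimalReducible y → x ≢ y →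
                    IsLeadingMonomial k _≼_ (binomial x) u → v ∈supp binomial y → ¬ (u Divides v)
      not-divides {x} {y} {u} {v} minx miny x≢y lead v∈ u∣v with binomial-lead-unique {x} {u} (proj₁ minx) lead | supp-binomial y v v∈
      ... | refl | inj₁ refl = x≢y (minimal-divides miny (proj₁ minx) u∣v)
      ... | refl | inj₂ refl with u∣v
      ...   | w , eq = normalForm-irreducible y (subst Reducible (sym eq) (reducible-· w (proj₁ minx)))

      reduced : ∀ i j → i ≢ j → ∀ u v → IsLeadingMonomial k _≼_ (List.lookup basis i) u →
                v ∈supp List.lookup basis j → ¬ (u Divides v)
      reduced i j i≢j u v lead v∈ with lookup-map-unique binomial {leads} (deduplicate-! _≟ᴹ_ _) i j i≢j
      ... | x , y , x∈ , y∈ , x≢y , eqi , eqj = not-divides (leads-minimal x∈) (leads-minimal y∈) x≢y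
        (subst (λ f → IsLeadingMonomial k _≼_ f u) eqi lead) (subst (v ∈supp_) eqj v∈)

    squarefree : All (HasSquarefreeLeadingTerm k _≼_) basis
    squarefree = all-basis λ {u} min v lead →
      subst SquarefreeMonomial (sym (binomial-lead-unique {u} {v} (proj₁ min) lead)) (proj₁ (minimal-small min))

    bounded : All (HasDegreeAtMost k q) basis
    bounded = all-basis λ {u} min v v∈ → ≤-trans (≼⇒degree≤ (supp-binomial-≼ u v v∈)) (proj₂ (minimal-small min))

-- The cells of a matrix, its lines, and a tiling by dominoes

∑-map : ∀ {a b} {A : Set a} {B : Set b} (f : B → ℕ) (g : A → B) xs → ∑ f (map g xs) ≡ ∑ (f ∘ g) xs
∑-map f g []       = refl
∑-map f g (x ∷ xs) = cong (f (g x) +_) (∑-map f g xs)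

module Grid (m n : ℕ) where

  Cell : Set
  Cell = Fin m × Fin n

  _≟ᶜ_ : (c d : Cell) → Dec (c ≡ d)
  _≟ᶜ_ = ≡-dec Fin._≟_ Fin._≟_

  row : Fin m → List Cell
  row i = map (i ,_) (allFin n)

  column : Fin n → List Cell
  column j = map (_, j) (allFin m)

  rows columns : List (List Cell)
  rows    = map row (allFin m)
  columns = map column (allFin n)

  cells : List Cell
  cells = cartesianProduct (allFin m) (allFin n)

  private
    concat-map-map : ∀ {A B C : Set} (f : A → B → C) xs ys →
                     concat (map (λ x → map (f x) ys) xs) ≡ cartesianProductWith f xs ys
    concat-map-map f []       ys = refl
    concat-map-map f (x ∷ xs) ys = cong (map (f x) ys ++_) (concat-map-map f xs ys)

  unique-rows : Unique (concat rows)
  unique-rows = subst Unique (sym (concat-map-map _,_ (allFin m) (allFin n)))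
    (cartesianProductWith⁺ _,_ (λ { refl → refl , refl }) (allFin⁺ m) (allFin⁺ n))

  unique-columns : Unique (concat columns)
  unique-columns = subst Unique (sym (concat-map-map (λ j i → i , j) (allFin n) (allFin m)))
    (cartesianProductWith⁺ (λ j i → i , j) (λ { refl → refl , refl }) (allFin⁺ n) (allFin⁺ m))

  functionals : List (List Cell)
  functionals = (rows ++ columns) ++ map pair (concatMap pairUp (rows ++ columns)) ++ map (_∷ []) cells

  row∈ : ∀ i → row i ∈ functionals
  row∈ i = ∈-++⁺ˡ (∈-++⁺ˡ (∈-map⁺ row (∈-allFin i)))

  column∈ : ∀ j → column j ∈ functionals
  column∈ j = ∈-++⁺ˡ (∈-++⁺ʳ rows (∈-map⁺ column (∈-allFin j)))

  domino∈ : ∀ {xy} → xy ∈ concatMap pairUp (rows ++ columns) → pair xy ∈ functionals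
  domino∈ xy∈ = ∈-++⁺ʳ (rows ++ columns) (∈-++⁺ˡ (∈-map⁺ pair xy∈))

  cell∈ : ∀ c → c ∷ [] ∈ functionals
  cell∈ (i , j) = ∈-++⁺ʳ (rows ++ columns) (∈-++⁺ʳ (map pair (concatMap pairUp (rows ++ columns)))
    (∈-map⁺ (_∷ []) (∈-cartesianProduct⁺ (∈-allFin i) (∈-allFin j))))

  -- The cells of the last column if n is odd, and no cells if n is even.
  leftover : List Cell
  leftover = concatMap (λ i → map (i ,_) (last (allFin n))) (allFin m)

  -- Rows are cut into horizontal dominoes; for odd `n` the last column is cut into vertical ones,
  -- so only its last cell can be missed.
  tiling : List (Cell × Cell)
  tiling = concatMap (pairUp ∘ row) (allFin m) ++ pairUp leftover

  last-map : ∀ {A B : Set} (f : A → B) xs → last (map f xs) ≡ map f (last xs)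
  last-map f []           = refl
  last-map f (x ∷ [])     = refl
  last-map f (x ∷ y ∷ xs) = last-map f xs

  last-cases : ∀ {A : Set} (xs : List A) → last xs ≡ [] ⊎ ∃[ x ] last xs ≡ x ∷ []
  last-cases []           = inj₁ refl
  last-cases (x ∷ [])     = inj₂ (x , refl)
  last-cases (x ∷ y ∷ xs) = last-cases xs

  leftover-column : leftover ≡ [] ⊎ ∃[ j ] leftover ≡ column j
  leftover-column with last (allFin n) | last-cases (allFin n)
  ... | _ | inj₁ refl       = inj₁ (empty (allFin m))
    where
    empty : ∀ (is : List (Fin m)) → concatMap (λ i → map (i ,_) (List.[] {A = Fin n})) is ≡ []
    empty []       = refl
    empty (i ∷ is) = empty is
  ... | _ | inj₂ (j , refl) = inj₂ (j , single (allFin m))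
    where
    single : ∀ (is : List (Fin m)) → concatMap (λ i → map (i ,_) (j ∷ [])) is ≡ map (_, j) is
    single []       = refl
    single (i ∷ is) = cong ((i , j) ∷_) (single is)

  -- `halve` balances the dominoes that `pairUp` cuts from whole rows and columns, so those of the
  -- tiling must be among them.
  tiling⊆ : ∀ {xy} → xy ∈ tiling → xy ∈ concatMap pairUp (rows ++ columns)
  tiling⊆ {xy} xy∈ with ∈-++⁻ (concatMap (pairUp ∘ row) (allFin m)) xy∈
  ... | inj₁ xy∈rows with find (∈-concatMap⁻ (pairUp ∘ row) {xs = allFin m} xy∈rows)
  ...   | i , i∈ , xy∈row = ∈-concatMap⁺ pairUp (lose (∈-++⁺ˡ (∈-map⁺ row i∈)) xy∈row)
  tiling⊆ {xy} xy∈ | inj₂ xy∈rest with leftover-column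
  ... | inj₁ eq with () ← subst (λ cs → xy ∈ pairUp cs) eq xy∈rest
  ... | inj₂ (j , eq) = ∈-concatMap⁺ pairUp
    (lose (∈-++⁺ʳ rows (∈-map⁺ column (∈-allFin j))) (subst (λ cs → xy ∈ pairUp cs) eq xy∈rest))

  -- The one cell that the tiling may miss; an arbitrary cell if it misses none.
  missing : Cell → Cell
  missing c with last leftover
  ... | []    = c
  ... | d ∷ _ = d

  ∈-flat⁻ : ∀ {c : Cell} {ps} → c ∈ flat ps → ∃[ xy ] (xy ∈ ps × (c ≡ proj₁ xy ⊎ c ≡ proj₂ xy))
  ∈-flat⁻ {ps = xy ∷ ps} (here eq)         = xy , here refl , inj₁ eq
  ∈-flat⁻ {ps = xy ∷ ps} (there (here eq)) = xy , here refl , inj₂ eq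
  ∈-flat⁻ {ps = xy ∷ ps} (there (there c∈)) =
    let zw , zw∈ , eq = ∈-flat⁻ c∈ in zw , there zw∈ , eq

  Covered : Cell → Set
  Covered c = ∃[ t ] (c ≡ proj₁ (List.lookup tiling t) ⊎ c ≡ proj₂ (List.lookup tiling t))

  covered : ∀ {c xy} → xy ∈ tiling → c ≡ proj₁ xy ⊎ c ≡ proj₂ xy → Covered c
  covered {c} xy∈ eq = Any.index xy∈ , subst (λ xy → c ≡ proj₁ xy ⊎ c ≡ proj₂ xy) (Any.lookup-index xy∈) eq

  tiling-covers : ∀ c₀ c → c ≡ missing c₀ ⊎ Covered c
  tiling-covers c₀ c@(i , j) with ∈-++⁻ (flat (pairUp (row i))) (subst (c ∈_) (sym (flat-pairUp (row i))) (∈-map⁺ (i ,_) (∈-allFin j)))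
  ... | inj₁ c∈ =
    let xy , xy∈ , eq = ∈-flat⁻ c∈ in inj₂ (covered (∈-++⁺ˡ (∈-concatMap⁺ (pairUp ∘ row) (lose (∈-allFin i) xy∈))) eq)
  ... | inj₂ c∈last with ∈-++⁻ (flat (pairUp leftover)) (subst (c ∈_) (sym (flat-pairUp leftover))
          (∈-concatMap⁺ (λ i → map (i ,_) (last (allFin n))) (lose (∈-allFin i) (subst (c ∈_) (last-map (i ,_) (allFin n)) c∈last))))
  ...   | inj₁ c∈ = let xy , xy∈ , eq = ∈-flat⁻ c∈ in inj₂ (covered (∈-++⁺ʳ (concatMap (pairUp ∘ row) (allFin m)) xy∈) eq)
  ...   | inj₂ c∈ with last leftover | last-cases leftover
  tiling-covers c₀ c | inj₂ _ | inj₂ () | _ | inj₁ refl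
  tiling-covers c₀ c | inj₂ _ | inj₂ (here refl) | _ | inj₂ (d , refl) = inj₁ refl

  length-pairUp : ∀ {A : Set} (xs : List A) → length (pairUp xs) ≡ ⌊ length xs /2⌋
  length-pairUp []           = refl
  length-pairUp (x ∷ [])     = refl
  length-pairUp (x ∷ y ∷ xs) = cong suc (length-pairUp xs)

  -- With n = 2h + l, the rows give mh dominoes and the leftover cells ⌊ml/2⌋; the even part 2mh
  -- passes out of the floor.
  length-tiling : length tiling ≡ ⌊ m * n /2⌋
  length-tiling = begin
    length tiling                                           ≡⟨ length-++ (concatMap (pairUp ∘ row) (allFin m)) ⟩
    length (concatMap (pairUp ∘ row) (allFin m)) + length (pairUp leftover)
                                                            ≡⟨ cong₂ _+_ (length-concatMap (pairUp ∘ row) h row-length (allFin m)) (length-pairUp leftover) ⟩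
    length (allFin m) * h + ⌊ length leftover /2⌋           ≡⟨ cong₂ _+_ (cong (_* h) (length-allFin m)) (cong ⌊_/2⌋ leftover-length) ⟩
    m * h + ⌊ m * l /2⌋                                     ≡⟨ half-+ (m * h) (m * l) ⟨
    ⌊ (m * h + m * h) + m * l /2⌋                           ≡⟨ cong ⌊_/2⌋ (distrib m h l) ⟩
    ⌊ m * ((h + h) + l) /2⌋                                 ≡⟨ cong (λ k → ⌊ m * k /2⌋) n≡ ⟩
    ⌊ m * n /2⌋                                             ∎
    where
    open ≡-Reasoning
    h = length (pairUp (allFin n))
    l = length (last (allFin n))
    length-allFin : ∀ k → length (allFin k) ≡ k
    length-allFin k = length-tabulate {n = k} (λ i → i)
    length-concatMap : ∀ {A B : Set} (f : A → List B) k → (∀ x → length (f x) ≡ k) → ∀ xs → length (concatMap f xs) ≡ length xs * k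
    length-concatMap f k eq []       = refl
    length-concatMap f k eq (x ∷ xs) = trans (length-++ (f x)) (cong₂ _+_ (eq x) (length-concatMap f k eq xs))
    row-length : ∀ i → length (pairUp (row i)) ≡ h
    row-length i = trans (length-pairUp (row i)) (trans (cong ⌊_/2⌋ (length-map (i ,_) (allFin n))) (sym (length-pairUp (allFin n))))
    leftover-length : length leftover ≡ m * l
    leftover-length = trans (length-concatMap _ l (λ i → length-map (i ,_) (last (allFin n))) (allFin m)) (cong (_* l) (length-allFin m))
    half-+ : ∀ a b → ⌊ (a + a) + b /2⌋ ≡ a + ⌊ b /2⌋
    half-+ zero    b = refl
    half-+ (suc a) b = trans (cong (λ k → ⌊ suc k + b /2⌋) (+-suc a a)) (cong suc (half-+ a b))
    distrib : ∀ m h l → (m * h + m * h) + m * l ≡ m * ((h + h) + l)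
    distrib = solve-∀
    length-flat : ∀ {A : Set} (ps : List (A × A)) → length (flat ps) ≡ length ps + length ps
    length-flat []       = refl
    length-flat (p ∷ ps) = cong suc (trans (cong suc (length-flat ps)) (sym (+-suc _ _)))
    n≡ : (h + h) + l ≡ n
    n≡ = trans (cong (_+ l) (sym (length-flat (pairUp (allFin n)))))
      (trans (sym (length-++ (flat (pairUp (allFin n))))) (trans (cong length (flat-pairUp (allFin n))) (length-allFin n)))

-- Lattice points as natural number matrices

Σℤ-∑ : ∀ {k l} (f : Fin l → ℤ) (g : Fin l → ℕ) → (∀ i → f i ≡ ℤ.+ g i) → (h : Fin k → Fin l) →
       Σℤ (f ∘ h) ≡ ℤ.+ ∑ g (tabulate h)
Σℤ-∑ {zero}  f g eq h = refl
Σℤ-∑ {suc k} f g eq h = cong₂ ℤ._+_ (eq (h zero)) (Σℤ-∑ f g eq (h ∘ suc))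

matrix-ext : ∀ {m n} {A B : Matrix ℤ m n} → (∀ i j → entry A i j ≡ entry B i j) → A ≡ B
matrix-ext {A = A} {B} eq = vec-ext λ i → vec-ext (eq i)
  where
  vec-ext : ∀ {X : Set} {k} {u v : Vec X k} → (∀ i → lookup u i ≡ lookup v i) → u ≡ v
  vec-ext eq = trans (sym (Vec.tabulate∘lookup _)) (trans (Vec.tabulate-cong eq) (Vec.tabulate∘lookup _))

module Points {m n : ℕ} (r : Vec ℕ m) (s : Vec ℕ n) where

  open Grid m n

  N : ℕ
  N = #latticePoints r s

  matrix : Fin N → Matrix ℤ m n
  matrix A = value (latticePoint r s A)

  inPolytope : ∀ A → InTransportationPolytope r s (matrix A)
  inPolytope A with latticePoint r s A
  ... | M , [ T ] = recompute (inTransportationPolytope? r s M) T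

  pt : Fin N → Cell → ℕ
  pt A (i , j) = ∣ entry (matrix A) i j ∣

  entry≡pt : ∀ A i j → entry (matrix A) i j ≡ ℤ.+ pt A (i , j)
  entry≡pt A i j = sym (ℤ.0≤i⇒+∣i∣≡i (InTransportationPolytope.nonNegative (inPolytope A) i j))

  row-sum : ∀ A i → ∑ (pt A) (row i) ≡ lookup r i
  row-sum A i = ℤ.+-injective (trans (cong ℤ.+_ (∑-map (pt A) (i ,_) (allFin n)))
    (trans (sym (Σℤ-∑ (entry (matrix A) i) (λ j → pt A (i , j)) (entry≡pt A i) (λ j → j)))
           (InTransportationPolytope.rowSums (inPolytope A) i)))

  column-sum : ∀ A j → ∑ (pt A) (column j) ≡ lookup s j
  column-sum A j = ℤ.+-injective (trans (cong ℤ.+_ (∑-map (pt A) (_, j) (allFin m)))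
    (trans (sym (Σℤ-∑ (λ i → entry (matrix A) i j) (λ i → pt A (i , j)) (λ i → entry≡pt A i j) (λ i → i)))
           (InTransportationPolytope.columnSums (inPolytope A) j)))

  Realises : Fin N → (Cell → ℕ) → Set
  Realises A Q = ∀ c → pt A c ≡ Q c

  realise : (Q : Cell → ℕ) → (∀ i → ∑ Q (row i) ≡ lookup r i) → (∀ j → ∑ Q (column j) ≡ lookup s j) →
            ∃[ A ] Realises A Q
  realise Q rowsQ columnsQ = A , λ (i , j) → trans (cong (λ P → ∣ entry (value P) i j ∣) eq) (cong ∣_∣ (entry-M i j))
    where
    M : Matrix ℤ m n
    M = Vec.tabulate λ i → Vec.tabulate λ j → ℤ.+ Q (i , j)
    entry-M : ∀ i j → entry M i j ≡ ℤ.+ Q (i , j)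
    entry-M i j = trans (cong (λ v → lookup v j) (Vec.lookup∘tabulate (λ i → Vec.tabulate λ j → ℤ.+ Q (i , j)) i))
                        (Vec.lookup∘tabulate (λ j → ℤ.+ Q (i , j)) j)
    T : InTransportationPolytope r s M
    T = record
      { nonNegative = λ i j → subst (0ℤ ℤ.≤_) (sym (entry-M i j)) (ℤ.+≤+ z≤n)
      ; columnSums  = λ j → trans (Σℤ-∑ (λ i → entry M i j) (λ i → Q (i , j)) (λ i → entry-M i j) (λ i → i))
                              (cong ℤ.+_ (trans (sym (∑-map Q (_, j) (allFin m))) (columnsQ j)))
      ; rowSums     = λ i → trans (Σℤ-∑ (entry M i) (λ j → Q (i , j)) (entry-M i) (λ j → j))
                              (cong ℤ.+_ (trans (sym (∑-map Q (i ,_) (allFin n))) (rowsQ i)))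
      }
    A : Fin N
    A = Inverse.from (proj₂ (latticePoints-finite r s)) (M , [ T ])
    eq : latticePoint r s A ≡ (M , [ T ])
    eq = Inverse.strictlyInverseˡ (proj₂ (latticePoints-finite r s)) (M , [ T ])

  pt-injective : ∀ {A B} → (∀ c → pt A c ≡ pt B c) → A ≡ B
  pt-injective {A} {B} eq = trans (sym (Inverse.strictlyInverseʳ enum A))
    (trans (cong (Inverse.from enum) same) (Inverse.strictlyInverseʳ enum B))
    where
    enum = proj₂ (latticePoints-finite r s)
    value-injective : ∀ {P Q : LatticePoint r s} → value P ≡ value Q → P ≡ Q
    value-injective {_ , _} {_ , _} refl = refl
    same : latticePoint r s A ≡ latticePoint r s B
    same = value-injective (matrix-ext λ i j →
      trans (entry≡pt A i j) (trans (cong ℤ.+_ (eq (i , j))) (sym (entry≡pt B i j))))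

  total : List (Fin N) → Cell → ℕ
  total As c = ∑ (λ A → pt A c) As

  total-line : ∀ ℓ {ρ} → (∀ A → ∑ (pt A) ℓ ≡ ρ) → ∀ As → ∑ (total As) ℓ ≡ length As * ρ
  total-line ℓ {ρ} sums As = trans (sym (∑-swap pt As ℓ)) (trans (∑-cong sums As) (∑-const ρ As))

  -- All points have the same sum on a given line. Some line has a non-zero sum, and the total on it
  -- counts the points.
  total-positive : ¬ (r ≡ replicate m 0 × s ≡ replicate n 0) →
                   ∀ {As Bs} → (∀ c → total As c ≡ total Bs c) → length As ≡ length Bs
  total-positive nonzero {As} {Bs} same with nonzero-entry r | nonzero-entry s
    where
    nonzero-entry : ∀ {k} (v : Vec ℕ k) → v ≡ replicate k 0 ⊎ ∃[ i ] NonZero (lookup v i)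
    nonzero-entry []          = inj₁ refl
    nonzero-entry (suc x ∷ v) = inj₂ (zero , _)
    nonzero-entry (zero ∷ v) with nonzero-entry v
    ... | inj₁ eq       = inj₁ (cong (0 ∷_) eq)
    ... | inj₂ (i , nz) = inj₂ (suc i , nz)
  ... | inj₁ r≡0 | inj₁ s≡0 = contradiction (r≡0 , s≡0) nonzero
  ... | inj₂ (i , nz) | _ = *-cancelʳ-≡ (length As) (length Bs) (lookup r i) {{nz}}
    (trans (sym (total-line (row i) (λ A → row-sum A i) As)) (trans (∑-cong same (row i)) (total-line (row i) (λ A → row-sum A i) Bs)))
  ... | inj₁ _ | inj₂ (j , nz) = *-cancelʳ-≡ (length As) (length Bs) (lookup s j) {{nz}}
    (trans (sym (total-line (column j) (λ A → column-sum A j) As)) (trans (∑-cong same (column j)) (total-line (column j) (λ A → column-sum A j) Bs)))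

  open Rebalance functionals (halve _≟ᶜ_ cells rows columns unique-rows unique-columns)

  pairwise⇒balanced : ∀ ℓ {Qs} → AllPairs CloseOnL Qs → ℓ ∈ functionals → Balanced (λ Q → ∑ Q ℓ) Qs
  pairwise⇒balanced ℓ (_ ∷ _)      ℓ∈ (here refl) (here refl) = n≤1+n _
  pairwise⇒balanced ℓ (close ∷ _)  ℓ∈ (here refl) (there Q∈)  = proj₁ (All.lookup (All.lookup close Q∈) ℓ∈)
  pairwise⇒balanced ℓ (close ∷ _)  ℓ∈ (there P∈)  (here refl) = proj₂ (All.lookup (All.lookup close P∈) ℓ∈)
  pairwise⇒balanced ℓ (_ ∷ closes) ℓ∈ (there P∈)  (there Q∈)  = pairwise⇒balanced ℓ closes ℓ∈ P∈ Q∈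

  realise-all : ∀ (Qs : List (Cell → ℕ)) → (∀ Q → Q ∈ Qs → ∃[ A ] Realises A Q) →
                ∃[ Cs ] Pointwise Realises Cs Qs
  realise-all []       _    = [] , []
  realise-all (Q ∷ Qs) real =
    let A , eq = real Q (here refl)
        Cs , eqs = realise-all Qs (λ Q′ → real Q′ ∘ there)
    in A ∷ Cs , eq ∷ eqs

  module _ {Cs Qs} (eqs : Pointwise Realises Cs Qs) where

    realised-∈ : ∀ {C} → C ∈ Cs → ∃[ Q ] (Q ∈ Qs × Realises C Q)
    realised-∈ = go eqs
      where
      go : ∀ {Cs Qs C} → Pointwise Realises Cs Qs → C ∈ Cs → ∃[ Q ] (Q ∈ Qs × Realises C Q)
      go (eq ∷ _)   (here refl) = _ , here refl , eq
      go (_ ∷ eqs) (there C∈)  = let Q , Q∈ , eq = go eqs C∈ in Q , there Q∈ , eq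

    realised-balanced : ∀ ℓ → Balanced (λ Q → ∑ Q ℓ) Qs → Balanced (λ C → ∑ (pt C) ℓ) Cs
    realised-balanced ℓ bal C∈ D∈ with realised-∈ C∈ | realised-∈ D∈
    ... | P , P∈ , eqP | Q , Q∈ , eqQ =
      subst₂ (λ x y → x ≤ suc y) (sym (∑-cong eqP ℓ)) (sym (∑-cong eqQ ℓ)) (bal P∈ Q∈)

  realised-total : ∀ {Cs Qs} → Pointwise Realises Cs Qs →
                   length Cs ≡ length Qs × (∀ c → total Cs c ≡ ∑ (λ Q → Q c) Qs)
  realised-total []          = refl , λ _ → refl
  realised-total (eq ∷ eqs) =
    let len , sums = realised-total eqs in cong suc len , λ c → cong₂ _+_ (eq c) (sums c)

  -- Decomposing a sum of lattice points into balanced ones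

  Decomposition : List (Fin N) → List (Fin N) → ℕ → Set
  Decomposition As Bs e = ∃[ Cs ] (length Cs ≡ e × (∀ c → total (Bs ++ Cs) c ≡ total As c) ×
                                   (∀ {ℓ} → ℓ ∈ functionals → Balanced (λ C → ∑ (pt C) ℓ) Cs))

  module _ (As Bs : List (Fin N)) (Bs≤As : ∀ c → total Bs c ≤ total As c) where

    rest : Cell → ℕ
    rest c = total As c ∸ total Bs c

    rest-line : ∀ ℓ {ρ e} → length As ≡ e + length Bs → (∀ A → ∑ (pt A) ℓ ≡ ρ) → ∑ rest ℓ ≡ e * ρ
    rest-line ℓ {ρ} {e} len sums = +-cancelʳ-≡ (length Bs * ρ) _ _ (begin
      ∑ rest ℓ + length Bs * ρ          ≡⟨ cong (∑ rest ℓ +_) (total-line ℓ sums Bs) ⟨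
      ∑ rest ℓ + ∑ (total Bs) ℓ         ≡⟨ ∑-+ rest (total Bs) ℓ ⟨
      ∑ (λ c → rest c + total Bs c) ℓ   ≡⟨ ∑-cong (λ c → m∸n+n≡m (Bs≤As c)) ℓ ⟩
      ∑ (total As) ℓ                    ≡⟨ total-line ℓ sums As ⟩
      length As * ρ                     ≡⟨ cong (_* ρ) len ⟩
      (e + length Bs) * ρ               ≡⟨ *-distribʳ-+ ρ e (length Bs) ⟩
      e * ρ + length Bs * ρ             ∎)
      where open ≡-Reasoning

    total-++ : ∀ Cs c → total Cs c ≡ rest c → total (Bs ++ Cs) c ≡ total As c
    total-++ Cs c eq = trans (∑-++ (λ A → pt A c) Bs Cs) (trans (cong (total Bs c +_) eq) (m+[n∸m]≡n (Bs≤As c)))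

    -- The whole remainder starts as one part and the others as 0, although these need not be
    -- lattice points. Rebalancing brings the line sums of the parts within 1 of each other, and
    -- their mean is the prescribed sum, so each part acquires the right margins.
    decompose : ∀ e → length As ≡ e + length Bs → Decomposition As Bs e
    -- There is no part to take up the remainder, but its row sums are 0, so it vanishes.
    decompose zero    len = [] , refl , (λ c → total-++ [] c (sym (vanish c))) , λ _ ()
      where
      vanish : ∀ c → rest c ≡ 0
      vanish (i , j) = ∑≡0⇒≡0 rest (rest-line (row i) len (λ A → row-sum A i)) (∈-map⁺ (i ,_) (∈-allFin j))
    decompose (suc e) len = conclude (rebalance (rest ∷ List.replicate e (const 0)))
      where
      conclude : Rebalanced (rest ∷ List.replicate e (const 0)) → Decomposition As Bs (suc e)
      conclude (Qs , lenQ , sumQ , close) =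
        let Cs , eqs = realise-all Qs λ Q Q∈ → realise Q
              (λ i → margin (row i) (row∈ i) (λ A → row-sum A i) Q Q∈)
              (λ j → margin (column j) (column∈ j) (λ A → column-sum A j) Q Q∈)
            lenC , sumC = realised-total eqs
        in Cs , trans lenC length-Qs , (λ c → total-++ Cs c (trans (sumC c) (total-Qs c))) ,
           λ {ℓ} ℓ∈ → realised-balanced eqs ℓ (pairwise⇒balanced ℓ close ℓ∈)
        where
        length-Qs : length Qs ≡ suc e
        length-Qs = trans lenQ (cong suc (length-replicate e))

        total-Qs : ∀ c → ∑ (λ Q → Q c) Qs ≡ rest c
        total-Qs c = trans (sumQ c) (trans (cong (rest c +_) (zeros e)) (+-identityʳ _))
          where
          zeros : ∀ k → ∑ (λ Q → Q c) (List.replicate k (const 0)) ≡ 0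
          zeros zero    = refl
          zeros (suc k) = zeros k

        margin : ∀ ℓ {ρ} → ℓ ∈ functionals → (∀ A → ∑ (pt A) ℓ ≡ ρ) → ∀ Q → Q ∈ Qs → ∑ Q ℓ ≡ ρ
        margin ℓ {ρ} ℓ∈ sums Q = balanced-average (λ Q → ∑ Q ℓ) {Qs} ρ (pairwise⇒balanced ℓ close ℓ∈) (begin
          ∑ (λ Q → ∑ Q ℓ) Qs           ≡⟨ ∑-swap (λ Q c → Q c) Qs ℓ ⟩
          ∑ (λ c → ∑ (λ Q → Q c) Qs) ℓ ≡⟨ ∑-cong total-Qs ℓ ⟩
          ∑ rest ℓ                     ≡⟨ rest-line ℓ len sums ⟩
          suc e * ρ                    ≡⟨ cong (_* ρ) length-Qs ⟨
          length Qs * ρ                ∎)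
          where open ≡-Reasoning

  single-row : m ≡ 1 → ∀ (A B : Fin N) → A ≡ B
  single-row refl A B = pt-injective λ { (zero , j) → trans (sole A j) (sym (sole B j)) }
    where
    sole : ∀ A j → pt A (zero , j) ≡ lookup s j
    sole A j = trans (sym (+-identityʳ _)) (column-sum A j)

  single-column : n ≡ 1 → ∀ (A B : Fin N) → A ≡ B
  single-column refl A B = pt-injective λ { (i , zero) → trans (sole A i) (sym (sole B i)) }
    where
    sole : ∀ A i → pt A (i , zero) ≡ lookup r i
    sole A i = trans (sym (+-identityʳ _)) (row-sum A i)

  -- The tiling has two dominoes as soon as `m` and `n` are at least 2; in a single row or column
  -- the margins determine the point.
  large : 1 ≤ m → 1 ≤ n → 2 ≤ length tiling ⊎ (∀ (A B : Fin N) → A ≡ B)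
  large 1≤m 1≤n with m ≟ 1 | n ≟ 1
  ... | yes m≡1 | _       = inj₂ (single-row m≡1)
  ... | no _    | yes n≡1 = inj₂ (single-column n≡1)
  ... | no m≢1  | no n≢1  = inj₁ (≤-trans (⌊n/2⌋-mono (*-mono-≤ (≤∧≢⇒< 1≤m (m≢1 ∘ sym)) (≤∧≢⇒< 1≤n (n≢1 ∘ sym))))
                                          (≤-reflexive (sym length-tiling)))

  module Order (1≤m : 1 ≤ m) (1≤n : 1 ≤ n) where

    corner : Cell
    corner = missing (fromℕ< 1≤m , fromℕ< 1≤n)

    byCorner : DecTotalOrder 0ℓ 0ℓ 0ℓ
    byCorner = On.decTotalOrder ≤-decTotalOrder (λ (A : Fin N) → pt A corner)

    open Sort byCorner using (sort; sort-↭; sort-↗)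

    all-sorted : ∀ A → A ∈ sort (allFin N)
    all-sorted A = ∈-resp-↭ (↭-sym (sort-↭ (allFin N))) (∈-allFin {n = N} A)

    corner-sorted : AllPairs (λ A B → pt A corner ≤ pt B corner) (sort (allFin N))
    corner-sorted = Sorted⇒AllPairs (DecTotalOrder.totalOrder byCorner) (sort-↗ (allFin N))

    tiling-functional : ∀ {ℓ} → ℓ ∈ dominoFunctionals (List.lookup tiling) → ℓ ∈ functionals
    tiling-functional ℓ∈ with find (∈-concatMap⁻ _ {xs = allFin (length tiling)} ℓ∈)
    ... | t , _ , here refl                 = domino∈ (tiling⊆ (∈-lookup {xs = tiling} t))
    ... | t , _ , there (here refl)         = cell∈ _
    ... | t , _ , there (there (here refl)) = cell∈ _

    tiling-decompose : ∀ As Bs e → length As ≡ e + length Bs → (∀ c → total Bs c ≤ total As c) →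
      ∃[ Cs ] (length Cs ≡ e × (∀ c → total (Bs ++ Cs) c ≡ total As c) ×
               (∀ {ℓ} → ℓ ∈ dominoFunctionals (List.lookup tiling) → Balanced (λ C → ∑ (pt C) ℓ) Cs))
    tiling-decompose As Bs e len Bs≤As =
      let Cs , lenC , sums , bal = decompose As Bs Bs≤As e len in Cs , lenC , sums , bal ∘ tiling-functional

    open Core {N = N} pt corner (List.lookup tiling) (tiling-covers _)
      tiling-decompose (large 1≤m 1≤n) (sort (allFin N))
      all-sorted
      corner-sorted public

    termOrder : IsTermOrder _≼_
    termOrder = isTermOrder all-sorted

    -- Homogeneity of the toric ideal. For zero margins it would fail: the only variable would be
    -- sent to 1.
    fibre⇒degree : ¬ (r ≡ replicate m 0 × s ≡ replicate n 0) → ∀ u v → Fibre u v → degree u ≡ degree v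
    fibre⇒degree nonzero u v fib = trans (sym (length-variables u))
      (trans (total-positive nonzero {variables u} {variables v} (fibre⇒same {u} {v} fib)) (length-variables v))

    small-divisor : ¬ (r ≡ replicate m 0 × s ≡ replicate n 0) → ∀ u v → Fibre u v → v ≼ u → v ≢ u →
                    (∀ i → ¬ (1 ≤ lookup v i × 1 ≤ lookup u i)) →
                    ∃[ g ] (g Divides u × SquarefreeMonomial g × degree g ≤ length tiling × Reducible g)
    small-divisor nonzero u v fib v≼u v≢u disjoint = divisor , divides , squarefree , bounded , reducible
      where open SmallDivisor (smallDivisor u v fib (sym (fibre⇒degree nonzero u v fib)) v≼u v≢u disjoint)

mainTheorem7 : {c ℓ₁ ℓ₂ : Level} (k : HeytingField c ℓ₁ ℓ₂) →
    (m n : ℕ) → .{{_ : NonZero m}} → .{{_ : NonZero n}} →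
    (r : Vec ℕ m) (s : Vec ℕ n) → ¬ (r ≡ replicate m 0 × s ≡ replicate n 0) →
    Σ[ _≼_ ∈ Rel (Monomial (#latticePoints r s)) 0ℓ ]
    Σ[ G ∈ List (Polynomial k (#latticePoints r s)) ]
    ( IsTermOrder _≼_
    × IsReducedGröbnerBasis k _≼_ (toricIdeal k (configuration r s)) G
    × All (HasSquarefreeLeadingTerm k _≼_) G
    × All (HasDegreeAtMost k ⌊ m * n /2⌋) G )
mainTheorem7 k m n r s nonzero =
  _≼_ , basis , termOrder , isReducedGröbnerBasis , squarefree ,
  subst (λ q → All (HasDegreeAtMost k q) basis) (Grid.length-tiling m n) bounded
  where
  open Points r s
  open Order (>-nonZero⁻¹ m) (>-nonZero⁻¹ n)
  position : Fin m × Fin n → Fin (m * n)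
  position (i , j) = combine i j
  configuration≡pt : ∀ A x → lookup (configuration r s A) (position x) ≡ ℤ.+ pt A x
  configuration≡pt A (i , j) = trans (Vec.lookup-concat (matrix A) i j) (entry≡pt A i j)
  open ToricGröbner k (configuration r s) pt position (λ t → remQuot n t , Fin.combine-remQuot {m} n t)
    configuration≡pt _≼_ termOrder ≼⇒degree≤ using (module Basis)
  open Basis (length (Grid.tiling m n)) (small-divisor nonzero)
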